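{- For every $n \in \mathbb{N}$ and every $d \in \mathbb{Q}$ with $d > 1$, there exists a graph $G$ with $$ e(G) \le C\, n^{2 - 1/(\lceil d \rceil + 1)} $$ edges which is $\mathcal{H}_d(n)$-universal, where $C = C(d)$ is a constant depending only on $d$.
   Context: All graphs are finite and simple. For a graph $H$, its density is $m(H) = \max_{H' \subseteq H} e(H')/v(H')$, where $e(\cdot)$ and $v(\cdot)$ denote numbers of edges and vertices. For $d \in \mathbb{Q}$ and $n \in \mathbb{N}$, $\mathcal{H}_d(n)$ is the family of all graphs on $n$ vertices with density at most $d$. A graph $G$ is universal for a family $\mathcal{H}$ (or $\mathcal{H}$-universal) if every $H \in \mathcal{H}$ is a (not necessarily induced) subgraph of $G$. -}

module Defs where

open import Data.Bool using (Bool; true; false; if_then_else_; _∧_)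
open import Data.Nat using (ℕ; zero; suc; _<ᵇ_; _+_; _*_; _^_; _≤_; _>_)
open import Data.Fin using (Fin; toℕ)
open import Data.List using (List; map; concatMap; allFin)
open import Data.Nat.ListAction using (sum)
open import Data.Product using (Σ; ∃; _×_; _,_)
open import Data.Rational as ℚ using (ℚ)
open import Data.Integer as ℤ using (ℤ)
open import Function.Definitions using (Injective)
open import Relation.Binary.PropositionalEquality using (_≡_)

record Graph (n : ℕ) : Set where
  field
    adj    : Fin n → Fin n → Bool
    sym    : ∀ i j → adj i j ≡ adj j i
    irrefl : ∀ i → adj i i ≡ false
open Graph public

v : ∀ {n} → Graph n → ℕ
v {n} _ = n

e : ∀ {n} → Graph n → ℕ
e {n} H = sum (concatMap (λ i → map (λ j →
            if (toℕ i <ᵇ toℕ j) ∧ adj H i j then 1 else 0) (allFin n)) (allFin n))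

_⊆G_ : ∀ {k n} → Graph k → Graph n → Set
_⊆G_ {k} {n} H G = Σ (Fin k → Fin n) λ f →
  Injective _≡_ _≡_ f × (∀ i j → adj H i j ≡ true → adj G (f i) (f j) ≡ true)

DensityAtMost : ℚ → ∀ {n} → Graph n → Set
DensityAtMost d H = ∀ k (H' : Graph (suc k)) → H' ⊆G H →
  (ℚ._/_ (ℤ.+ e H') (suc k)) ℚ.≤ d

Universal : ℚ → (n : ℕ) → ∀ {N} → Graph N → Set
Universal d n G = ∀ (H : Graph n) → DensityAtMost d H → H ⊆G G

-- ⌈ d ⌉ as a natural number (d > 1 here, so ⌈d⌉ ≥ 2)
ceilℕ : ℚ → ℕ
ceilℕ d = ℤ.∣ ℚ.⌈ d ⌉ ∣

{-# OPTIONS --safe #-}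
-- Put k = ⌈d⌉ and let h be a power of 2 with h^(2k+2) ≈ n. A graph H of density at most d has
-- an orientation with outdegrees at most k. The O(n/h²) vertices of indegree at least h² (giants)
-- can be joined to everything. Those of indegree between h and h² (hubs) number O(n/h), so
-- they may be joined to each other; all remaining vertices are light.
--
-- Give every vertex a colour in [h]². A light vertex x is sent to a vertex of the host graph
-- labelled by its own colour and those of its out-neighbours, where only the first digit of a
-- hub's colour is recorded; hubs record first digits only. Two vertices of the host graph are
-- adjacent if their labels share a colour, or a first digit if one of them is a hub. A light
-- vertex thus sees a fraction O(1/h²) of the light vertices and O(1/h) of the hubs, which yields
-- O(n²/h²) = O(n^(2−1/(k+1))) edges in all, provided that no label is used more than O(1) times
-- its average.
--
-- Such a colouring is found greedily. The vertices are ordered so that each receives at most k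
-- arcs from its predecessors. For labels that are only partially determined the average load
-- exceeds the effect of one choice by a factor of order h (for hubs because k ≥ 2), which beats
-- log n, and a derandomised Chernoff bound (an exponential potential) keeps all loads within a
-- constant factor of their average. The last choice completing the label of a light vertex
-- concerns at most k + 1 vertices at a time, so by Markov's inequality half of the colours are
-- harmless for all of them.

module Submission where

open import Defs hiding (sym; v)
open import Data.Bool using (Bool; true; false; if_then_else_; _∧_; T)
import Data.Bool.Properties as Boolₚ
open import Data.Empty using (⊥; ⊥-elim)
open import Data.Fin using (Fin; toℕ)
import Data.Fin.Properties as Finₚ
open import Data.List using (List; []; _∷_; _++_; map; concatMap; length; allFin; upTo; lookup)
import Data.List.Properties as Listₚ
open import Data.List.Membership.Propositional using (_∈_; _∉_; find; lose)
open import Data.List.Membership.Propositional.Properties using (∈-lookup; ∈-∃++; ∈-concatMap⁻; ∈-map⁻; ∈-map⁺; ∈-upTo⁻; ∈-upTo⁺; ∈-++⁺ˡ; ∈-++⁺ʳ; ∈-concatMap⁺)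
open import Data.List.Relation.Binary.Permutation.Propositional as ↭ using (_↭_; prep; ↭-refl; ↭-sym; ↭-trans; ↭-reflexive)
open import Data.List.Relation.Binary.Permutation.Propositional.Properties using (shift; ↭-length; ∈-resp-↭)
open import Data.List.Relation.Unary.All using (All; []; _∷_)
open import Data.List.Relation.Unary.AllPairs using ([]; _∷_)
import Data.List.Relation.Unary.All as All
open import Data.List.Relation.Unary.Unique.Propositional using (Unique)
open import Data.List.Relation.Unary.Unique.Propositional.Properties using (allFin⁺; upTo⁺)
open import Data.List.Relation.Unary.Any using (here; there; index)
open import Data.List.Relation.Unary.Any.Properties using (lookup-index)
open import Data.Integer as ℤ using (ℤ; -[1+_])
import Data.Integer.Properties as ℤₚ
open import Data.Rational as ℚ using (ℚ; 1ℚ)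
import Data.Rational.Properties as ℚₚ
import Data.Rational.Unnormalised as ℚᵘ
import Data.Rational.Unnormalised.Properties as ℚᵘₚ
open import Data.Maybe using (Maybe; just; nothing)
import Data.Maybe.Properties as Maybeₚ
import Data.Product.Properties as ×ₚ
open import Data.Nat
open import Data.Nat.ListAction using (sum)
open import Data.Nat.Properties
open import Data.Nat.Tactic.RingSolver using (solve-∀)
open import Data.Product using (Σ; ∃; _×_; _,_; proj₁; proj₂)
open import Data.Sum using (_⊎_; inj₁; inj₂)
open import Function using (_∘_; id)
open import Relation.Binary.Definitions using (DecidableEquality; tri<; tri≈; tri>)
open import Relation.Binary.PropositionalEquality
open import Relation.Nullary using (Dec; yes; no; ¬_; does)
open import Relation.Nullary.Decidable using (_×-dec_; _⊎-dec_; ¬?; dec-true; dec-false)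

-- The labels are far from independent: colouring one hub may extend nearly `h²` light words at
-- once, all by the same mark. So words are grown mark by mark, and the load of `s ∷ bs` is compared
-- not with a fixed expectation but with the number of words that have left `bs`, which itself
-- depends on the earlier choices. The potential of a node has a gain for each arrival at `s ∷ bs`
-- and a loss for each departure from `bs`; its average over the next colour does not grow.
-- Departures from `bs` never exceed arrivals at `bs`, so load bounds pass from each word length to
-- the next, with a constant factor lost each time. A complete light word may consist of `k + 1`
-- marks of two digits each, and the number of vertices is about `h^(2k+2)`, so its average load can
-- be of order one. No logarithm is affordable there, and the potential stops one mark earlier.
-- Confining the last choice to half of the colours at most doubles the mean number of arrivals at
-- every other node; the 2 in the decay base `1 − 2/h³` pays for that.

private variable
  A B : Set
  P₁ P₂ : Set

-- Indicators of decidable propositions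

𝟙 : Dec P₁ → ℕ
𝟙 (yes _) = 1
𝟙 (no _)  = 0

𝟙≤1 : (d : Dec P₁) → 𝟙 d ≤ 1
𝟙≤1 (yes _) = ≤-refl
𝟙≤1 (no _)  = z≤n

𝟙-yes : (d : Dec P₁) → P₁ → 𝟙 d ≡ 1
𝟙-yes (yes _) p = refl
𝟙-yes (no ¬p) p = ⊥-elim (¬p p)

𝟙-no : (d : Dec P₁) → ¬ P₁ → 𝟙 d ≡ 0
𝟙-no (yes p) ¬p = ⊥-elim (¬p p)
𝟙-no (no _)  ¬p = refl

𝟙-mono : (d : Dec P₁) (d′ : Dec P₂) → (P₁ → P₂) → 𝟙 d ≤ 𝟙 d′
𝟙-mono (no _)  d′ f = z≤n
𝟙-mono (yes p) d′ f = ≤-reflexive (sym (𝟙-yes d′ (f p)))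

𝟙⁻ : (d : Dec P₁) → 0 < 𝟙 d → P₁
𝟙⁻ (yes p) _ = p

𝟙-× : (d : Dec P₁) (d′ : Dec P₂) → 𝟙 (d ×-dec d′) ≡ 𝟙 d * 𝟙 d′
𝟙-× (yes _) (yes _) = refl
𝟙-× (yes _) (no _)  = refl
𝟙-× (no _)  (yes _) = refl
𝟙-× (no _)  (no _)  = refl

0<m*n⇒0<m : ∀ m {n} → 0 < m * n → 0 < m
0<m*n⇒0<m (suc m) _ = s≤s z≤n

0<m*n⇒0<n : ∀ m {n} → 0 < m * n → 0 < n
0<m*n⇒0<n m {n} p = 0<m*n⇒0<m n (subst (0 <_) (*-comm m n) p)

-- Finite sums

+-interchange : ∀ a b c d → a + b + (c + d) ≡ a + c + (b + d)
+-interchange = solve-∀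

∑ : List A → (A → ℕ) → ℕ
∑ []       f = 0
∑ (x ∷ xs) f = f x + ∑ xs f

∑-mono∈ : ∀ (xs : List A) {f g : A → ℕ} → (∀ {x} → x ∈ xs → f x ≤ g x) → ∑ xs f ≤ ∑ xs g
∑-mono∈ []       f≤g = z≤n
∑-mono∈ (x ∷ xs) f≤g = +-mono-≤ (f≤g (here refl)) (∑-mono∈ xs (f≤g ∘ there))

∑-mono : ∀ (xs : List A) {f g : A → ℕ} → (∀ x → f x ≤ g x) → ∑ xs f ≤ ∑ xs g
∑-mono xs f≤g = ∑-mono∈ xs (λ {x} _ → f≤g x)

∑-cong∈ : ∀ (xs : List A) {f g : A → ℕ} → (∀ {x} → x ∈ xs → f x ≡ g x) → ∑ xs f ≡ ∑ xs g
∑-cong∈ xs f≡g = ≤-antisym (∑-mono∈ xs (≤-reflexive ∘ f≡g)) (∑-mono∈ xs (≤-reflexive ∘ sym ∘ f≡g))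

∑-cong : ∀ (xs : List A) {f g : A → ℕ} → (∀ x → f x ≡ g x) → ∑ xs f ≡ ∑ xs g
∑-cong xs f≡g = ∑-cong∈ xs (λ {x} _ → f≡g x)

∑-+ : ∀ (xs : List A) (f g : A → ℕ) → ∑ xs (λ x → f x + g x) ≡ ∑ xs f + ∑ xs g
∑-+ []       f g = refl
∑-+ (x ∷ xs) f g rewrite ∑-+ xs f g = +-interchange (f x) (g x) (∑ xs f) (∑ xs g)

∑-*ˡ : ∀ (xs : List A) c (f : A → ℕ) → ∑ xs (λ x → c * f x) ≡ c * ∑ xs f
∑-*ˡ []       c f = sym (*-zeroʳ c)
∑-*ˡ (x ∷ xs) c f rewrite ∑-*ˡ xs c f = sym (*-distribˡ-+ c (f x) _)

∑-*ʳ : ∀ (xs : List A) c (f : A → ℕ) → ∑ xs (λ x → f x * c) ≡ ∑ xs f * c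
∑-*ʳ []       c f = refl
∑-*ʳ (x ∷ xs) c f rewrite ∑-*ʳ xs c f = sym (*-distribʳ-+ c (f x) _)

∑-const : ∀ (xs : List A) c → ∑ xs (λ _ → c) ≡ length xs * c
∑-const []       c = refl
∑-const (x ∷ xs) c = cong (c +_) (∑-const xs c)

∑-zero : ∀ (xs : List A) → ∑ xs (λ _ → 0) ≡ 0
∑-zero xs = trans (∑-const xs 0) (*-zeroʳ (length xs))

∑-bound : ∀ (xs : List A) {f : A → ℕ} c → (∀ {x} → x ∈ xs → f x ≤ c) → ∑ xs f ≤ length xs * c
∑-bound xs c f≤c = ≤-trans (∑-mono∈ xs f≤c) (≤-reflexive (∑-const xs c))

∑-swap : ∀ (xs : List A) (ys : List B) (f : A → B → ℕ) →
         ∑ xs (λ x → ∑ ys (f x)) ≡ ∑ ys (λ y → ∑ xs (λ x → f x y))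
∑-swap []       ys f = sym (∑-zero ys)
∑-swap (x ∷ xs) ys f = trans (cong (∑ ys (f x) +_) (∑-swap xs ys f))
                             (sym (∑-+ ys (f x) (λ y → ∑ xs (λ x → f x y))))

∑-++ : ∀ (xs ys : List A) (f : A → ℕ) → ∑ (xs ++ ys) f ≡ ∑ xs f + ∑ ys f
∑-++ []       ys f = refl
∑-++ (x ∷ xs) ys f = trans (cong (f x +_) (∑-++ xs ys f)) (sym (+-assoc (f x) _ _))

∑-map : ∀ (xs : List A) (h : A → B) (f : B → ℕ) → ∑ (map h xs) f ≡ ∑ xs (f ∘ h)
∑-map []       h f = refl
∑-map (x ∷ xs) h f = cong (f (h x) +_) (∑-map xs h f)

∑-concatMap : ∀ (xs : List A) (h : A → List B) (f : B → ℕ) →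
              ∑ (concatMap h xs) f ≡ ∑ xs (λ x → ∑ (h x) f)
∑-concatMap []       h f = refl
∑-concatMap (x ∷ xs) h f = trans (∑-++ (h x) (concatMap h xs) f) (cong (∑ (h x) f +_) (∑-concatMap xs h f))

∑-∈ : ∀ {xs : List A} (f : A → ℕ) {x} → x ∈ xs → f x ≤ ∑ xs f
∑-∈ f (here refl) = m≤m+n _ _
∑-∈ f (there {x = y} p) = ≤-trans (∑-∈ f p) (m≤n+m _ (f y))

∑-positive : ∀ (xs : List A) (f : A → ℕ) → 0 < ∑ xs f → ∃ λ x → x ∈ xs × 0 < f x
∑-positive (x ∷ xs) f p with f x in eq
... | suc _ = x , here refl , subst (0 <_) (sym eq) (s≤s z≤n)
... | zero  with ∑-positive xs f p
...   | y , y∈ , q = y , there y∈ , q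

-- If `f` exceeded `c` wherever the weight is positive, the weighted sum would be too large. Weights
-- 0 and 1 confine the choice to admissible elements; this is how a colour is found that is harmless
-- and also no worse than average.
∑-average : ∀ (xs : List A) (w f : A → ℕ) c → 0 < ∑ xs w →
            ∑ xs (λ x → w x * f x) ≤ ∑ xs w * c → ∃ λ x → x ∈ xs × 0 < w x × f x ≤ c
∑-average (x ∷ xs) w f c 0<w le with w x in eq
... | zero with ∑-average xs w f c 0<w le
...   | y , y∈ , r = y , there y∈ , r
∑-average (x ∷ xs) w f c 0<w le | suc a with f x ≤? c
... | yes q = x , here refl , subst (0 <_) (sym eq) (s≤s z≤n) , q
... | no  q with 0 <? ∑ xs w
...   | yes 0<w′ with ∑-average xs w f c 0<w′ (+-cancelˡ-≤ (suc a * c) _ _ (begin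
            suc a * c + ∑ xs (λ x → w x * f x)   ≤⟨ +-monoˡ-≤ _ (*-monoʳ-≤ (suc a) (<⇒≤ (≰⇒> q))) ⟩
            suc a * f x + ∑ xs (λ x → w x * f x) ≤⟨ le ⟩
            (suc a + ∑ xs w) * c                  ≡⟨ *-distribʳ-+ c (suc a) (∑ xs w) ⟩
            suc a * c + ∑ xs w * c                ∎))
            where open ≤-Reasoning
...     | y , y∈ , r = y , there y∈ , r
∑-average (x ∷ xs) w f c 0<w le | suc a | no q | no 0≮w′ = ⊥-elim (<-irrefl refl (begin-strict
  suc a * c <⟨ *-monoʳ-< (suc a) (≰⇒> q) ⟩
  suc a * f x ≤⟨ m≤m+n _ _ ⟩
  suc a * f x + ∑ xs (λ x → w x * f x) ≤⟨ le ⟩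
  (suc a + ∑ xs w) * c ≡⟨ cong (λ z → (suc a + z) * c) (n≤0⇒n≡0 (≮⇒≥ 0≮w′)) ⟩
  (suc a + 0) * c ≡⟨ cong (_* c) (+-identityʳ (suc a)) ⟩
  suc a * c ∎))
  where open ≤-Reasoning

∑-markov : ∀ (xs : List A) (f : A → ℕ) s → ∑ xs (λ x → 𝟙 (suc s ≤? f x)) * suc s ≤ ∑ xs f
∑-markov xs f s = ≤-trans (≤-reflexive (sym (∑-*ʳ xs (suc s) _))) (∑-mono xs pointwise)
  where
  pointwise : ∀ x → 𝟙 (suc s ≤? f x) * suc s ≤ f x
  pointwise x with suc s ≤? f x
  ... | yes p = ≤-trans (≤-reflexive (*-identityˡ (suc s))) p
  ... | no _  = z≤n

module _ (_≟_ : DecidableEquality A) where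

  -- Distinctness as a bound on multiplicities, the form that double counting uses directly and that
  -- permutations visibly preserve.
  NoRepeat : List A → Set
  NoRepeat xs = ∀ z → ∑ xs (λ x → 𝟙 (x ≟ z)) ≤ 1

  ∑-select : ∀ (xs : List A) (f : A → ℕ) {z} → z ∈ xs → f z ≤ ∑ xs (λ x → 𝟙 (z ≟ x) * f x)
  ∑-select xs f {z} z∈ = ≤-trans (≤-reflexive (sym (trans (cong (_* f z) (𝟙-yes (z ≟ z) refl)) (*-identityˡ _))))
                                 (∑-∈ (λ x → 𝟙 (z ≟ x) * f x) z∈)

  -- Each nonzero `f x` is found again at a copy of `x` in `zs`; after the sums are exchanged,
  -- `NoRepeat us` says that no entry of `zs` is charged twice.
  ∑-support : ∀ (us zs : List A) (f : A → ℕ) → NoRepeat us →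
              (∀ {x} → x ∈ us → 0 < f x → x ∈ zs) → ∑ us f ≤ ∑ zs f
  ∑-support us zs f nr supp = begin
    ∑ us f ≤⟨ ∑-mono∈ us select ⟩
    ∑ us (λ x → ∑ zs (λ z → 𝟙 (x ≟ z) * f z)) ≡⟨ ∑-swap us zs _ ⟩
    ∑ zs (λ z → ∑ us (λ x → 𝟙 (x ≟ z) * f z)) ≡⟨ ∑-cong zs (λ z → ∑-*ʳ us (f z) _) ⟩
    ∑ zs (λ z → ∑ us (λ x → 𝟙 (x ≟ z)) * f z) ≤⟨ ∑-mono zs (λ z → *-monoˡ-≤ (f z) (nr z)) ⟩
    ∑ zs (λ z → 1 * f z)                       ≡⟨ ∑-cong zs (λ z → *-identityˡ (f z)) ⟩
    ∑ zs f ∎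
    where
    open ≤-Reasoning
    select : ∀ {x} → x ∈ us → f x ≤ ∑ zs (λ z → 𝟙 (x ≟ z) * f z)
    select {x} x∈ with f x in eq
    ... | zero  = z≤n
    ... | suc _ = ≤-trans (≤-reflexive (sym eq)) (∑-select zs f (supp x∈ (subst (0 <_) (sym eq) (s≤s z≤n))))

  NoRepeat-∷ : ∀ {x xs} → x ∉ xs → NoRepeat xs → NoRepeat (x ∷ xs)
  NoRepeat-∷ {x} {xs} x∉ nr z with x ≟ z
  ... | no _  = nr z
  ... | yes refl = s≤s (≤-reflexive (trans (∑-cong∈ xs λ {y} y∈ → 𝟙-no (y ≟ x) λ { refl → x∉ y∈ }) (∑-zero xs)))

  NoRepeat-tail : ∀ {x xs} → NoRepeat (x ∷ xs) → NoRepeat xs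
  NoRepeat-tail nr z = ≤-trans (m≤n+m _ _) (nr z)

  NoRepeat-head : ∀ {x xs} → NoRepeat (x ∷ xs) → x ∉ xs
  NoRepeat-head {x} {xs} nr x∈ = <-irrefl refl (begin-strict
    1 <⟨ s≤s (s≤s z≤n) ⟩
    1 + 1 ≡⟨ cong₂ _+_ (sym (𝟙-yes (x ≟ x) refl)) (sym (𝟙-yes (x ≟ x) refl)) ⟩
    𝟙 (x ≟ x) + 𝟙 (x ≟ x) ≤⟨ +-monoʳ-≤ (𝟙 (x ≟ x)) (∑-∈ (λ y → 𝟙 (y ≟ x)) x∈) ⟩
    𝟙 (x ≟ x) + ∑ xs (λ y → 𝟙 (y ≟ x)) ≤⟨ nr x ⟩
    1 ∎)
    where open ≤-Reasoning

Unique⇒NoRepeat : ∀ (_≟_ : DecidableEquality A) {xs : List A} → Unique xs → NoRepeat _≟_ xs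
Unique⇒NoRepeat _≟_ []          z = z≤n
Unique⇒NoRepeat _≟_ (x≢ ∷ uniq) = NoRepeat-∷ _≟_ (λ x∈ → All.lookup x≢ x∈ refl) (Unique⇒NoRepeat _≟_ uniq)

NoRepeat-allFin : ∀ n → NoRepeat Finₚ._≟_ (allFin n)
NoRepeat-allFin n = Unique⇒NoRepeat Finₚ._≟_ (allFin⁺ n)

∈-allFin : ∀ {n} (i : Fin n) → i ∈ allFin n
∈-allFin = ∈-tabulate⁺
  where open import Data.List.Membership.Propositional.Properties using (∈-tabulate⁺)

length-allFin : ∀ n → length (allFin n) ≡ n
length-allFin n = length-tabulate (id {A = Fin n})
  where open import Data.List.Properties using (length-tabulate)

∑-lookup : ∀ (xs : List A) (f : A → ℕ) → ∑ (allFin (length xs)) (f ∘ lookup xs) ≡ ∑ xs f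
∑-lookup xs f = trans (sym (∑-map (allFin (length xs)) (lookup xs) f))
                      (cong (λ ys → ∑ ys f) (trans (map-tabulate id (lookup xs)) (tabulate-lookup xs)))
  where open import Data.List.Properties using (map-tabulate; tabulate-lookup)

∑≡sum : ∀ (xs : List A) (f : A → ℕ) → sum (map f xs) ≡ ∑ xs f
∑≡sum []       f = refl
∑≡sum (x ∷ xs) f = cong (f x +_) (∑≡sum xs f)

-- Exponential estimates

^-positive : ∀ m n → 0 < m → 0 < m ^ n
^-positive (suc m) n _ = m^n>0 (suc m) n

*-positive : ∀ {m n} → 0 < m → 0 < n → 0 < m * n
*-positive {suc m} {suc n} _ _ = s≤s z≤n

*-cancelˡ-≤′ : ∀ {m n} o → 0 < o → o * m ≤ o * n → m ≤ n
*-cancelˡ-≤′ (suc o) _ = *-cancelˡ-≤ (suc o)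

^-split : ∀ b {m n} → m ≤ n → b ^ m * b ^ (n ∸ m) ≡ b ^ n
^-split b {m} {n} m≤n = trans (sym (^-distribˡ-+-* b m (n ∸ m))) (cong (b ^_) (m+[n∸m]≡n m≤n))

^-distrib-* : ∀ a b n → (a * b) ^ n ≡ a ^ n * b ^ n
^-distrib-* a b zero    = refl
^-distrib-* a b (suc n) rewrite ^-distrib-* a b n = interchange a b (a ^ n) (b ^ n)
  where
  interchange : ∀ a b c d → a * b * (c * d) ≡ a * c * (b * d)
  interchange = solve-∀

-- This is `(1 + 1/q)^s ≥ 1 + s/q`. Like all estimates that follow, it is cleared of denominators so
-- that the whole argument stays in `ℕ`.
bernoulli : ∀ q s → q ^ s * (q + s) ≤ suc q ^ s * q
bernoulli q zero    = ≤-reflexive (cong (1 *_) (+-identityʳ q))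
bernoulli q (suc s) = begin
  q * q ^ s * (q + suc s)       ≡⟨ expand q s (q ^ s) ⟩
  q ^ s * (q + q * (q + s))     ≤⟨ *-monoʳ-≤ (q ^ s) (+-monoˡ-≤ (q * (q + s)) (m≤m+n q s)) ⟩
  q ^ s * (suc q * (q + s))     ≡⟨ reorder (q ^ s) (suc q) (q + s) ⟩
  suc q * (q ^ s * (q + s))     ≤⟨ *-monoʳ-≤ (suc q) (bernoulli q s) ⟩
  suc q * (suc q ^ s * q)       ≡⟨ *-assoc (suc q) (suc q ^ s) q ⟨
  suc q * suc q ^ s * q         ∎
  where
  open ≤-Reasoning
  expand : ∀ q s t → q * t * (q + suc s) ≡ t * (q + q * (q + s))
  expand = solve-∀
  reorder : ∀ a b c → a * (b * c) ≡ b * (a * c)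
  reorder = solve-∀

-- (1 + 1/2Γ)^s ≤ 1 + s/Γ for s ≤ Γ
upper-bernoulli : ∀ Γ s → s ≤ Γ → suc (2 * Γ) ^ s * Γ ≤ (2 * Γ) ^ s * (Γ + s)
upper-bernoulli Γ zero    _  = ≤-reflexive (cong (1 *_) (sym (+-identityʳ Γ)))
upper-bernoulli Γ (suc s) s< = begin
  suc (2 * Γ) * suc (2 * Γ) ^ s * Γ             ≡⟨ *-assoc (suc (2 * Γ)) (suc (2 * Γ) ^ s) Γ ⟩
  suc (2 * Γ) * (suc (2 * Γ) ^ s * Γ)           ≤⟨ *-monoʳ-≤ (suc (2 * Γ)) (upper-bernoulli Γ s (<⇒≤ s<)) ⟩
  suc (2 * Γ) * ((2 * Γ) ^ s * (Γ + s))         ≡⟨ expand (2 * Γ) ((2 * Γ) ^ s) (Γ + s) ⟩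
  (2 * Γ) ^ s * (Γ + s + 2 * Γ * (Γ + s))
    ≤⟨ *-monoʳ-≤ ((2 * Γ) ^ s) (+-monoˡ-≤ (2 * Γ * (Γ + s)) (+-monoʳ-≤ Γ (<⇒≤ s<))) ⟩
  (2 * Γ) ^ s * (Γ + Γ + 2 * Γ * (Γ + s))       ≡⟨ collect Γ s ((2 * Γ) ^ s) ⟩
  2 * Γ * (2 * Γ) ^ s * (Γ + suc s)             ∎
  where
  open ≤-Reasoning
  expand : ∀ a t c → suc a * (t * c) ≡ t * (c + a * c)
  expand = solve-∀
  collect : ∀ Γ s t → t * (Γ + Γ + 2 * Γ * (Γ + s)) ≡ 2 * Γ * t * (Γ + suc s)
  collect = solve-∀

-- (1 − 2/Λ)^y (1 + 2y/Λ) ≤ 1, where Λ = 2 + R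
decay-upper : ∀ R y → R ^ y * (2 + R + 2 * y) ≤ (2 + R) ^ y * (2 + R)
decay-upper R zero    = ≤-reflexive (cong (1 *_) (+-identityʳ (2 + R)))
decay-upper R (suc y) = begin
  R * R ^ y * (2 + R + 2 * suc y)     ≡⟨ reorder R (R ^ y) (2 + R + 2 * suc y) ⟩
  R ^ y * (R * (2 + R + 2 * suc y))
    ≤⟨ *-monoʳ-≤ (R ^ y) (m+n≤o⇒m≤o (R * (2 + R + 2 * suc y)) (≤-reflexive (slack R y))) ⟩
  R ^ y * ((2 + R) * (2 + R + 2 * y)) ≡⟨ reorder′ (R ^ y) (2 + R) (2 + R + 2 * y) ⟩
  (2 + R) * (R ^ y * (2 + R + 2 * y)) ≤⟨ *-monoʳ-≤ (2 + R) (decay-upper R y) ⟩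
  (2 + R) * ((2 + R) ^ y * (2 + R))   ≡⟨ *-assoc (2 + R) ((2 + R) ^ y) (2 + R) ⟨
  (2 + R) * (2 + R) ^ y * (2 + R)     ∎
  where
  open ≤-Reasoning
  reorder : ∀ a b c → a * b * c ≡ b * (a * c)
  reorder = solve-∀
  reorder′ : ∀ a b c → a * (b * c) ≡ b * (a * c)
  reorder′ = solve-∀
  slack : ∀ R y → R * (2 + R + 2 * suc y) + (4 + 4 * y) ≡ (2 + R) * (2 + R + 2 * y)
  slack = solve-∀

-- Bernoulli's inequality `(1 − 2/Λ)^x ≥ 1 − 2x/Λ` with `Λ = 2 + R`; the subtracted term stands on
-- the other side to avoid truncated subtraction.
decay-lower : ∀ R x → (2 + R) ^ x * (2 + R) ≤ R ^ x * (2 + R) + 2 * x * (2 + R) ^ x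
decay-lower R zero    = m≤m+n _ 0
decay-lower R (suc x) = begin
  Λ * p * Λ                                   ≡⟨ expand R p ⟩
  R * (p * Λ) + 2 * (Λ * p)                   ≤⟨ +-monoˡ-≤ (2 * (Λ * p)) (*-monoʳ-≤ R (decay-lower R x)) ⟩
  R * (R ^ x * Λ + 2 * x * p) + 2 * (Λ * p)   ≤⟨ m≤m+n _ (4 * x * p) ⟩
  R * (R ^ x * Λ + 2 * x * p) + 2 * (Λ * p) + 4 * x * p ≡⟨ collect R x p (R ^ x) ⟩
  R * R ^ x * Λ + 2 * suc x * (Λ * p)         ∎
  where
  open ≤-Reasoning
  Λ p : ℕ
  Λ = 2 + R
  p = Λ ^ x
  expand : ∀ R p → (2 + R) * p * (2 + R) ≡ R * (p * (2 + R)) + 2 * ((2 + R) * p)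
  expand = solve-∀
  collect : ∀ R x p r → R * (r * (2 + R) + 2 * x * p) + 2 * ((2 + R) * p) + 4 * x * p
                        ≡ R * r * (2 + R) + 2 * suc x * ((2 + R) * p)
  collect = solve-∀

decay-half : ∀ R x → 0 < x → 4 * x ≡ 2 + R → (2 + R) ^ x ≤ 2 * R ^ x
decay-half R x 0<x eq = *-cancelˡ-≤′ (2 * x) (*-positive {2} (s≤s z≤n) 0<x) (+-cancelʳ-≤ (2 * x * p) _ _ (begin
  2 * x * p + 2 * x * p        ≡⟨ double x p ⟩
  p * (4 * x)                  ≡⟨ cong (p *_) eq ⟩
  p * (2 + R)                  ≤⟨ decay-lower R x ⟩
  R ^ x * (2 + R) + 2 * x * p  ≡⟨ cong (λ z → R ^ x * z + 2 * x * p) eq ⟨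
  R ^ x * (4 * x) + 2 * x * p  ≡⟨ cong (_+ 2 * x * p) (reorder x (R ^ x)) ⟩
  2 * x * (2 * R ^ x) + 2 * x * p ∎))
  where
  open ≤-Reasoning
  p : ℕ
  p = (2 + R) ^ x
  double : ∀ x p → 2 * x * p + 2 * x * p ≡ p * (4 * x)
  double = solve-∀
  reorder : ∀ x r → r * (4 * x) ≡ 2 * x * (2 * r)
  reorder = solve-∀

-- By Bernoulli, `Q` factors `1 + 1/Q` amount to at least a doubling, and `a` contains `X` such
-- blocks.
growth-double : ∀ Q X → 0 < Q → ∀ {a} → Q * X ≤ a → 2 ^ X * Q ^ a ≤ suc Q ^ a
growth-double Q X 0<Q {a} le = begin
  2 ^ X * Q ^ a                          ≡⟨ cong (2 ^ X *_) (^-split Q le) ⟨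
  2 ^ X * (Q ^ (Q * X) * Q ^ (a ∸ Q * X)) ≡⟨ *-assoc (2 ^ X) _ _ ⟨
  2 ^ X * Q ^ (Q * X) * Q ^ (a ∸ Q * X)  ≤⟨ *-mono-≤ main (^-monoˡ-≤ (a ∸ Q * X) (n≤1+n Q)) ⟩
  suc Q ^ (Q * X) * suc Q ^ (a ∸ Q * X)  ≡⟨ ^-split (suc Q) le ⟩
  suc Q ^ a                              ∎
  where
  open ≤-Reasoning
  base : 2 * Q ^ Q ≤ suc Q ^ Q
  base = *-cancelˡ-≤′ Q 0<Q (begin
    Q * (2 * Q ^ Q)   ≡⟨ reorder Q (Q ^ Q) ⟩
    Q ^ Q * (Q + Q)   ≤⟨ bernoulli Q Q ⟩
    suc Q ^ Q * Q     ≡⟨ *-comm _ Q ⟩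
    Q * suc Q ^ Q     ∎)
    where
    reorder : ∀ q t → q * (2 * t) ≡ t * (q + q)
    reorder = solve-∀
  main : 2 ^ X * Q ^ (Q * X) ≤ suc Q ^ (Q * X)
  main = begin
    2 ^ X * Q ^ (Q * X)   ≡⟨ cong (2 ^ X *_) (^-*-assoc Q Q X) ⟨
    2 ^ X * (Q ^ Q) ^ X   ≡⟨ ^-distrib-* 2 (Q ^ Q) X ⟨
    (2 * Q ^ Q) ^ X       ≤⟨ ^-monoˡ-≤ X base ⟩
    (suc Q ^ Q) ^ X       ≡⟨ ^-*-assoc (suc Q) Q X ⟩
    suc Q ^ (Q * X)       ∎

-- The counterpart for the decay: each of `Y` blocks of length `Λ/4` costs at most a factor 2.
decay-bound : ∀ R x Y → 0 < x → 0 < R → 4 * x ≡ 2 + R → ∀ {b} → b ≤ x * Y → (2 + R) ^ b ≤ 2 ^ Y * R ^ b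
decay-bound R x Y 0<x 0<R eq {b} le = *-cancelˡ-≤′ (R ^ (x * Y)) (^-positive R (x * Y) 0<R) (begin
  R ^ (x * Y) * Λ ^ b                    ≡⟨ cong (_* Λ ^ b) (^-split R le) ⟨
  R ^ b * R ^ c * Λ ^ b
    ≤⟨ *-monoˡ-≤ (Λ ^ b) (*-monoʳ-≤ (R ^ b) (^-monoˡ-≤ c (≤-trans (n≤1+n R) (n≤1+n (suc R))))) ⟩
  R ^ b * Λ ^ c * Λ ^ b                  ≡⟨ reorder (R ^ b) (Λ ^ c) (Λ ^ b) ⟩
  R ^ b * (Λ ^ b * Λ ^ c)                ≡⟨ cong (R ^ b *_) (^-split Λ le) ⟩
  R ^ b * Λ ^ (x * Y)                    ≡⟨ cong (R ^ b *_) (^-*-assoc Λ x Y) ⟨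
  R ^ b * (Λ ^ x) ^ Y                    ≤⟨ *-monoʳ-≤ (R ^ b) (^-monoˡ-≤ Y (decay-half R x 0<x eq)) ⟩
  R ^ b * (2 * R ^ x) ^ Y                ≡⟨ cong (R ^ b *_) (^-distrib-* 2 (R ^ x) Y) ⟩
  R ^ b * (2 ^ Y * (R ^ x) ^ Y)          ≡⟨ cong (λ t → R ^ b * (2 ^ Y * t)) (^-*-assoc R x Y) ⟩
  R ^ b * (2 ^ Y * R ^ (x * Y))          ≡⟨ reorder′ (R ^ b) (2 ^ Y) (R ^ (x * Y)) ⟩
  R ^ (x * Y) * (2 ^ Y * R ^ b)          ∎)
  where
  open ≤-Reasoning
  Λ c : ℕ
  Λ = 2 + R
  c = x * Y ∸ b
  reorder : ∀ a b c → a * b * c ≡ a * (c * b)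
  reorder = solve-∀
  reorder′ : ∀ a b c → a * (b * c) ≡ c * (b * a)
  reorder′ = solve-∀

-- If (1 + 1/2Γ)^a (1 − 2/Λ)^b ≤ 2^ℓ with b ≤ (Λ/4) Y, then a < 2Γ (ℓ + Y + 1).
potential-bound : ∀ Γ R x ℓ Y a b → 0 < Γ → 0 < x → 0 < R → 4 * x ≡ 2 + R → b ≤ x * Y →
                  suc (2 * Γ) ^ a * R ^ b ≤ 2 ^ ℓ * ((2 * Γ) ^ a * (2 + R) ^ b) →
                  a < 2 * Γ * (ℓ + Y + 1)
-- Otherwise the growth would contribute a factor `2^(ℓ+Y+1)`, of which the decay takes back at most
-- `2^Y`; the extra 1 makes the conflict with `2^ℓ` strict.
potential-bound Γ R x ℓ Y a b 0<Γ 0<x 0<R eq b≤ hyp = ≰⇒> λ le → <-irrefl refl (begin-strict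
  2 ^ (ℓ + Y) * (Q ^ a * R ^ b)
    <⟨ m<m+n (2 ^ (ℓ + Y) * (Q ^ a * R ^ b)) {2 ^ (ℓ + Y) * (Q ^ a * R ^ b)} (*-positive (^-positive 2 (ℓ + Y) (s≤s z≤n)) (*-positive (^-positive Q a 0<Q) (^-positive R b 0<R))) ⟩
  2 ^ (ℓ + Y) * (Q ^ a * R ^ b) + 2 ^ (ℓ + Y) * (Q ^ a * R ^ b) ≡⟨ twice (2 ^ (ℓ + Y)) (Q ^ a) (R ^ b) ⟩
  2 * 2 ^ (ℓ + Y) * Q ^ a * R ^ b      ≡⟨ cong (λ t → 2 ^ t * Q ^ a * R ^ b) (+-comm (ℓ + Y) 1) ⟨
  2 ^ (ℓ + Y + 1) * Q ^ a * R ^ b      ≤⟨ *-monoˡ-≤ (R ^ b) (growth-double Q (ℓ + Y + 1) 0<Q le) ⟩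
  suc Q ^ a * R ^ b                    ≤⟨ hyp ⟩
  2 ^ ℓ * (Q ^ a * (2 + R) ^ b)
    ≤⟨ *-monoʳ-≤ (2 ^ ℓ) (*-monoʳ-≤ (Q ^ a) (decay-bound R x Y 0<x 0<R eq b≤)) ⟩
  2 ^ ℓ * (Q ^ a * (2 ^ Y * R ^ b))    ≡⟨ reorder (2 ^ ℓ) (Q ^ a) (2 ^ Y) (R ^ b) ⟩
  2 ^ ℓ * 2 ^ Y * (Q ^ a * R ^ b)      ≡⟨ cong (_* (Q ^ a * R ^ b)) (^-distribˡ-+-* 2 ℓ Y) ⟨
  2 ^ (ℓ + Y) * (Q ^ a * R ^ b)        ∎)
  where
  open ≤-Reasoning
  Q : ℕ
  Q = 2 * Γ
  0<Q : 0 < Q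
  0<Q = *-positive {2} (s≤s z≤n) 0<Γ
  twice : ∀ a b c → a * (b * c) + a * (b * c) ≡ 2 * a * b * c
  twice = solve-∀
  reorder : ∀ a b c d → a * (b * (c * d)) ≡ a * c * (b * d)
  reorder = solve-∀

-- One step of the potential argument: the weighted average over the choices of
-- (1 + 1/2Γ)^(v w) (1 − 2/Λ)^(z u) is at most 1.
potential-step : (xs : List A) (ω w : A → ℕ) (C v z u Γ R : ℕ) → 0 < Γ →
  (∀ x → ω x ≤ 1) → (∀ x → w x ≤ u) → (∀ {x} → x ∈ xs → v * w x ≤ Γ) → v * u ≤ C → z * u ≤ C →
  ∑ xs (λ x → 𝟙 (1 ≤? w x)) * (v * u) * (2 + R) ≤ Γ * ∑ xs ω * (2 * (z * u)) →
  ∑ xs (λ x → ω x * (suc (2 * Γ) ^ (v * w x) * (2 * Γ) ^ (C ∸ v * w x) * (R ^ (z * u) * (2 + R) ^ (C ∸ z * u))))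
    ≤ ∑ xs ω * ((2 * Γ) ^ C * (2 + R) ^ C)
potential-step xs ω w C v z u Γ R 0<Γ ω≤1 w≤u vw≤Γ vu≤C zu≤C hits =
  *-cancelˡ-≤′ (Γ * Λ) (*-positive 0<Γ (s≤s z≤n)) (begin
  Γ * Λ * ∑ xs (λ x → ω x * (p x * r))               ≡⟨ ∑-*ˡ xs (Γ * Λ) _ ⟨
  ∑ xs (λ x → Γ * Λ * (ω x * (p x * r)))             ≡⟨ ∑-cong xs (λ x → pull Γ Λ (ω x) (p x) r) ⟩
  ∑ xs (λ x → ω x * (p x * Γ) * (Λ * r))             ≡⟨ ∑-*ʳ xs (Λ * r) _ ⟩
  -- The growth is replaced by its linear bound `1 + v w/Γ`; after that, each choice with an arrival
  -- is charged the maximal `v u`, so only the number of such choices matters.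
  ∑ xs (λ x → ω x * (p x * Γ)) * (Λ * r)             ≤⟨ *-monoˡ-≤ (Λ * r) (∑-mono∈ xs pointwise) ⟩
  ∑ xs (λ x → Q ^ C * (ω x * Γ + 𝟙 (1 ≤? w x) * (v * u))) * (Λ * r) ≡⟨ cong (_* (Λ * r)) (∑-*ˡ xs (Q ^ C) _) ⟩
  Q ^ C * ∑ xs (λ x → ω x * Γ + 𝟙 (1 ≤? w x) * (v * u)) * (Λ * r)
    ≡⟨ cong (λ t → Q ^ C * t * (Λ * r)) (trans (∑-+ xs _ _) (cong₂ _+_ (∑-*ʳ xs Γ ω) (∑-*ʳ xs (v * u) _))) ⟩
  Q ^ C * (∑ω * Γ + H * (v * u)) * (Λ * r)           ≡⟨ expand (Q ^ C) (∑ω * Γ) (H * (v * u)) Λ r ⟩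
  -- By `hits` the mean linear gain is at most `2zu/Λ`, and `decay-upper` says that the decay over
  -- `z u` steps cancels it.
  Q ^ C * (∑ω * Γ * Λ + H * (v * u) * Λ) * r
    ≤⟨ *-monoˡ-≤ r (*-monoʳ-≤ (Q ^ C) (+-monoʳ-≤ (∑ω * Γ * Λ) hits)) ⟩
  Q ^ C * (∑ω * Γ * Λ + Γ * ∑ω * (2 * (z * u))) * r
    ≡⟨ collect (Q ^ C) ∑ω Γ Λ (2 * (z * u)) (R ^ (z * u)) (Λ ^ (C ∸ z * u)) ⟩
  Q ^ C * ∑ω * Γ * Λ ^ (C ∸ z * u) * (R ^ (z * u) * (Λ + 2 * (z * u)))
    ≤⟨ *-monoʳ-≤ (Q ^ C * ∑ω * Γ * Λ ^ (C ∸ z * u)) (decay-upper R (z * u)) ⟩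
  Q ^ C * ∑ω * Γ * Λ ^ (C ∸ z * u) * (Λ ^ (z * u) * Λ)
    ≡⟨ finish (Q ^ C) ∑ω Γ Λ (Λ ^ (C ∸ z * u)) (Λ ^ (z * u)) ⟩
  Γ * Λ * (∑ω * (Q ^ C * (Λ ^ (z * u) * Λ ^ (C ∸ z * u))))
    ≡⟨ cong (λ t → Γ * Λ * (∑ω * (Q ^ C * t))) (^-split Λ zu≤C) ⟩
  Γ * Λ * (∑ω * (Q ^ C * Λ ^ C))                     ∎)
  where
  open ≤-Reasoning
  Λ Q r ∑ω H : ℕ
  Λ = 2 + R
  Q = 2 * Γ
  r = R ^ (z * u) * Λ ^ (C ∸ z * u)
  ∑ω = ∑ xs ω
  H = ∑ xs (λ x → 𝟙 (1 ≤? w x))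
  p : _ → ℕ
  p x = suc Q ^ (v * w x) * Q ^ (C ∸ v * w x)
  bound : ∀ x → v * w x ≤ 𝟙 (1 ≤? w x) * (v * u)
  bound x with 1 ≤? w x
  ... | yes _ = ≤-trans (*-monoʳ-≤ v (w≤u x)) (≤-reflexive (sym (*-identityˡ _)))
  ... | no ¬p = ≤-reflexive (trans (cong (v *_) (n≤0⇒n≡0 (≮⇒≥ ¬p))) (*-zeroʳ v))
  swapʳ : ∀ a b c → a * b * c ≡ a * c * b
  swapʳ = solve-∀
  distrib : ∀ w q Γ s → w * (q * (Γ + s)) ≡ q * (w * Γ + w * s)
  distrib = solve-∀
  pull : ∀ Γ Λ w p r → Γ * Λ * (w * (p * r)) ≡ w * (p * Γ) * (Λ * r)
  pull = solve-∀
  expand : ∀ q a b Λ r → q * (a + b) * (Λ * r) ≡ q * (a * Λ + b * Λ) * r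
  expand = solve-∀
  collect : ∀ q o Γ Λ s a b → q * (o * Γ * Λ + Γ * o * s) * (a * b) ≡ q * o * Γ * b * (a * (Λ + s))
  collect = solve-∀
  finish : ∀ q o Γ Λ b a → q * o * Γ * b * (a * Λ) ≡ Γ * Λ * (o * (q * (a * b)))
  finish = solve-∀
  pointwise : ∀ {x} → x ∈ xs → ω x * (p x * Γ) ≤ Q ^ C * (ω x * Γ + 𝟙 (1 ≤? w x) * (v * u))
  pointwise {x} x∈ = begin
    ω x * (p x * Γ) ≡⟨ cong (ω x *_) (swapʳ (suc Q ^ s) (Q ^ (C ∸ s)) Γ) ⟩
    ω x * (suc Q ^ s * Γ * Q ^ (C ∸ s))
      ≤⟨ *-monoʳ-≤ (ω x) (*-monoˡ-≤ (Q ^ (C ∸ s)) (upper-bernoulli Γ s (vw≤Γ x∈))) ⟩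
    ω x * (Q ^ s * (Γ + s) * Q ^ (C ∸ s)) ≡⟨ cong (ω x *_) (swapʳ (Q ^ s) (Γ + s) (Q ^ (C ∸ s))) ⟩
    ω x * (Q ^ s * Q ^ (C ∸ s) * (Γ + s))
      ≡⟨ cong (λ t → ω x * (t * (Γ + s))) (^-split Q (≤-trans (*-monoʳ-≤ v (w≤u x)) vu≤C)) ⟩
    ω x * (Q ^ C * (Γ + s)) ≡⟨ distrib (ω x) (Q ^ C) Γ s ⟩
    Q ^ C * (ω x * Γ + ω x * s)
      ≤⟨ *-monoʳ-≤ (Q ^ C) (+-monoʳ-≤ (ω x * Γ) (≤-trans (*-monoˡ-≤ s (ω≤1 x)) (≤-trans (≤-reflexive (*-identityˡ s)) (bound x)))) ⟩
    Q ^ C * (ω x * Γ + 𝟙 (1 ≤? w x) * (v * u)) ∎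
    where
    s : ℕ
    s = v * w x

∑-mono∈-< : ∀ (xs : List A) {f g : A → ℕ} → (∀ {x} → x ∈ xs → f x ≤ g x) → ∀ {x} → x ∈ xs → f x < g x → ∑ xs f < ∑ xs g
∑-mono∈-< (x ∷ xs) f≤g (here refl) lt = +-mono-<-≤ lt (∑-mono∈ xs (f≤g ∘ there))
∑-mono∈-< (y ∷ xs) f≤g (there x∈)  lt = +-mono-≤-< (f≤g (here refl)) (∑-mono∈-< xs (f≤g ∘ there) x∈ lt)

∑-mono-< : ∀ (xs : List A) {f g : A → ℕ} → (∀ x → f x ≤ g x) → ∀ {x} → x ∈ xs → f x < g x → ∑ xs f < ∑ xs g
∑-mono-< xs f≤g = ∑-mono∈-< xs (λ {x} _ → f≤g x)

-- Edge counts as double sums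

⟦_⟧ : Bool → ℕ
⟦ true ⟧  = 1
⟦ false ⟧ = 0

if≡⟦⟧ : ∀ b → (if b then 1 else 0) ≡ ⟦ b ⟧
if≡⟦⟧ true  = refl
if≡⟦⟧ false = refl

⟦⟧⁻ : ∀ b → 0 < ⟦ b ⟧ → b ≡ true
⟦⟧⁻ true _ = refl

⟦⟧≤1 : ∀ b → ⟦ b ⟧ ≤ 1
⟦⟧≤1 true  = ≤-refl
⟦⟧≤1 false = z≤n

e≡∑ : ∀ {n} (H : Graph n) →
      e H ≡ ∑ (allFin n) (λ i → ∑ (allFin n) (λ j → ⟦ (toℕ i <ᵇ toℕ j) ∧ adj H i j ⟧))
e≡∑ {n} H = begin
  sum (concatMap row (allFin n))                  ≡⟨ cong sum (map-id (concatMap row (allFin n))) ⟨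
  sum (map id (concatMap row (allFin n)))         ≡⟨ ∑≡sum (concatMap row (allFin n)) id ⟩
  ∑ (concatMap row (allFin n)) id                 ≡⟨ ∑-concatMap (allFin n) row id ⟩
  ∑ (allFin n) (λ i → ∑ (row i) id)
    ≡⟨ ∑-cong (allFin n) (λ i → trans (∑-map (allFin n) _ id) (∑-cong (allFin n) (λ j → if≡⟦⟧ ((toℕ i <ᵇ toℕ j) ∧ adj H i j)))) ⟩
  ∑ (allFin n) (λ i → ∑ (allFin n) (λ j → ⟦ (toℕ i <ᵇ toℕ j) ∧ adj H i j ⟧)) ∎
  where
  open ≡-Reasoning
  open import Data.List.Properties using (map-id)
  row : Fin n → List ℕ
  row i = map (λ j → if (toℕ i <ᵇ toℕ j) ∧ adj H i j then 1 else 0) (allFin n)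

-- Orientations with bounded outdegree

record Orientation {n} (H : Graph n) : Set where
  field
    arc      : Fin n → Fin n → Bool
    arc⇒adj  : ∀ a b → arc a b ≡ true → adj H a b ≡ true
    adj⇒arc  : ∀ a b → adj H a b ≡ true → arc a b ≡ true ⊎ arc b a ≡ true
    asym     : ∀ a b → arc a b ≡ true → arc b a ≡ false

  outdeg : Fin n → ℕ
  outdeg a = ∑ (allFin n) (λ b → ⟦ arc a b ⟧)

  indeg : Fin n → ℕ
  indeg b = ∑ (allFin n) (λ a → ⟦ arc a b ⟧)

  arc-irrefl : ∀ a → arc a a ≡ false
  arc-irrefl a with arc a a in eq
  ... | false = refl
  ... | true  = trans (sym eq) (asym a a eq)

  arc-≢ : ∀ {a b} → arc a b ≡ true → a ≢ b
  arc-≢ {a} p refl with trans (sym p) (arc-irrefl a)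
  ... | ()

open Orientation using (arc; outdeg) public

<ᵇ-true : ∀ {m n} → m < n → (m <ᵇ n) ≡ true
<ᵇ-true {m} {n} m<n with m <ᵇ n | <⇒<ᵇ m<n
... | true | _ = refl

<ᵇ-false : ∀ {m n} → ¬ m < n → (m <ᵇ n) ≡ false
<ᵇ-false {m} {n} m≮n with m <ᵇ n in eq
... | false = refl
... | true  = ⊥-elim (m≮n (<ᵇ⇒< m n (subst T (sym eq) _)))

naturalOrientation : ∀ {n} (H : Graph n) → Orientation H
naturalOrientation {n} H = record
  { arc     = λ a b → (toℕ a <ᵇ toℕ b) ∧ adj H a b
  ; arc⇒adj = λ a b → ∧-true² (toℕ a <ᵇ toℕ b)
  ; adj⇒arc = total
  ; asym    = asym′
  }
  where
  ∧-true² : ∀ x {y} → x ∧ y ≡ true → y ≡ true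
  ∧-true² true p = p
  total : ∀ a b → adj H a b ≡ true → (toℕ a <ᵇ toℕ b) ∧ adj H a b ≡ true ⊎ (toℕ b <ᵇ toℕ a) ∧ adj H b a ≡ true
  total a b p with <-cmp (toℕ a) (toℕ b)
  ... | tri< a<b _ _ rewrite <ᵇ-true a<b = inj₁ p
  ... | tri> _ _ b<a rewrite <ᵇ-true b<a = inj₂ (trans (Graph.sym H b a) p)
  ... | tri≈ _ a≡b _ with Finₚ.toℕ-injective a≡b
  ...   | refl with trans (sym p) (irrefl H a)
  ...     | ()
  asym′ : ∀ a b → (toℕ a <ᵇ toℕ b) ∧ adj H a b ≡ true → (toℕ b <ᵇ toℕ a) ∧ adj H b a ≡ false
  asym′ a b p with toℕ a <ᵇ toℕ b in eq
  ... | true rewrite <ᵇ-false {toℕ b} {toℕ a} (<-asym (<ᵇ⇒< (toℕ a) (toℕ b) (subst T (sym eq) _))) = refl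

flipAt : Dec P₁ → Dec P₂ → Bool → Bool
flipAt (yes _) _       _ = false
flipAt (no _)  (yes _) _ = true
flipAt (no _)  (no _)  x = x

module Flip {n} {H : Graph n} (o : Orientation H) {w z : Fin n} (w→z : arc o w z ≡ true) where
  open Orientation o renaming (arc to _⇒_; outdeg to deg)

  private
    w≢z : w ≢ z
    w≢z = arc-≢ w→z

  atFwd : ∀ a b → Dec (a ≡ w × b ≡ z)
  atFwd a b = (a Finₚ.≟ w) ×-dec (b Finₚ.≟ z)

  atBwd : ∀ a b → Dec (a ≡ z × b ≡ w)
  atBwd a b = (a Finₚ.≟ z) ×-dec (b Finₚ.≟ w)

  _⇒′_ : Fin n → Fin n → Bool
  a ⇒′ b = flipAt (atFwd a b) (atBwd a b) (a ⇒ b)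

  flip : Orientation H
  flip = record { arc = _⇒′_ ; arc⇒adj = sound ; adj⇒arc = total ; asym = asym′ }
    where
    sound : ∀ a b → a ⇒′ b ≡ true → adj H a b ≡ true
    sound a b p with atFwd a b | atBwd a b
    ... | no _ | yes (refl , refl) = trans (Graph.sym H z w) (arc⇒adj w z w→z)
    ... | no _ | no _ = arc⇒adj a b p
    total : ∀ a b → adj H a b ≡ true → a ⇒′ b ≡ true ⊎ b ⇒′ a ≡ true
    total a b p with atFwd a b | atBwd a b | atFwd b a | atBwd b a
    ... | yes (refl , refl) | _ | yes (z≡w , _) | _ = ⊥-elim (w≢z (sym z≡w))
    ... | yes (refl , refl) | _ | no _ | yes _ = inj₂ refl
    ... | yes (refl , refl) | _ | no _ | no ¬q = ⊥-elim (¬q (refl , refl))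
    ... | no _ | yes _ | _ | _ = inj₁ refl
    ... | no _ | no ¬q | yes (refl , refl) | _ = ⊥-elim (¬q (refl , refl))
    ... | no _ | no _ | no _ | yes _ = inj₂ refl
    ... | no _ | no _ | no _ | no _ = adj⇒arc a b p
    asym′ : ∀ a b → a ⇒′ b ≡ true → b ⇒′ a ≡ false
    asym′ a b p with atFwd a b | atBwd a b | atFwd b a | atBwd b a
    ... | no _ | _ | yes _ | _ = refl
    ... | no _ | yes (refl , refl) | no ¬q | _ = ⊥-elim (¬q (refl , refl))
    ... | no ¬q | no _ | no _ | yes (refl , refl) = ⊥-elim (¬q (refl , refl))
    ... | no _ | no _ | no _ | no _ = asym a b p

  unchanged : ∀ {a b} → a ≢ z → b ≢ z → a ⇒′ b ≡ a ⇒ b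
  unchanged {a} {b} a≢z b≢z with atFwd a b | atBwd a b
  ... | yes (_ , b≡z) | _ = ⊥-elim (b≢z b≡z)
  ... | no _ | yes (a≡z , _) = ⊥-elim (a≢z a≡z)
  ... | no _ | no _ = refl

  outdeg-other : ∀ {a} → a ≢ w → a ≢ z → outdeg flip a ≡ deg a
  outdeg-other {a} a≢w a≢z = ∑-cong (allFin n) (λ b → cong ⟦_⟧ (same b))
    where
    same : ∀ b → a ⇒′ b ≡ a ⇒ b
    same b with atFwd a b | atBwd a b
    ... | yes (a≡w , _) | _ = ⊥-elim (a≢w a≡w)
    ... | no _ | yes (a≡z , _) = ⊥-elim (a≢z a≡z)
    ... | no _ | no _ = refl

  outdeg-tail : outdeg flip w < deg w
  outdeg-tail = begin-strict
    outdeg flip w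
      <⟨ m<m+n (outdeg flip w) (≤-trans (≤-reflexive (sym (𝟙-yes (z Finₚ.≟ z) refl))) (∑-∈ (λ b → 𝟙 (b Finₚ.≟ z)) (∈-allFin z))) ⟩
    outdeg flip w + ∑ (allFin n) (λ b → 𝟙 (b Finₚ.≟ z)) ≡⟨ ∑-+ (allFin n) _ _ ⟨
    ∑ (allFin n) (λ b → ⟦ w ⇒′ b ⟧ + 𝟙 (b Finₚ.≟ z)) ≤⟨ ∑-mono (allFin n) pointwise ⟩
    deg w ∎
    where
    open ≤-Reasoning
    pointwise : ∀ b → ⟦ w ⇒′ b ⟧ + 𝟙 (b Finₚ.≟ z) ≤ ⟦ w ⇒ b ⟧
    pointwise b with w Finₚ.≟ w | b Finₚ.≟ z | atBwd w b
    ... | no ¬q | _ | _ = ⊥-elim (¬q refl)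
    ... | yes _ | yes refl | _ rewrite w→z = ≤-refl
    ... | yes _ | no _ | yes (w≡z , _) = ⊥-elim (w≢z w≡z)
    ... | yes _ | no _ | no _ = ≤-reflexive (+-identityʳ _)

  outdeg-head : outdeg flip z ≤ suc (deg z)
  outdeg-head = begin
    outdeg flip z ≤⟨ ∑-mono (allFin n) pointwise ⟩
    ∑ (allFin n) (λ b → 𝟙 (b Finₚ.≟ w) + ⟦ z ⇒ b ⟧) ≡⟨ ∑-+ (allFin n) _ _ ⟩
    ∑ (allFin n) (λ b → 𝟙 (b Finₚ.≟ w)) + deg z ≤⟨ +-monoˡ-≤ (deg z) (NoRepeat-allFin n w) ⟩
    suc (deg z) ∎
    where
    open ≤-Reasoning
    pointwise : ∀ b → ⟦ z ⇒′ b ⟧ ≤ 𝟙 (b Finₚ.≟ w) + ⟦ z ⇒ b ⟧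
    pointwise b with atFwd z b | z Finₚ.≟ z | b Finₚ.≟ w
    ... | yes _ | _ | _ = z≤n
    ... | no _ | no ¬q | _ = ⊥-elim (¬q refl)
    ... | no _ | yes _ | yes _ = s≤s z≤n
    ... | no _ | yes _ | no _ = ≤-refl

-- Lowering outdegrees by reversing paths

module Balance {n} {H : Graph n} (k : ℕ)
  (sparse : ∀ (o : Orientation H) x S → NoRepeat Finₚ._≟_ (x ∷ S) →
            ∑ (x ∷ S) (λ a → ∑ (x ∷ S) (λ b → ⟦ arc o a b ⟧)) ≤ length (x ∷ S) * k) where

  open import Data.List.Membership.DecPropositional (Finₚ._≟_ {n}) using (_∈?_)

  excess : Orientation H → ℕ
  excess o = ∑ (allFin n) (λ a → outdeg o a ∸ k)

  -- A search tree rooted at x, listed in reverse order of discovery.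
  data Tree (o : Orientation H) (x : Fin n) : List (Fin n) → Set where
    root : Tree o x (x ∷ [])
    grow : ∀ {S w z} → Tree o x S → w ∈ S → z ∉ S → arc o w z ≡ true → Tree o x (z ∷ S)

  -- The list is a stack of discoveries, so cutting it off at `w` keeps the path from the root to
  -- `w`.
  prune : ∀ {o x S w} → Tree o x S → w ∈ S →
          ∃ λ S′ → Tree o x (w ∷ S′) × (∀ {u} → u ∈ w ∷ S′ → u ∈ S) × length (w ∷ S′) ≤ length S
  prune t@root (here refl) = [] , t , id , ≤-refl
  prune t@(grow {S} _ _ _ _) (here refl) = S , t , id , ≤-refl
  prune (grow t _ _ _) (there w∈) with prune t w∈
  ... | S′ , t′ , ⊆S , len = S′ , t′ , there ∘ ⊆S , m≤n⇒m≤1+n len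

  -- Reversing an arc into `z` changes only arcs at `z`, and the tree avoids `z`.
  transport : ∀ {o x S w z} (w→z : arc o w z ≡ true) → Tree o x S → z ∉ S → Tree (Flip.flip o w→z) x S
  transport w→z root z∉ = root
  transport {o} w→z (grow t u∈ y∉ u→y) z∉ =
    grow (transport w→z t (z∉ ∘ there)) u∈ y∉
         (trans (Flip.unchanged o w→z (λ { refl → z∉ (there u∈) }) (λ { refl → z∉ (here refl) })) u→y)

  flip-excess : ∀ (o : Orientation H) {w z} (w→z : arc o w z ≡ true) → outdeg o z < k →
                ∀ a → outdeg (Flip.flip o w→z) a ∸ k ≤ outdeg o a ∸ k
  flip-excess o {w} {z} w→z z<k a = cases (a Finₚ.≟ z) (a Finₚ.≟ w)
    where
    open Flip o w→z
    cases : Dec (a ≡ z) → Dec (a ≡ w) → outdeg flip a ∸ k ≤ outdeg o a ∸ k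
    cases (yes refl) _ = ≤-trans (≤-reflexive (m≤n⇒m∸n≡0 (≤-trans outdeg-head z<k))) z≤n
    cases (no _) (yes refl) = ∸-monoˡ-≤ k (<⇒≤ outdeg-tail)
    cases (no a≢z) (no a≢w) = ≤-reflexive (cong (_∸ k) (outdeg-other a≢w a≢z))

  -- The path from `x` to the deficient vertex `z` is reversed from its far end. Flipping `w → z`
  -- lowers the outdegree of `w`. If `w` was overloaded, the excess has dropped; if not, `w` is now
  -- deficient and takes the place of `z` in a shorter tree. Since `x` is overloaded, the first case
  -- occurs at the root at the latest.
  improve : ∀ m (o : Orientation H) x {z S} → Tree o x (z ∷ S) → length S ≤ m → k < outdeg o x → outdeg o z < k →
            ∃ λ o′ → excess o′ < excess o
  improve m o x root len k<x z<k = ⊥-elim (<-asym k<x z<k)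
  improve m o x {z} {S} (grow {w = w} t w∈ z∉ w→z) len k<x z<k with k <? outdeg o w
  ... | yes k<w = flip , ∑-mono-< (allFin n) (flip-excess o {w} {z} w→z z<k) (∈-allFin w) (∸-monoˡ-<′ outdeg-tail k<w)
    where
    open Flip o w→z
    ∸-monoˡ-<′ : ∀ {a b} → a < b → k < b → a ∸ k < b ∸ k
    ∸-monoˡ-<′ {a} {b} a<b k<b with k ≤? a
    ... | yes k≤a = ∸-monoˡ-< a<b k≤a
    ... | no k≰a = ≤-trans (s≤s (≤-reflexive (m≤n⇒m∸n≡0 (<⇒≤ (≰⇒> k≰a))))) (m<n⇒0<n∸m k<b)
  improve zero o x (grow {S = _ ∷ _} t w∈ z∉ w→z) () k<x z<k | no k≮w
  improve (suc m) o x {z} {S} (grow {w = w} t w∈ z∉ w→z) len k<x z<k | no k≮w with prune t w∈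
  ... | S′ , t′ , ⊆S , len′ with improve m flip x (transport w→z t′ (z∉ ∘ ⊆S)) (≤-pred (≤-trans len′ len))
                                  (subst (k <_) (sym (outdeg-other x≢w x≢z)) k<x) (≤-trans outdeg-tail (≮⇒≥ k≮w))
    where
    open Flip o w→z
    x≢w : x ≢ w
    x≢w refl = k≮w k<x
    x≢z : x ≢ z
    x≢z refl = <-asym k<x z<k
  ...   | o′ , lt = o′ , <-≤-trans lt (∑-mono (allFin n) (flip-excess o {w} {z} w→z z<k))

  tree-noRepeat : ∀ {o x S} → Tree o x S → NoRepeat Finₚ._≟_ S
  tree-noRepeat root           = NoRepeat-∷ Finₚ._≟_ {xs = []} (λ ()) (λ _ → z≤n)
  tree-noRepeat (grow t _ z∉ _) = NoRepeat-∷ Finₚ._≟_ z∉ (tree-noRepeat t)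

  root∈ : ∀ {o x S} → Tree o x S → x ∈ S
  root∈ root           = here refl
  root∈ (grow t _ _ _) = there (root∈ t)

  -- The tree grows until it meets a deficient vertex or no arc leaves it. In the latter case all
  -- outdegrees are realised inside the tree, are at least `k`, and exceed `k` at `x`, so the tree
  -- has too many arcs for `sparse`. The vertices of a tree are distinct, which is why the fuel
  -- suffices.
  search : ∀ fuel (o : Orientation H) x {S} → Tree o x S → n < length S + fuel → k < outdeg o x →
           (∀ {a} → a ∈ S → k ≤ outdeg o a) → ∃ λ o′ → excess o′ < excess o
  search zero o x {S} t fuel< k<x big = ⊥-elim (<-irrefl refl (begin-strict
    n                          <⟨ fuel< ⟩
    length S + 0               ≡⟨ +-identityʳ _ ⟩
    length S                   ≡⟨ *-identityʳ _ ⟨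
    length S * 1               ≡⟨ ∑-const S 1 ⟨
    ∑ S (λ _ → 1)
      ≤⟨ ∑-support Finₚ._≟_ S (allFin n) (λ _ → 1) (tree-noRepeat t) (λ _ _ → ∈-allFin _) ⟩
    ∑ (allFin n) (λ _ → 1)     ≡⟨ ∑-const (allFin n) 1 ⟩
    length (allFin n) * 1      ≡⟨ *-identityʳ _ ⟩
    length (allFin n)          ≡⟨ length-allFin n ⟩
    n                          ∎))
    where open ≤-Reasoning
  search (suc fuel) o x {S} t fuel< k<x big with 0 <? ∑ S (λ w → ∑ (allFin n) (λ z → ⟦ arc o w z ⟧ * 𝟙 (¬? (z ∈? S))))
  ... | yes 0<∑ with ∑-positive S _ 0<∑
  ...   | w , w∈ , 0<∑′ with ∑-positive (allFin n) _ 0<∑′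
  ...     | z , _ , 0<t with ⟦⟧⁻ (arc o w z) (0<m*n⇒0<m _ 0<t) | 𝟙⁻ (¬? (z ∈? S)) (0<m*n⇒0<n ⟦ arc o w z ⟧ 0<t) | k ≤? outdeg o z
  ...       | w→z | z∉ | no k≰z = improve (length S) o x (grow t w∈ z∉ w→z) ≤-refl k<x (≰⇒> k≰z)
  ...       | w→z | z∉ | yes k≤z = search fuel o x (grow t w∈ z∉ w→z) (≤-trans fuel< (≤-reflexive (+-suc (length S) fuel))) k<x
                                     (λ { (here refl) → k≤z ; (there a∈) → big a∈ })
  search (suc fuel) o x {[]} () fuel< k<x big | no ¬0<∑
  search (suc fuel) o x {y ∷ S} t fuel< k<x big | no ¬0<∑ = ⊥-elim (<-irrefl refl (begin-strict
    length (y ∷ S) * k ≡⟨ ∑-const (y ∷ S) k ⟨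
    ∑ (y ∷ S) (λ _ → k) <⟨ ∑-mono∈-< (y ∷ S) big (root∈ t) k<x ⟩
    ∑ (y ∷ S) (outdeg o)
      ≤⟨ ∑-mono∈ (y ∷ S) (λ a∈ → ∑-support Finₚ._≟_ (allFin n) (y ∷ S) _ (NoRepeat-allFin n) (λ {b} _ → closed a∈ b)) ⟩
    ∑ (y ∷ S) (λ a → ∑ (y ∷ S) (λ b → ⟦ arc o a b ⟧)) ≤⟨ sparse o y S (tree-noRepeat t) ⟩
    length (y ∷ S) * k ∎))
    where
    open ≤-Reasoning
    closed : ∀ {a} → a ∈ y ∷ S → ∀ b → 0 < ⟦ arc o a b ⟧ → b ∈ y ∷ S
    closed {a} a∈ b 0<arc with b ∈? (y ∷ S)
    ... | yes b∈ = b∈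
    ... | no b∉ = ⊥-elim (¬0<∑ (begin-strict
      0 <⟨ *-positive 0<arc (≤-reflexive (sym (𝟙-yes (¬? (b ∈? (y ∷ S))) b∉))) ⟩
      ⟦ arc o a b ⟧ * 𝟙 (¬? (b ∈? (y ∷ S)))
        ≤⟨ ∑-∈ (λ b → ⟦ arc o a b ⟧ * 𝟙 (¬? (b ∈? (y ∷ S)))) (∈-allFin b) ⟩
      ∑ (allFin n) (λ b → ⟦ arc o a b ⟧ * 𝟙 (¬? (b ∈? (y ∷ S))))
        ≤⟨ ∑-∈ (λ a → ∑ (allFin n) (λ b → ⟦ arc o a b ⟧ * 𝟙 (¬? (b ∈? (y ∷ S))))) a∈ ⟩
      ∑ (y ∷ S) (λ a → ∑ (allFin n) (λ b → ⟦ arc o a b ⟧ * 𝟙 (¬? (b ∈? (y ∷ S))))) ∎))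

  balance : ∀ m o → excess o ≤ m → ∃ λ (o′ : Orientation H) → ∀ a → outdeg o′ a ≤ k
  balance m o ≤m with 0 <? excess o
  balance m o ≤m | no ¬0< = o , λ a → m∸n≡0⇒m≤n (n≤0⇒n≡0 (≤-trans (∑-∈ (λ a → outdeg o a ∸ k) (∈-allFin a)) (≮⇒≥ ¬0<)))
  balance zero o ≤m | yes 0<ex = ⊥-elim (<-irrefl refl (≤-trans 0<ex ≤m))
  balance (suc m) o ≤m | yes 0<ex with ∑-positive (allFin n) _ 0<ex
  ... | x , _ , 0<x with search n o x root (n<1+n n) (m<n∸o⇒ 0<x) (λ { (here refl) → <⇒≤ (m<n∸o⇒ 0<x) })
    where
    m<n∸o⇒ : ∀ {b} → 0 < b ∸ k → k < b
    m<n∸o⇒ {b} p = ≰⇒> (λ b≤k → <-irrefl refl (≤-trans p (≤-reflexive (m≤n⇒m∸n≡0 b≤k))))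
  ...   | o′ , lt = balance m o′ (≤-pred (≤-trans lt ≤m))

-- Induced subgraphs

lookup-injective : ∀ (_≟_ : DecidableEquality A) {xs : List A} → NoRepeat _≟_ xs →
                   ∀ {i j} → lookup xs i ≡ lookup xs j → i ≡ j
lookup-injective _≟_ {x ∷ xs} nr {Fin.zero}  {Fin.zero}  eq = refl
lookup-injective _≟_ {x ∷ xs} nr {Fin.zero}  {Fin.suc j} eq = ⊥-elim (NoRepeat-head _≟_ {xs = xs} nr (subst (_∈ xs) (sym eq) (∈-lookup j)))
lookup-injective _≟_ {x ∷ xs} nr {Fin.suc i} {Fin.zero}  eq = ⊥-elim (NoRepeat-head _≟_ {xs = xs} nr (subst (_∈ xs) eq (∈-lookup i)))
lookup-injective _≟_ {x ∷ xs} nr {Fin.suc i} {Fin.suc j} eq = cong Fin.suc (lookup-injective _≟_ {xs} (NoRepeat-tail _≟_ {x = x} {xs} nr) eq)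

module _ {n} (H : Graph n) where

  induced : (x : Fin n) (S : List (Fin n)) → Graph (suc (length S))
  induced x S = record
    { adj    = λ i j → adj H (lookup (x ∷ S) i) (lookup (x ∷ S) j)
    ; sym    = λ i j → Graph.sym H _ _
    ; irrefl = λ i → irrefl H _ }

  induced-⊆ : ∀ x S → NoRepeat Finₚ._≟_ (x ∷ S) → induced x S ⊆G H
  induced-⊆ x S nr = lookup (x ∷ S) , lookup-injective Finₚ._≟_ nr , λ i j p → p

  -- An arc is charged to the pair of positions of its ends. `up` and `down` are its two possible
  -- directions seen from the smaller position, and by asymmetry at most one of them is present.
  arcs≤edges : ∀ (o : Orientation H) x S →
               ∑ (x ∷ S) (λ a → ∑ (x ∷ S) (λ b → ⟦ arc o a b ⟧)) ≤ e (induced x S)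
  arcs≤edges o x S = begin
    ∑ xs (λ a → ∑ xs (λ b → ⟦ arc o a b ⟧))                        ≡⟨ ∑-lookup xs _ ⟨
    ∑ Is (λ i → ∑ xs (λ b → ⟦ arc o (s i) b ⟧))
      ≡⟨ ∑-cong Is (λ i → ∑-lookup xs (λ b → ⟦ arc o (s i) b ⟧)) ⟨
    ∑ Is (λ i → ∑ Is (λ j → ⟦ arc o (s i) (s j) ⟧))
      ≤⟨ ∑-mono Is (λ i → ∑-mono Is (λ j → split i j)) ⟩
    ∑ Is (λ i → ∑ Is (λ j → up i j + down j i))
      ≡⟨ ∑-cong Is (λ i → ∑-+ Is (up i) (λ j → down j i)) ⟩
    ∑ Is (λ i → ∑ Is (up i) + ∑ Is (λ j → down j i))
      ≡⟨ ∑-+ Is (λ i → ∑ Is (up i)) (λ i → ∑ Is (λ j → down j i)) ⟩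
    ∑ Is (λ i → ∑ Is (up i)) + ∑ Is (λ i → ∑ Is (λ j → down j i))
      ≡⟨ cong (∑ Is (λ i → ∑ Is (up i)) +_) (∑-swap Is Is (λ i j → down j i)) ⟩
    ∑ Is (λ i → ∑ Is (up i)) + ∑ Is (λ i → ∑ Is (down i))
      ≡⟨ ∑-+ Is (λ i → ∑ Is (up i)) (λ i → ∑ Is (down i)) ⟨
    ∑ Is (λ i → ∑ Is (up i) + ∑ Is (down i))
      ≡⟨ ∑-cong Is (λ i → ∑-+ Is (up i) (down i)) ⟨
    ∑ Is (λ i → ∑ Is (λ j → up i j + down i j))
      ≤⟨ ∑-mono Is (λ i → ∑-mono Is (λ j → merge i j)) ⟩
    ∑ Is (λ i → ∑ Is (λ j → ⟦ (toℕ i <ᵇ toℕ j) ∧ adj H (s i) (s j) ⟧)) ≡⟨ e≡∑ (induced x S) ⟨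
    e (induced x S) ∎
    where
    open ≤-Reasoning
    xs : List (Fin n)
    xs = x ∷ S
    Is : List (Fin (length xs))
    Is = allFin (length xs)
    s : Fin (length xs) → Fin n
    s = lookup xs
    up down : Fin (length xs) → Fin (length xs) → ℕ
    up i j = ⟦ (toℕ i <ᵇ toℕ j) ∧ arc o (s i) (s j) ⟧
    down i j = ⟦ (toℕ i <ᵇ toℕ j) ∧ arc o (s j) (s i) ⟧
    split : ∀ i j → ⟦ arc o (s i) (s j) ⟧ ≤ up i j + down j i
    split i j with <-cmp (toℕ i) (toℕ j)
    ... | tri< i<j _ _ rewrite <ᵇ-true i<j = m≤m+n _ _
    ... | tri> _ _ j<i rewrite <ᵇ-true j<i = m≤n+m _ (up i j)
    ... | tri≈ _ i≡j _ rewrite Finₚ.toℕ-injective i≡j | Orientation.arc-irrefl o (s j) = z≤n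
    merge : ∀ i j → up i j + down i j ≤ ⟦ (toℕ i <ᵇ toℕ j) ∧ adj H (s i) (s j) ⟧
    merge i j with toℕ i <ᵇ toℕ j
    ... | false = z≤n
    ... | true with arc o (s i) (s j) in eq | arc o (s j) (s i) in eq′
    ...   | false | false = z≤n
    ...   | true  | false rewrite Orientation.arc⇒adj o _ _ eq = ≤-refl
    ...   | false | true  rewrite Graph.sym H (s i) (s j) | Orientation.arc⇒adj o _ _ eq′ = ≤-refl
    ...   | true  | true with trans (sym eq′) (Orientation.asym o _ _ eq)
    ...     | ()

-- Density and elimination orders

-- The ceiling unfolds to minus the floor of `− d`, hence the division of a negative numerator;
-- dropping the nonnegative remainder gives the upper bound.
ceil-property : ∀ d → 1ℚ ℚ.< d → ∃ λ N → ℚ.numerator d ≡ ℤ.+ N × suc (ℚ.denominator-1 d) < N × N ≤ ceilℕ d * suc (ℚ.denominator-1 d)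
ceil-property (ℚ.mkℚ -[1+ a ] D-1 _) (ℚ.*<* ())
ceil-property (ℚ.mkℚ (ℤ.+ zero) D-1 _) (ℚ.*<* (ℤ.+<+ ()))
ceil-property d@(ℚ.mkℚ (ℤ.+ suc a) D-1 _) (ℚ.*<* lt) =
  suc a , refl , ℤₚ.drop‿+<+ (subst₂ ℤ._<_ (ℤₚ.*-identityˡ D) (ℤₚ.*-identityʳ (ℤ.+ suc a)) lt) , ℤₚ.drop‿+≤+ (begin
  ℤ.+ suc a                       ≡⟨⟩
  ℤ.- -[1+ a ]                    ≡⟨ cong ℤ.-_ (a≡a%n+[a/n]*n -[1+ a ] D) ⟩
  ℤ.- (r ℤ.+ q ℤ.* D)             ≡⟨ ℤₚ.neg-distrib-+ r (q ℤ.* D) ⟩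
  ℤ.- r ℤ.+ ℤ.- (q ℤ.* D)
    ≤⟨ ℤₚ.+-monoˡ-≤ (ℤ.- (q ℤ.* D)) (ℤₚ.neg-≤-pos {m = -[1+ a ] ℤ.% D} {n = 0}) ⟩
  ℤ.+ 0 ℤ.+ ℤ.- (q ℤ.* D)         ≡⟨ ℤₚ.+-identityˡ _ ⟩
  ℤ.- (q ℤ.* D)                   ≡⟨ ℤₚ.neg-distribˡ-* q D ⟩
  ℤ.- q ℤ.* D                     ≤⟨ ℤₚ.*-monoʳ-≤-nonNeg D (i≤∣i∣ (ℤ.- q)) ⟩
  ℤ.+ ℤ.∣ ℤ.- q ∣ ℤ.* D           ≡⟨ ℤₚ.pos-* ℤ.∣ ℤ.- q ∣ (suc D-1) ⟨
  ℤ.+ (ceilℕ d * suc D-1)         ∎)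
  where
  open ℤₚ.≤-Reasoning
  open import Data.Integer.DivMod using (a≡a%n+[a/n]*n)
  D q r : ℤ
  D = ℤ.+ suc D-1
  q = -[1+ a ] ℤ./ D
  r = ℤ.+ (-[1+ a ] ℤ.% D)
  i≤∣i∣ : ∀ i → i ℤ.≤ ℤ.+ ℤ.∣ i ∣
  i≤∣i∣ (ℤ.+ _)  = ℤₚ.≤-refl
  i≤∣i∣ -[1+ _ ] = ℤ.-≤+

2≤ceilℕ : ∀ d → 1ℚ ℚ.< d → 2 ≤ ceilℕ d
2≤ceilℕ d 1<d with ceil-property d 1<d
... | N , _ , D<N , N≤ = ≰⇒> λ c≤1 → <-irrefl refl (≤-trans D<N (≤-trans N≤ (≤-trans (*-monoˡ-≤ _ c≤1) (≤-reflexive (*-identityˡ _)))))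

ratio≤⇒≤ceilℕ : ∀ d → 1ℚ ℚ.< d → ∀ m k → (ℤ.+ m) ℚ./ suc k ℚ.≤ d → m ≤ suc k * ceilℕ d
ratio≤⇒≤ceilℕ d@record{} 1<d m k le with ceil-property d 1<d
... | N , num , _ , N≤ = *-cancelʳ-≤ m (suc k * ceilℕ d) (suc (ℚ.denominator-1 d)) (begin
  m * suc (ℚ.denominator-1 d)
    ≤⟨ ℤₚ.drop‿+≤+ (subst₂ ℤ._≤_ (sym (ℤₚ.pos-* m _)) (sym (trans (ℤₚ.pos-* N (suc k)) (cong (ℤ._* (ℤ.+ suc k)) (sym num)))) cross) ⟩
  N * suc k                                     ≤⟨ *-monoˡ-≤ (suc k) N≤ ⟩
  ceilℕ d * suc (ℚ.denominator-1 d) * suc k     ≡⟨ reorder (ceilℕ d) (suc (ℚ.denominator-1 d)) (suc k) ⟩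
  suc k * ceilℕ d * suc (ℚ.denominator-1 d)     ∎)
  where
  open ≤-Reasoning
  reorder : ∀ a b c → a * b * c ≡ c * a * b
  reorder = solve-∀
  cross : ℤ.+ m ℤ.* ℤ.+ suc (ℚ.denominator-1 d) ℤ.≤ ℚ.numerator d ℤ.* ℤ.+ suc k
  cross with ℚᵘₚ.≤-trans (ℚᵘₚ.≤-reflexive (ℚᵘₚ.≃-sym (ℚₚ.toℚᵘ-fromℚᵘ (ℚᵘ.mkℚᵘ (ℤ.+ m) k)))) (ℚₚ.toℚᵘ-mono-≤ le)
  ... | ℚᵘ.*≤* p = p

orientation : ∀ {n} (H : Graph n) d → 1ℚ ℚ.< d → DensityAtMost d H →
              ∃ λ (o : Orientation H) → ∀ a → outdeg o a ≤ ceilℕ d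
orientation H d 1<d dense = Balance.balance (ceilℕ d) sparse _ (naturalOrientation H) ≤-refl
  where
  sparse : ∀ (o : Orientation H) x S → NoRepeat Finₚ._≟_ (x ∷ S) →
           ∑ (x ∷ S) (λ a → ∑ (x ∷ S) (λ b → ⟦ arc o a b ⟧)) ≤ length (x ∷ S) * ceilℕ d
  sparse o x S nr = ≤-trans (arcs≤edges H o x S)
    (ratio≤⇒≤ceilℕ d 1<d (e (induced H x S)) (length S) (dense (length S) (induced H x S) (induced-⊆ H x S nr)))

∑-↭ : ∀ {xs ys : List A} → xs ↭ ys → ∀ (f : A → ℕ) → ∑ xs f ≡ ∑ ys f
∑-↭ ↭.refl          f = refl
∑-↭ (prep x p)      f = cong (f x +_) (∑-↭ p f)
∑-↭ (↭.swap x y p)  f rewrite ∑-↭ p f = exchange (f x) (f y) _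
  where
  exchange : ∀ a b c → a + (b + c) ≡ b + (a + c)
  exchange = solve-∀
∑-↭ (↭.trans p q)   f = trans (∑-↭ p f) (∑-↭ q f)

module _ {n} {H : Graph n} (o : Orientation H) (k : ℕ) where

  -- An elimination order, last vertex first: each vertex receives at most k arcs from its predecessors.
  data Eliminates : List (Fin n) → Set where
    []  : Eliminates []
    _∷_ : ∀ {y ys} → ∑ ys (λ x → ⟦ arc o x y ⟧) ≤ k → Eliminates ys → Eliminates (y ∷ ys)

  -- Counting the arcs inside `R` by their tails shows that the mean indegree within `R` is at most
  -- `k`; a vertex that attains this is placed last and removed.
  elimination : (∀ a → outdeg o a ≤ k) → ∀ m R → length R ≡ m → NoRepeat Finₚ._≟_ R →
                ∃ λ ys → Eliminates ys × ys ↭ R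
  elimination out≤k zero [] refl nr = [] , [] , ↭-refl
  elimination out≤k (suc m) R@(_ ∷ _) len nr
    with ∑-average R (λ _ → 1) (λ y → ∑ R (λ x → ⟦ arc o x y ⟧)) k (s≤s z≤n) (begin
      ∑ R (λ y → 1 * ∑ R (λ x → ⟦ arc o x y ⟧)) ≡⟨ ∑-cong R (λ y → *-identityˡ _) ⟩
      ∑ R (λ y → ∑ R (λ x → ⟦ arc o x y ⟧))     ≡⟨ ∑-swap R R (λ y x → ⟦ arc o x y ⟧) ⟩
      ∑ R (λ x → ∑ R (λ y → ⟦ arc o x y ⟧))
        ≤⟨ ∑-mono R (λ x → ≤-trans (∑-support Finₚ._≟_ R (allFin n) _ nr (λ _ _ → ∈-allFin _)) (out≤k x)) ⟩
      ∑ R (λ _ → k)                              ≡⟨ ∑-const R k ⟩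
      length R * k
        ≡⟨ cong (_* k) (trans (∑-const R 1) (*-identityʳ (length R))) ⟨
      ∑ R (λ _ → 1) * k                          ∎)
    where open ≤-Reasoning
  ... | y , y∈ , _ , in≤k with ∈-∃++ y∈
  ...   | as , bs , R≡ with elimination out≤k m (as ++ bs) (suc-injective (trans (sym (↭-length R↭)) len)) nr′
    where
    R↭ : R ↭ y ∷ as ++ bs
    R↭ = ↭-trans (↭-reflexive R≡) (shift y as bs)
    nr′ : NoRepeat Finₚ._≟_ (as ++ bs)
    nr′ z = ≤-trans (m≤n+m _ (𝟙 (y Finₚ.≟ z))) (≤-trans (≤-reflexive (sym (∑-↭ R↭ _))) (nr z))
  ...     | ys , el , ys↭ = y ∷ ys , bound ∷ el , ↭-trans (prep y ys↭) (↭-sym R↭)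
    where
    R↭ : R ↭ y ∷ as ++ bs
    R↭ = ↭-trans (↭-reflexive R≡) (shift y as bs)
    bound : ∑ ys (λ x → ⟦ arc o x y ⟧) ≤ k
    bound = ≤-trans (≤-reflexive (∑-↭ ys↭ _)) (≤-trans (m≤n+m _ ⟦ arc o y y ⟧) (≤-trans (≤-reflexive (sym (∑-↭ R↭ (λ x → ⟦ arc o x y ⟧)))) in≤k))

-- Classes, colours and marks

data Class : Set where
  light hub : Class

_≟ᶜ_ : DecidableEquality Class
light ≟ᶜ light = yes refl
light ≟ᶜ hub   = no λ ()
hub   ≟ᶜ light = no λ ()
hub   ≟ᶜ hub   = yes refl

-- A colour is a pair (i , j) of base-h digits; a mark records it in full or only its first digit.
data Mark : Set where
  coarse : ℕ → Mark
  fine   : ℕ → ℕ → Mark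

_≟ᵐ_ : DecidableEquality Mark
coarse i ≟ᵐ coarse j with i ≟ j
... | yes refl = yes refl
... | no ¬p    = no λ { refl → ¬p refl }
coarse _ ≟ᵐ fine _ _ = no λ ()
fine _ _ ≟ᵐ coarse _ = no λ ()
fine i i′ ≟ᵐ fine j j′ with i ≟ j | i′ ≟ j′
... | yes refl | yes refl = yes refl
... | no ¬p    | _        = no λ { refl → ¬p refl }
... | yes _    | no ¬p    = no λ { refl → ¬p refl }

_≟ʷ_ : DecidableEquality (List Mark)
_≟ʷ_ = ≡-dec _≟ᵐ_
  where open import Data.List.Properties using (≡-dec)

digits : Mark → ℕ
digits (coarse _) = 1
digits (fine _ _) = 2

weight : List Mark → ℕ
weight bs = ∑ bs digits

weight≤2*length : ∀ bs → weight bs ≤ 2 * length bs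
weight≤2*length bs = ≤-trans (∑-bound bs 2 (λ {b} _ → digits≤2 b)) (≤-reflexive (*-comm (length bs) 2))
  where
  digits≤2 : ∀ b → digits b ≤ 2
  digits≤2 (coarse _) = s≤s z≤n
  digits≤2 (fine _ _) = ≤-refl

Colour : Set
Colour = ℕ × ℕ

-- The first class is that of the recording vertex, the second that of the vertex whose colour is
-- recorded.
markAs : Class → Class → Colour → Mark
markAs light light (i , j) = fine i j
markAs light hub   (i , _) = coarse i
markAs hub   _     (i , _) = coarse i

digitsAs : Class → Class → ℕ
digitsAs light light = 2
digitsAs light hub   = 1
digitsAs hub   _     = 1

digits-markAs : ∀ κ κ′ γ → digits (markAs κ κ′ γ) ≡ digitsAs κ κ′
digits-markAs light light γ = refl
digits-markAs light hub   γ = refl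
digits-markAs hub   κ′    γ = refl

colours : ℕ → List Colour
colours h = concatMap (λ i → map (i ,_) (upTo h)) (upTo h)

∑-colours : ∀ h (f : Colour → ℕ) → ∑ (colours h) f ≡ ∑ (upTo h) (λ i → ∑ (upTo h) (λ j → f (i , j)))
∑-colours h f = trans (∑-concatMap (upTo h) _ f) (∑-cong (upTo h) (λ i → ∑-map (upTo h) (i ,_) f))

length-upTo : ∀ h → length (upTo h) ≡ h
length-upTo = Listₚ.length-upTo

∑-colours-1 : ∀ h → ∑ (colours h) (λ _ → 1) ≡ h * h
∑-colours-1 h = begin
  ∑ (colours h) (λ _ → 1)                             ≡⟨ ∑-colours h _ ⟩
  ∑ (upTo h) (λ _ → ∑ (upTo h) (λ _ → 1))             ≡⟨ ∑-const (upTo h) _ ⟩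
  length (upTo h) * ∑ (upTo h) (λ _ → 1)
    ≡⟨ cong₂ _*_ (length-upTo h) (trans (∑-const (upTo h) 1) (trans (*-identityʳ _) (length-upTo h))) ⟩
  h * h                                               ∎
  where open ≡-Reasoning

∈-colours⁻ : ∀ h {i j} → (i , j) ∈ colours h → i < h × j < h
∈-colours⁻ h γ∈ with ∈-concatMap⁻ (λ i → map (i ,_) (upTo h)) {xs = upTo h} γ∈
... | p with find p
...   | i , i∈ , q with ∈-map⁻ (i ,_) q
...     | j , j∈ , refl = ∈-upTo⁻ i∈ , ∈-upTo⁻ j∈

NoRepeat-upTo : ∀ h → NoRepeat _≟_ (upTo h)
NoRepeat-upTo h = Unique⇒NoRepeat _≟_ (upTo⁺ h)

-- A mark prescribes `digits s` of the two digits of a colour; a mark of a shape that these classes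
-- do not produce is hit by no colour.
markAs-hits : ∀ h κ κ′ s → ∑ (colours h) (λ γ → 𝟙 (markAs κ κ′ γ ≟ᵐ s)) * h ^ digits s ≤ h * h
markAs-hits h κ κ′ s = ≤-trans (*-monoˡ-≤ (h ^ digits s) (≤-reflexive (∑-colours h _))) (cases κ κ′ s)
  where
  open ≤-Reasoning
  U : List ℕ
  U = upTo h
  none : ∀ κ κ′ s → (∀ γ → markAs κ κ′ γ ≢ s) →
         ∑ U (λ i → ∑ U (λ j → 𝟙 (markAs κ κ′ (i , j) ≟ᵐ s))) * h ^ digits s ≤ h * h
  none κ κ′ s ne = ≤-trans (≤-reflexive (cong (_* h ^ digits s)
    (trans (∑-cong U (λ i → trans (∑-cong U (λ j → 𝟙-no (markAs κ κ′ (i , j) ≟ᵐ s) (ne (i , j)))) (∑-zero U))) (∑-zero U)))) z≤n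
  oneDigit : ∀ i₀ → ∑ U (λ i → ∑ U (λ j → 𝟙 (coarse i ≟ᵐ coarse i₀))) * h ^ 1 ≤ h * h
  oneDigit i₀ = begin
    ∑ U (λ i → ∑ U (λ j → 𝟙 (coarse i ≟ᵐ coarse i₀))) * h ^ 1
      ≤⟨ *-monoˡ-≤ (h ^ 1) (∑-mono U (λ i → ∑-mono U (λ j → 𝟙-mono (coarse i ≟ᵐ coarse i₀) (i ≟ i₀) (λ { refl → refl })))) ⟩
    ∑ U (λ i → ∑ U (λ j → 𝟙 (i ≟ i₀))) * h ^ 1
      ≡⟨ cong (_* h ^ 1) (trans (∑-swap U U (λ i j → 𝟙 (i ≟ i₀))) (∑-const U _)) ⟩
    length U * ∑ U (λ i → 𝟙 (i ≟ i₀)) * h ^ 1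
      ≤⟨ *-mono-≤ (*-mono-≤ (≤-reflexive (length-upTo h)) (NoRepeat-upTo h i₀)) (≤-reflexive (*-identityʳ h)) ⟩
    h * 1 * h ≡⟨ cong (_* h) (*-identityʳ h) ⟩
    h * h ∎
  cases : ∀ κ κ′ s → ∑ U (λ i → ∑ U (λ j → 𝟙 (markAs κ κ′ (i , j) ≟ᵐ s))) * h ^ digits s ≤ h * h
  cases light light s@(coarse _) = none light light s (λ _ ())
  cases light hub   s@(fine _ _) = none light hub s (λ _ ())
  cases hub   κ′    s@(fine _ _) = none hub κ′ s (λ _ ())
  cases light hub   (coarse i₀) = oneDigit i₀
  cases hub   κ′    (coarse i₀) = oneDigit i₀
  cases light light (fine i₀ j₀) = begin
    ∑ U (λ i → ∑ U (λ j → 𝟙 (fine i j ≟ᵐ fine i₀ j₀))) * h ^ 2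
      ≤⟨ *-monoˡ-≤ (h ^ 2) (∑-mono U (λ i → ∑-mono U (λ j → both i j))) ⟩
    ∑ U (λ i → ∑ U (λ j → 𝟙 (i ≟ i₀) * 𝟙 (j ≟ j₀))) * h ^ 2
      ≡⟨ cong (_* h ^ 2) (trans (∑-cong U (λ i → ∑-*ˡ U (𝟙 (i ≟ i₀)) _)) (∑-*ʳ U _ _)) ⟩
    ∑ U (λ i → 𝟙 (i ≟ i₀)) * ∑ U (λ j → 𝟙 (j ≟ j₀)) * h ^ 2
      ≤⟨ *-monoˡ-≤ (h ^ 2) (*-mono-≤ (NoRepeat-upTo h i₀) (NoRepeat-upTo h j₀)) ⟩
    1 * h ^ 2 ≡⟨ trans (*-identityˡ _) (cong (h *_) (*-identityʳ h)) ⟩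
    h * h ∎
    where
    both : ∀ i j → 𝟙 (fine i j ≟ᵐ fine i₀ j₀) ≤ 𝟙 (i ≟ i₀) * 𝟙 (j ≟ j₀)
    both i j = ≤-trans (𝟙-mono (fine i j ≟ᵐ fine i₀ j₀) ((i ≟ i₀) ×-dec (j ≟ j₀)) (λ { refl → refl , refl }))
                       (≤-reflexive (𝟙-× (i ≟ i₀) (j ≟ j₀)))

markAs-hits′ : ∀ h κ κ′ s → ∑ (colours h) (λ γ → 𝟙 (s ≟ᵐ markAs κ κ′ γ)) * h ^ digitsAs κ κ′ ≤ h * h
markAs-hits′ h κ κ′ s = begin
  ∑ (colours h) (λ γ → 𝟙 (s ≟ᵐ markAs κ κ′ γ)) * h ^ digitsAs κ κ′   ≡⟨ ∑-*ʳ (colours h) _ _ ⟨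
  ∑ (colours h) (λ γ → 𝟙 (s ≟ᵐ markAs κ κ′ γ) * h ^ digitsAs κ κ′)   ≡⟨ ∑-cong (colours h) same ⟩
  ∑ (colours h) (λ γ → 𝟙 (markAs κ κ′ γ ≟ᵐ s) * h ^ digits s)        ≡⟨ ∑-*ʳ (colours h) _ _ ⟩
  ∑ (colours h) (λ γ → 𝟙 (markAs κ κ′ γ ≟ᵐ s)) * h ^ digits s        ≤⟨ markAs-hits h κ κ′ s ⟩
  h * h ∎
  where
  open ≤-Reasoning
  same : ∀ γ → 𝟙 (s ≟ᵐ markAs κ κ′ γ) * h ^ digitsAs κ κ′ ≡ 𝟙 (markAs κ κ′ γ ≟ᵐ s) * h ^ digits s
  same γ with s ≟ᵐ markAs κ κ′ γ | markAs κ κ′ γ ≟ᵐ s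
  ... | yes refl | yes _ = cong (λ d → 1 * h ^ d) (sym (digits-markAs κ κ′ γ))
  ... | yes p | no ¬q = ⊥-elim (¬q (sym p))
  ... | no ¬p | yes q = ⊥-elim (¬p (sym q))
  ... | no _ | no _ = refl

-- h ^ capExp k κ is the order of magnitude of the number of vertices of class κ.
capExp : ℕ → Class → ℕ
capExp k light = 2 * k + 2
capExp k hub   = 2 * k + 1

-- h ^ burstExp κ s bounds how many items of class κ can receive the mark s in one step.
burstExp : Class → Mark → ℕ
burstExp light (coarse _) = 2
burstExp light (fine _ _) = 1
burstExp hub   _            = 1

-- Exponent of a bound on how many words of the first class grow when a vertex of the second class
-- is coloured. Giants apart, a hub has indegree below `h²` and a light vertex below `h`; among hub
-- words, a hub extends only its own.
tokenExp : Class → Class → ℕ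
tokenExp light hub   = 2
tokenExp light light = 1
tokenExp hub   _     = 1

data Valid (h : ℕ) : Class → Mark → Set where
  coarse : ∀ {κ i} → i < h → Valid h κ (coarse i)
  fine   : ∀ {i j} → i < h → j < h → Valid h light (fine i j)

markAs-valid : ∀ {h} κ κ′ {γ} → γ ∈ colours h → Valid h κ (markAs κ κ′ γ)
markAs-valid light light γ∈ = fine (proj₁ (∈-colours⁻ _ γ∈)) (proj₂ (∈-colours⁻ _ γ∈))
markAs-valid light hub   γ∈ = coarse (proj₁ (∈-colours⁻ _ γ∈))
markAs-valid hub   κ′    γ∈ = coarse (proj₁ (∈-colours⁻ _ γ∈))

hub-weight : ∀ {h bs} → All (Valid h hub) bs → weight bs ≡ length bs
hub-weight []             = refl
hub-weight (coarse _ ∷ v) = cong suc (hub-weight v)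

-- The node `(κ , s , bs)` stands for the growth of words of class `κ` from `bs` to `s ∷ bs`.
Node : Set
Node = Class × Mark × List Mark

-- The potential follows hub words to their full length, but light words only up to length `k`: a
-- complete one may have an average load of order one, too little for a Chernoff bound.
maxLen : ℕ → Class → ℕ
maxLen k light = k
maxLen k hub   = suc k

-- Arrivals at a node and departures towards it are counted with the multiplicities vExp and zExp,
-- so that one pair of bases, 1 + 1/2h² and 1 − 2/h³, serves all nodes.
vExp : ℕ → Class → Mark → ℕ
vExp h κ s = h ^ (2 ∸ burstExp κ s)

zExp : ℕ → Class → Mark → ℕ
zExp h κ s = h ^ (3 ∸ burstExp κ s ∸ digits s)

-- The multiplicity raises a maximal burst to exactly `Γ = h²`, the largest exponent that
-- `upper-bernoulli` admits.
vExp-spec : ∀ h κ s → vExp h κ s * h ^ burstExp κ s ≡ h * h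
vExp-spec h light (coarse _) = trans (*-identityˡ _) (cong (h *_) (*-identityʳ h))
vExp-spec h light (fine _ _) = cong₂ _*_ (*-identityʳ h) (*-identityʳ h)
vExp-spec h hub   s            = cong₂ _*_ (*-identityʳ h) (*-identityʳ h)

-- A departing word receives the mark `s` with probability at most `h^(− digits s)`. With `Λ = h³`,
-- this identity makes the loss `z/Λ` per departure equal to the mean gain `v/(Γ h^(digits s))`, up
-- to the factor 2 for restricted choices.
zExp-spec : ∀ h κ s → zExp h κ s * h ^ digits s * h ^ burstExp κ s ≡ h * h * h
zExp-spec h light (coarse _) = cube h
  where
  cube : ∀ h → 1 * (h * 1) * (h * (h * 1)) ≡ h * h * h
  cube = solve-∀
zExp-spec h light (fine _ _) = cube h
  where
  cube : ∀ h → 1 * (h * (h * 1)) * (h * 1) ≡ h * h * h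
  cube = solve-∀
zExp-spec h hub (coarse _) = cube h
  where
  cube : ∀ h → h * 1 * (h * 1) * (h * 1) ≡ h * h * h
  cube = solve-∀
zExp-spec h hub (fine _ _) = cube h
  where
  cube : ∀ h → 1 * (h * (h * 1)) * (h * 1) ≡ h * h * h
  cube = solve-∀

-- The average load of `s ∷ bs` exceeds the largest burst by a factor of at least `h`. In a light
-- word the exponents of digits and burst always add up to 3: marks of hubs arrive in bursts of `h²`
-- but carry one digit, marks of light vertices in bursts of `h` with two. For hub words the room
-- comes from `2 ≤ k`.
spareExp : ∀ {h k} κ s bs → 2 ≤ k → Valid h κ s → All (Valid h κ) bs → suc (length bs) ≤ maxLen k κ →
           digits s + weight bs + suc (burstExp κ s) ≤ capExp k κ
spareExp {k = k} light s bs 2≤k vs vbs len = begin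
  digits s + weight bs + suc (burstExp light s) ≡⟨ four s (weight bs) ⟩
  weight bs + 2 + 2                             ≤⟨ +-monoˡ-≤ 2 (+-monoˡ-≤ 2 (weight≤2*length bs)) ⟩
  2 * length bs + 2 + 2                         ≡⟨ cong (_+ 2) (double (length bs)) ⟩
  2 * suc (length bs) + 2                       ≤⟨ +-monoˡ-≤ 2 (*-monoʳ-≤ 2 len) ⟩
  2 * k + 2                                     ∎
  where
  open ≤-Reasoning
  four : ∀ s w → digits s + w + suc (burstExp light s) ≡ w + 2 + 2
  four (coarse _) w = four′ w
    where
    four′ : ∀ w → 1 + w + 3 ≡ w + 2 + 2
    four′ = solve-∀
  four (fine _ _) w = four′ w
    where
    four′ : ∀ w → 2 + w + 2 ≡ w + 2 + 2
    four′ = solve-∀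
  double : ∀ l → 2 * l + 2 ≡ 2 * suc l
  double = solve-∀
spareExp {k = k} hub (coarse _) bs 2≤k vs vbs len = begin
  1 + weight bs + 2 ≡⟨ cong (λ w → 1 + w + 2) (hub-weight vbs) ⟩
  1 + length bs + 2 ≤⟨ +-mono-≤ len 2≤k ⟩
  suc k + k         ≡⟨ odd k ⟩
  2 * k + 1         ∎
  where
  open ≤-Reasoning
  odd : ∀ k → suc k + k ≡ 2 * k + 1
  odd = solve-∀
spareExp hub (fine _ _) bs 2≤k () vbs len

tokenExp≡burstExp : ∀ κ κ′ γ → tokenExp κ κ′ ≡ burstExp κ (markAs κ κ′ γ)
tokenExp≡burstExp light light γ = refl
tokenExp≡burstExp light hub   γ = refl
tokenExp≡burstExp hub   κ′    γ = refl

-- The colouring process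

-- Vertices are coloured one at a time. The word of x, cur x, grows by one mark each time a
-- vertex related to x is coloured; arrivals and departures count the words passing through a node.
module Process {n : ℕ} (h k : ℕ) (kind : Fin n → Class) (rel : Fin n → Fin n → Bool) where

  V : List (Fin n)
  V = allFin n

  History : Set
  History = List (Fin n × Colour)

  mark : Fin n → Fin n → Colour → Mark
  mark x y γ = markAs (kind x) (kind y) γ

  extend : Bool → Mark → List Mark → List Mark
  extend true  s bs = s ∷ bs
  extend false s bs = bs

  cur : Fin n → History → List Mark
  cur x []            = []
  cur x ((y , γ) ∷ η) = extend (rel x y) (mark x y γ) (cur x η)

  is : Class → Fin n → ℕ
  is κ x = 𝟙 (kind x ≟ᶜ κ)

  token : Class → Fin n → Fin n → ℕ
  token κ y x = is κ x * ⟦ rel x y ⟧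

  dep : Class → List Mark → History → Fin n → ℕ
  dep κ bs η y = ∑ V (λ x → token κ y x * 𝟙 (cur x η ≟ʷ bs))

  arr : Class → Mark → List Mark → History → Fin n → Colour → ℕ
  arr κ s bs η y γ = ∑ V (λ x → token κ y x * 𝟙 (cur x η ≟ʷ bs) * 𝟙 (mark x y γ ≟ᵐ s))

  departures : Class → List Mark → History → ℕ
  departures κ bs []            = 0
  departures κ bs ((y , γ) ∷ η) = departures κ bs η + dep κ bs η y

  arrivals⁺ : Class → Mark → List Mark → History → ℕ
  arrivals⁺ κ s bs []            = 0
  arrivals⁺ κ s bs ((y , γ) ∷ η) = arrivals⁺ κ s bs η + arr κ s bs η y γ

  arrivals : Class → List Mark → History → ℕ
  arrivals κ []       η = ∑ V (is κ)
  arrivals κ (s ∷ bs) η = arrivals⁺ κ s bs η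

  present : Class → List Mark → History → ℕ
  present κ bs η = ∑ V (λ x → is κ x * 𝟙 (cur x η ≟ʷ bs))

  token≤1 : ∀ κ y x → token κ y x ≤ 1
  token≤1 κ y x = *-mono-≤ (𝟙≤1 (kind x ≟ᶜ κ)) (⟦⟧≤1 (rel x y))

  arr≤dep : ∀ κ s bs η y γ → arr κ s bs η y γ ≤ dep κ bs η y
  arr≤dep κ s bs η y γ = ∑-mono V λ x →
    ≤-trans (*-monoʳ-≤ (token κ y x * 𝟙 (cur x η ≟ʷ bs)) (𝟙≤1 (mark x y γ ≟ᵐ s)))
            (≤-reflexive (*-identityʳ (token κ y x * 𝟙 (cur x η ≟ʷ bs))))

  dep≤n : ∀ κ bs η y → dep κ bs η y ≤ n
  dep≤n κ bs η y = ≤-trans (∑-bound V 1 (λ {x} _ → *-mono-≤ (token≤1 κ y x) (𝟙≤1 (cur x η ≟ʷ bs))))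
                           (≤-reflexive (trans (*-identityʳ _) (length-allFin n)))

  module _ where
    gain : ℕ → Bool → Mark → List Mark → List Mark → ℕ
    gain i r m c []       = 0
    gain i r m c (s ∷ bs) = i * ⟦ r ⟧ * 𝟙 (c ≟ʷ bs) * 𝟙 (m ≟ᵐ s)

    move : ∀ i r m c bs → i * 𝟙 (extend r m c ≟ʷ bs) + i * ⟦ r ⟧ * 𝟙 (c ≟ʷ bs) ≤ i * 𝟙 (c ≟ʷ bs) + gain i r m c bs
    move i false m c bs = ≤-trans (≤-reflexive (cong (i * 𝟙 (c ≟ʷ bs) +_) (cong (_* 𝟙 (c ≟ʷ bs)) (*-zeroʳ i)))) (+-monoʳ-≤ _ z≤n)
    move i true  m c [] = ≤-reflexive (trans (cong₂ _+_ (trans (cong (i *_) (𝟙-no ((m ∷ c) ≟ʷ []) (λ ()))) (*-zeroʳ i)) (cong (_* 𝟙 (c ≟ʷ [])) (*-identityʳ i))) (sym (+-identityʳ _)))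
    move i true  m c (s ∷ bs) = begin
      i * 𝟙 ((m ∷ c) ≟ʷ (s ∷ bs)) + i * 1 * 𝟙 (c ≟ʷ (s ∷ bs))
        ≤⟨ +-monoˡ-≤ _ (*-monoʳ-≤ i (≤-trans (𝟙-mono ((m ∷ c) ≟ʷ (s ∷ bs)) ((c ≟ʷ bs) ×-dec (m ≟ᵐ s)) (λ { refl → refl , refl })) (≤-reflexive (𝟙-× (c ≟ʷ bs) (m ≟ᵐ s))))) ⟩
      i * (𝟙 (c ≟ʷ bs) * 𝟙 (m ≟ᵐ s)) + i * 1 * 𝟙 (c ≟ʷ (s ∷ bs))
        ≡⟨ reorder i (𝟙 (c ≟ʷ bs)) (𝟙 (m ≟ᵐ s)) (𝟙 (c ≟ʷ (s ∷ bs))) ⟩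
      i * 𝟙 (c ≟ʷ (s ∷ bs)) + i * 1 * 𝟙 (c ≟ʷ bs) * 𝟙 (m ≟ᵐ s) ∎
      where
      open ≤-Reasoning
      reorder : ∀ i a b d → i * (a * b) + i * 1 * d ≡ i * d + i * 1 * a * b
      reorder = solve-∀

  -- A conservation law: a word that has reached `bs` either is still there or has left. The
  -- inductive step is `move`, applied to each vertex.
  present+departures : ∀ κ bs η → present κ bs η + departures κ bs η ≤ arrivals κ bs η
  present+departures κ [] [] = ≤-reflexive (trans (+-identityʳ _) (∑-cong V (λ x → *-identityʳ _)))
  present+departures κ (s ∷ bs) [] = ≤-reflexive (trans (+-identityʳ _) (trans (∑-cong V (λ x → *-zeroʳ (is κ x))) (∑-zero V)))
  present+departures κ bs ((y , γ) ∷ η) = begin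
    present κ bs ((y , γ) ∷ η) + (departures κ bs η + dep κ bs η y)
      ≡⟨ reorder (present κ bs ((y , γ) ∷ η)) (departures κ bs η) (dep κ bs η y) ⟩
    present κ bs ((y , γ) ∷ η) + dep κ bs η y + departures κ bs η ≡⟨ cong (_+ departures κ bs η) (∑-+ V _ _) ⟨
    ∑ V (λ x → is κ x * 𝟙 (cur x ((y , γ) ∷ η) ≟ʷ bs) + token κ y x * 𝟙 (cur x η ≟ʷ bs)) + departures κ bs η
      ≤⟨ +-monoˡ-≤ (departures κ bs η) (∑-mono V (λ x → move (is κ x) (rel x y) (mark x y γ) (cur x η) bs)) ⟩
    ∑ V (λ x → is κ x * 𝟙 (cur x η ≟ʷ bs) + gain (is κ x) (rel x y) (mark x y γ) (cur x η) bs) + departures κ bs η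
      ≡⟨ cong (_+ departures κ bs η) (∑-+ V _ _) ⟩
    present κ bs η + gains + departures κ bs η ≡⟨ reorder′ (present κ bs η) gains (departures κ bs η) ⟩
    present κ bs η + departures κ bs η + gains ≤⟨ +-monoˡ-≤ gains (present+departures κ bs η) ⟩
    arrivals κ bs η + gains ≤⟨ finish bs ⟩
    arrivals κ bs ((y , γ) ∷ η) ∎
    where
    open ≤-Reasoning
    gains : ℕ
    gains = ∑ V (λ x → gain (is κ x) (rel x y) (mark x y γ) (cur x η) bs)
    reorder : ∀ a b c → a + (b + c) ≡ a + c + b
    reorder = solve-∀
    reorder′ : ∀ a b c → a + b + c ≡ a + c + b
    reorder′ = solve-∀
    finish : ∀ bs → arrivals κ bs η + ∑ V (λ x → gain (is κ x) (rel x y) (mark x y γ) (cur x η) bs) ≤ arrivals κ bs ((y , γ) ∷ η)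
    finish []       = ≤-reflexive (trans (cong (arrivals κ [] η +_) (∑-zero V)) (+-identityʳ _))
    finish (s ∷ bs) = ≤-refl

  present≤arrivals : ∀ κ bs η → present κ bs η ≤ arrivals κ bs η
  present≤arrivals κ bs η = m+n≤o⇒m≤o (present κ bs η) (present+departures κ bs η)

  departures≤arrivals : ∀ κ bs η → departures κ bs η ≤ arrivals κ bs η
  departures≤arrivals κ bs η = m+n≤o⇒n≤o (present κ bs η) (present+departures κ bs η)

  Coloured : History → Set
  Coloured = All (λ yγ → proj₂ yγ ∈ colours h)

  cur-valid : ∀ x {η} → Coloured η → All (Valid h (kind x)) (cur x η)
  cur-valid x {[]} [] = []
  cur-valid x {(y , γ) ∷ η} (γ∈ ∷ col) with rel x y
  ... | true  = markAs-valid (kind x) (kind y) γ∈ ∷ cur-valid x col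
  ... | false = cur-valid x col

  -- Past arrivals, summed over the colours that `y` might still get: each past departure from `bs`
  -- took one definite mark, which agrees with `mark x y γ` for at most `h² / h^d` colours `γ`.
  arrivals-spread : ∀ κ x y bs η → ∑ (colours h) (λ γ → arrivals⁺ κ (mark x y γ) bs η) * h ^ digitsAs (kind x) (kind y) ≤ h * h * departures κ bs η
  arrivals-spread κ x y bs [] = ≤-trans (≤-reflexive (cong (_* h ^ digitsAs (kind x) (kind y)) (∑-zero (colours h)))) z≤n
  arrivals-spread κ x y bs ((y′ , γ′) ∷ η) = begin
    ∑ Γ (λ γ → arrivals⁺ κ (mark x y γ) bs η + arr κ (mark x y γ) bs η y′ γ′) * d ≡⟨ cong (_* d) (∑-+ Γ _ _) ⟩
    (∑ Γ (λ γ → arrivals⁺ κ (mark x y γ) bs η) + ∑ Γ (λ γ → arr κ (mark x y γ) bs η y′ γ′)) * d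
      ≡⟨ *-distribʳ-+ d (∑ Γ (λ γ → arrivals⁺ κ (mark x y γ) bs η)) _ ⟩
    ∑ Γ (λ γ → arrivals⁺ κ (mark x y γ) bs η) * d + ∑ Γ (λ γ → arr κ (mark x y γ) bs η y′ γ′) * d
      ≤⟨ +-mono-≤ (arrivals-spread κ x y bs η) step ⟩
    h * h * departures κ bs η + h * h * dep κ bs η y′ ≡⟨ *-distribˡ-+ (h * h) (departures κ bs η) _ ⟨
    h * h * (departures κ bs η + dep κ bs η y′) ∎
    where
    open ≤-Reasoning
    Γ : List Colour
    Γ = colours h
    d : ℕ
    d = h ^ digitsAs (kind x) (kind y)
    t : Fin n → ℕ
    t x′ = token κ y′ x′ * 𝟙 (cur x′ η ≟ʷ bs)
    step : ∑ Γ (λ γ → arr κ (mark x y γ) bs η y′ γ′) * d ≤ h * h * dep κ bs η y′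
    step = begin
      ∑ Γ (λ γ → ∑ V (λ x′ → t x′ * 𝟙 (mark x′ y′ γ′ ≟ᵐ mark x y γ))) * d ≡⟨ cong (_* d) (∑-swap Γ V _) ⟩
      ∑ V (λ x′ → ∑ Γ (λ γ → t x′ * 𝟙 (mark x′ y′ γ′ ≟ᵐ mark x y γ))) * d ≡⟨ ∑-*ʳ V d _ ⟨
      ∑ V (λ x′ → ∑ Γ (λ γ → t x′ * 𝟙 (mark x′ y′ γ′ ≟ᵐ mark x y γ)) * d)
        ≡⟨ ∑-cong V (λ x′ → trans (cong (_* d) (∑-*ˡ Γ (t x′) _)) (*-assoc (t x′) _ d)) ⟩
      ∑ V (λ x′ → t x′ * (∑ Γ (λ γ → 𝟙 (mark x′ y′ γ′ ≟ᵐ mark x y γ)) * d))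
        ≤⟨ ∑-mono V (λ x′ → *-monoʳ-≤ (t x′) (markAs-hits′ h (kind x) (kind y) (mark x′ y′ γ′))) ⟩
      ∑ V (λ x′ → t x′ * (h * h)) ≡⟨ ∑-*ʳ V (h * h) t ⟩
      ∑ V t * (h * h) ≡⟨ *-comm _ (h * h) ⟩
      h * h * dep κ bs η y′ ∎

-- levelConst k c j is the factor over the average load allowed for words of length j; the complete
-- words of light vertices, of length k + 1, are treated separately and get leafConst k c.
levelConst : ℕ → ℕ → ℕ → ℕ
levelConst k c zero    = suc k
levelConst k c (suc j) = 8 * levelConst k c j + 2 * c

-- The Markov threshold, plus the at most `k + 1` words that can be completed in one step.
leafConst : ℕ → ℕ → ℕ
leafConst k c = 2 * suc k * levelConst k c k + suc k

wordConst : ℕ → ℕ → ℕ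
wordConst k c = leafConst k c + levelConst k c (suc k)

levelConst-positive : ∀ k c j → 0 < levelConst k c j
levelConst-positive k c zero    = s≤s z≤n
levelConst-positive k c (suc j) = ≤-trans (*-positive {8} (s≤s z≤n) (levelConst-positive k c j)) (m≤m+n _ _)

-- The greedy choice of colours

module Colouring {n : ℕ} (h k c ℓ q : ℕ) (kind : Fin n → Class) (rel : Fin n → Fin n → Bool)
  (h≡4q : h ≡ 4 * q) (0<q : 0 < q) (2≤k : 2 ≤ k) (ℓ<ch : suc ℓ ≤ c * h)
  (tokenBound : ∀ κ y → ∑ (allFin n) (λ x → 𝟙 (kind x ≟ᶜ κ) * ⟦ rel x y ⟧) ≤ h ^ tokenExp κ (kind y))
  (classBound : ∀ κ → ∑ (allFin n) (λ x → 𝟙 (kind x ≟ᶜ κ)) ≤ suc k * h ^ capExp k κ)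
  (nodes : List Node) (nodes≤ : length nodes ≤ 2 ^ ℓ)
  (complete : ∀ {κ s bs} → Valid h κ s → All (Valid h κ) bs → length bs < maxLen k κ → (κ , s , bs) ∈ nodes)
  where

  open Process h k kind rel

  private
    0<h : 0 < h
    0<h = subst (0 <_) (sym h≡4q) (*-positive {4} (s≤s z≤n) 0<q)

    0<h^ : ∀ m → 0 < h ^ m
    0<h^ m = ^-positive h m 0<h

    -- The growth base is `1 + 1/(2Γ)` and the decay base is `R/Λ = 1 − 2/h³`. No exponent within
    -- one step exceeds `C`, so `C`-th powers serve as common denominators.
    Γ Λ R C : ℕ
    Γ = h * h
    R = h * h * h ∸ 2
    Λ = 2 + R
    C = h * n

    4≤h : 4 ≤ h
    4≤h = subst (4 ≤_) (sym h≡4q) (*-monoʳ-≤ 4 0<q)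

    2<h³ : 2 < h * h * h
    2<h³ = ≤-trans (≤-trans (n≤1+n 3) (≤-trans 4≤h (≤-trans (≤-reflexive (sym (*-identityʳ h))) (*-monoʳ-≤ h 0<h))))
                   (≤-trans (≤-reflexive (sym (*-identityʳ (h * h)))) (*-monoʳ-≤ (h * h) 0<h))

    Λ≡h³ : Λ ≡ h * h * h
    Λ≡h³ = m+[n∸m]≡n (<⇒≤ 2<h³)

    0<R : 0 < R
    0<R = m<n⇒0<n∸m 2<h³

    0<Γ : 0 < Γ
    0<Γ = *-positive 0<h 0<h

    vE zE bE : Class → Mark → ℕ
    vE = vExp h
    zE = zExp h
    bE κ s = h ^ burstExp κ s

    ^≤h : ∀ m → m ≤ 1 → h ^ m ≤ h
    ^≤h zero    _ = 0<h
    ^≤h (suc zero) _ = ≤-reflexive (*-identityʳ h)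
    ^≤h (suc (suc m)) (s≤s ())

    vE≤h : ∀ κ s → vE κ s ≤ h
    vE≤h light (coarse _) = ^≤h 0 z≤n
    vE≤h light (fine _ _) = ^≤h 1 ≤-refl
    vE≤h hub   s            = ^≤h 1 ≤-refl

    zE≤h : ∀ κ s → zE κ s ≤ h
    zE≤h light (coarse _) = ^≤h 0 z≤n
    zE≤h light (fine _ _) = ^≤h 0 z≤n
    zE≤h hub   (coarse _) = ^≤h 1 ≤-refl
    zE≤h hub   (fine _ _) = ^≤h 0 z≤n

  -- This is `(1 + 1/2Γ)^(v w) (1 − 2/Λ)^(z u)` multiplied by `unit`, which plays the role of 1 in
  -- every step.
  factor : Class → Mark → ℕ → ℕ → ℕ
  factor κ s w u = suc (2 * Γ) ^ (vE κ s * w) * (2 * Γ) ^ (C ∸ vE κ s * w) * (R ^ (zE κ s * u) * Λ ^ (C ∸ zE κ s * u))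

  potential : Node → History → ℕ
  potential ν []            = 1
  potential ν@(κ , s , bs) ((y , γ) ∷ η) = potential ν η * factor κ s (arr κ s bs η y γ) (dep κ bs η y)

  unit : ℕ
  unit = (2 * Γ) ^ C * Λ ^ C

  0<unit : 0 < unit
  0<unit = *-positive (^-positive (2 * Γ) C (*-positive {2} (s≤s z≤n) 0<Γ)) (^-positive Λ C (s≤s z≤n))

  vdep≤C : ∀ κ s bs η y → vE κ s * dep κ bs η y ≤ C
  vdep≤C κ s bs η y = *-mono-≤ (vE≤h κ s) (dep≤n κ bs η y)

  zdep≤C : ∀ κ s bs η y → zE κ s * dep κ bs η y ≤ C
  zdep≤C κ s bs η y = *-mono-≤ (zE≤h κ s) (dep≤n κ bs η y)

  -- The exponents telescope along the history, so the potential only remembers the total numbers of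
  -- arrivals and departures.
  potential-closed : ∀ κ s bs η →
    potential (κ , s , bs) η * ((2 * Γ) ^ (vE κ s * arrivals⁺ κ s bs η) * Λ ^ (zE κ s * departures κ bs η))
      ≡ suc (2 * Γ) ^ (vE κ s * arrivals⁺ κ s bs η) * R ^ (zE κ s * departures κ bs η) * unit ^ length η
  potential-closed κ s bs [] rewrite *-zeroʳ (vE κ s) | *-zeroʳ (zE κ s) = refl
  potential-closed κ s bs ((y , γ) ∷ η) = begin
    φ * (P ^ (v * w) * Q ^ (C ∸ v * w) * (R ^ (z * u) * Λ ^ (C ∸ z * u))) * (Q ^ (v * (α + w)) * Λ ^ (z * (D + u)))
      ≡⟨ cong₂ (λ a b → φ * (P ^ (v * w) * Q ^ (C ∸ v * w) * (R ^ (z * u) * Λ ^ (C ∸ z * u))) * (a * b)) (splitExp Q v α w) (splitExp Λ z D u) ⟩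
    φ * (P ^ (v * w) * Q ^ (C ∸ v * w) * (R ^ (z * u) * Λ ^ (C ∸ z * u))) * (Q ^ (v * α) * Q ^ (v * w) * (Λ ^ (z * D) * Λ ^ (z * u)))
      ≡⟨ reorder φ (P ^ (v * w)) (Q ^ (C ∸ v * w)) (R ^ (z * u)) (Λ ^ (C ∸ z * u)) (Q ^ (v * α)) (Q ^ (v * w)) (Λ ^ (z * D)) (Λ ^ (z * u)) ⟩
    φ * (Q ^ (v * α) * Λ ^ (z * D)) * (P ^ (v * w) * (Q ^ (v * w) * Q ^ (C ∸ v * w)) * (R ^ (z * u) * (Λ ^ (z * u) * Λ ^ (C ∸ z * u))))
      ≡⟨ cong₂ (λ a b → φ * (Q ^ (v * α) * Λ ^ (z * D)) * (P ^ (v * w) * a * (R ^ (z * u) * b)))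
               (^-split Q (≤-trans (*-monoʳ-≤ v (arr≤dep κ s bs η y γ)) (vdep≤C κ s bs η y))) (^-split Λ (zdep≤C κ s bs η y)) ⟩
    φ * (Q ^ (v * α) * Λ ^ (z * D)) * (P ^ (v * w) * Q ^ C * (R ^ (z * u) * Λ ^ C))
      ≡⟨ cong (_* (P ^ (v * w) * Q ^ C * (R ^ (z * u) * Λ ^ C))) (potential-closed κ s bs η) ⟩
    P ^ (v * α) * R ^ (z * D) * unit ^ length η * (P ^ (v * w) * Q ^ C * (R ^ (z * u) * Λ ^ C))
      ≡⟨ reorder′ (P ^ (v * α)) (R ^ (z * D)) (unit ^ length η) (P ^ (v * w)) (Q ^ C) (R ^ (z * u)) (Λ ^ C) ⟩
    P ^ (v * α) * P ^ (v * w) * (R ^ (z * D) * R ^ (z * u)) * (unit * unit ^ length η)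
      ≡⟨ cong₂ (λ a b → a * b * (unit * unit ^ length η)) (splitExp P v α w) (splitExp R z D u) ⟨
    P ^ (v * (α + w)) * R ^ (z * (D + u)) * (unit * unit ^ length η) ∎
    where
    open ≡-Reasoning
    P Q φ v z α D w u : ℕ
    P = suc (2 * Γ)
    Q = 2 * Γ
    φ = potential (κ , s , bs) η
    v = vE κ s
    z = zE κ s
    α = arrivals⁺ κ s bs η
    D = departures κ bs η
    w = arr κ s bs η y γ
    u = dep κ bs η y
    splitExp : ∀ b v α w → b ^ (v * (α + w)) ≡ b ^ (v * α) * b ^ (v * w)
    splitExp b v α w = trans (cong (b ^_) (*-distribˡ-+ v α w)) (^-distribˡ-+-* b (v * α) (v * w))
    reorder : ∀ φ p q r l qa qw ld lu → φ * (p * q * (r * l)) * (qa * qw * (ld * lu)) ≡ φ * (qa * ld) * (p * (qw * q) * (r * (lu * l)))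
    reorder = solve-∀
    reorder′ : ∀ pa rd U p q r l → pa * rd * U * (p * q * (r * l)) ≡ pa * p * (rd * r) * (q * l * U)
    reorder′ = solve-∀

  -- An arrival reveals the class of `y` as far as it matters: a light word gets a coarse mark only
  -- from a hub and a fine one only from a light vertex. So the token bound for `y` is the burst
  -- bound for `s`.
  arr≤burst : ∀ κ s bs η y γ → arr κ s bs η y γ ≤ bE κ s
  arr≤burst κ s bs η y γ with 0 <? arr κ s bs η y γ
  ... | no ¬0< = ≤-trans (≮⇒≥ ¬0<) z≤n
  ... | yes 0< with ∑-positive V _ 0<
  ...   | x , _ , 0<t = begin
    arr κ s bs η y γ            ≤⟨ arr≤dep κ s bs η y γ ⟩
    dep κ bs η y
      ≤⟨ ∑-mono V (λ x → ≤-trans (*-monoʳ-≤ (token κ y x) (𝟙≤1 (cur x η ≟ʷ bs))) (≤-reflexive (*-identityʳ (token κ y x)))) ⟩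
    ∑ V (token κ y)             ≤⟨ tokenBound κ y ⟩
    h ^ tokenExp κ (kind y)
      ≡⟨ cong (h ^_) (trans (tokenExp≡burstExp κ (kind y) γ) (cong (burstExp κ) s≡)) ⟩
    bE κ s                      ∎
    where
    open ≤-Reasoning
    κ≡ : kind x ≡ κ
    κ≡ = 𝟙⁻ (kind x ≟ᶜ κ) (0<m*n⇒0<m (is κ x) (0<m*n⇒0<m (token κ y x) (0<m*n⇒0<m (token κ y x * 𝟙 (cur x η ≟ʷ bs)) 0<t)))
    s≡ : markAs κ (kind y) γ ≡ s
    s≡ = trans (cong (λ κ → markAs κ (kind y) γ) (sym κ≡)) (𝟙⁻ (mark x y γ ≟ᵐ s) (0<m*n⇒0<n (token κ y x * 𝟙 (cur x η ≟ʷ bs)) 0<t))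

  arr-hits : ∀ κ s bs η y → ∑ (colours h) (λ γ → 𝟙 (1 ≤? arr κ s bs η y γ)) * h ^ digits s ≤ h * h
  arr-hits κ s bs η y = ≤-trans (*-monoˡ-≤ (h ^ digits s) (∑-mono (colours h) (λ γ → 𝟙-mono (1 ≤? arr κ s bs η y γ) (markAs κ (kind y) γ ≟ᵐ s) (hit γ))))
                                (markAs-hits h κ (kind y) s)
    where
    hit : ∀ γ → 1 ≤ arr κ s bs η y γ → markAs κ (kind y) γ ≡ s
    hit γ 0< with ∑-positive V _ 0<
    ... | x , _ , 0<t = trans (cong (λ κ → markAs κ (kind y) γ) (sym κ≡)) s≡
      where
      κ≡ : kind x ≡ κ
      κ≡ = 𝟙⁻ (kind x ≟ᶜ κ) (0<m*n⇒0<m (is κ x) (0<m*n⇒0<m (token κ y x) (0<m*n⇒0<m (token κ y x * 𝟙 (cur x η ≟ʷ bs)) 0<t)))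
      s≡ : mark x y γ ≡ s
      s≡ = 𝟙⁻ (mark x y γ ≟ᵐ s) (0<m*n⇒0<n (token κ y x * 𝟙 (cur x η ≟ʷ bs)) 0<t)

  -- Restricting the choice to at least half of the colours at most doubles the mean number of
  -- arrivals; the numerator of `2/Λ` is chosen for this.
  factor-average : ∀ κ s bs η y (ω : Colour → ℕ) → (∀ γ → ω γ ≤ 1) → h * h ≤ 2 * ∑ (colours h) ω →
    ∑ (colours h) (λ γ → ω γ * factor κ s (arr κ s bs η y γ) (dep κ bs η y)) ≤ ∑ (colours h) ω * unit
  factor-average κ s bs η y ω ω≤1 half =
    potential-step (colours h) ω (arr κ s bs η y) C v z u Γ R 0<Γ ω≤1 (arr≤dep κ s bs η y)
      (λ {γ} _ → ≤-trans (*-monoʳ-≤ v (arr≤burst κ s bs η y γ)) (≤-reflexive (vExp-spec h κ s)))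
      (vdep≤C κ s bs η y) (zdep≤C κ s bs η y)
      (*-cancelˡ-≤′ (d * b) (*-positive (0<h^ (digits s)) (0<h^ (burstExp κ s))) (begin
        d * b * (H * (v * u) * Λ)          ≡⟨ reorder d b H v u Λ ⟩
        H * d * (v * b) * (u * Λ)
          ≤⟨ *-monoˡ-≤ (u * Λ) (*-mono-≤ (arr-hits κ s bs η y) (≤-reflexive (vExp-spec h κ s))) ⟩
        h * h * (h * h) * (u * Λ)          ≤⟨ *-monoˡ-≤ (u * Λ) (*-monoʳ-≤ (h * h) half) ⟩
        h * h * (2 * ∑ω) * (u * Λ)
          ≡⟨ cong (λ t → h * h * (2 * ∑ω) * (u * t)) (trans Λ≡h³ (sym (zExp-spec h κ s))) ⟩
        Γ * (2 * ∑ω) * (u * (z * d * b))   ≡⟨ reorder′ Γ ∑ω u z d b ⟩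
        d * b * (Γ * ∑ω * (2 * (z * u)))   ∎))
    where
    open ≤-Reasoning
    v z u d b H ∑ω : ℕ
    v = vE κ s
    z = zE κ s
    u = dep κ bs η y
    d = h ^ digits s
    b = bE κ s
    H = ∑ (colours h) (λ γ → 𝟙 (1 ≤? arr κ s bs η y γ))
    ∑ω = ∑ (colours h) ω
    reorder : ∀ d b H v u l → d * b * (H * (v * u) * l) ≡ H * d * (v * b) * (u * l)
    reorder = solve-∀
    reorder′ : ∀ g o u z d b → g * (2 * o) * (u * (z * d * b)) ≡ d * b * (g * o * (2 * (z * u)))
    reorder′ = solve-∀

  -- Measured in powers of `unit`, the potentials start at 1 and their mean over the nodes stays at
  -- most 1. Hence no single potential ever exceeds the number of nodes.
  Tame : History → Set
  Tame η = ∑ nodes (λ ν → potential ν η) ≤ length nodes * unit ^ length η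

  private
    K : ℕ → ℕ
    K = levelConst k c

  -- Induction on the word: departures from `bs` are at most the arrivals there, and the potential
  -- bounds the arrivals at `s ∷ bs` in terms of them. The logarithm `ℓ` of the number of nodes
  -- enters additively and is absorbed by the spare factor `h ^ suc t`, because `suc ℓ ≤ c * h`.
  arrivals-bound : ∀ η → Tame η → ∀ κ bs → All (Valid h κ) bs → length bs ≤ maxLen k κ →
                   arrivals κ bs η ≤ K (length bs) * h ^ (capExp k κ ∸ weight bs)
  arrivals-bound η tame κ [] _ _ = classBound κ
  arrivals-bound η tame κ (s ∷ bs) (vs ∷ vbs) len = begin
    α                                              ≤⟨ <⇒≤ (*-cancelˡ-< v α (2 * b * (ℓ + Y + 1)) vA<) ⟩
    2 * b * (ℓ + Y + 1)                            ≡⟨ shape b ℓ (K j) (h ^ suc t) ⟩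
    2 * b * suc ℓ + 8 * K j * (b * h ^ suc t)
      ≤⟨ +-monoˡ-≤ (8 * K j * (b * h ^ suc t)) (*-monoʳ-≤ (2 * b) (≤-trans ℓ<ch (*-monoʳ-≤ c h≤h^suc))) ⟩
    2 * b * (c * h ^ suc t) + 8 * K j * (b * h ^ suc t) ≡⟨ collect b c (h ^ suc t) (K j) ⟩
    (8 * K j + 2 * c) * (b * h ^ suc t)
      ≡⟨ cong ((8 * K j + 2 * c) *_) (trans (sym (^-distribˡ-+-* h (burstExp κ s) (suc t))) (cong (h ^_) (sym E∸))) ⟩
    (8 * K j + 2 * c) * h ^ (capExp k κ ∸ weight (s ∷ bs)) ∎
    where
    open ≤-Reasoning
    α D v z b d j t Y : ℕ
    α = arrivals⁺ κ s bs η
    D = departures κ bs η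
    v = vE κ s
    z = zE κ s
    b = bE κ s
    d = h ^ digits s
    j = length bs
    spare : digits s + weight bs + suc (burstExp κ s) ≤ capExp k κ
    spare = spareExp {h} {k} κ s bs 2≤k vs vbs len
    t = capExp k κ ∸ (digits s + weight bs + suc (burstExp κ s))
    -- Chosen so that `z D ≤ h³ K h^(t+1)` reads `z D ≤ (Λ/4) Y`.
    Y = 4 * (K j * h ^ suc t)
    cap≡ : capExp k κ ≡ digits s + weight bs + suc (burstExp κ s) + t
    cap≡ = sym (m+[n∸m]≡n spare)
    E∸ : capExp k κ ∸ weight (s ∷ bs) ≡ burstExp κ s + suc t
    E∸ = trans (cong (_∸ weight (s ∷ bs)) (trans cap≡ (+-assoc (digits s + weight bs) (suc (burstExp κ s)) t)))
               (trans (m+n∸m≡n (digits s + weight bs) (suc (burstExp κ s) + t)) (sym (+-suc (burstExp κ s) t)))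
    E∸′ : capExp k κ ∸ weight bs ≡ digits s + (burstExp κ s + suc t)
    E∸′ = trans (cong (_∸ weight bs) (trans cap≡ (rearrange (digits s) (weight bs) (burstExp κ s) t)))
                (m+n∸m≡n (weight bs) (digits s + (burstExp κ s + suc t)))
      where
      rearrange : ∀ d w b t → d + w + suc b + t ≡ w + (d + (b + suc t))
      rearrange = solve-∀
    h≤h^suc : h ≤ h ^ suc t
    h≤h^suc = ≤-trans (≤-reflexive (sym (*-identityʳ h))) (*-monoʳ-≤ h (0<h^ t))
    shape : ∀ b ℓ K H → 2 * b * (ℓ + 4 * (K * H) + 1) ≡ 2 * b * suc ℓ + 8 * K * (b * H)
    shape = solve-∀
    collect : ∀ b c H K → 2 * b * (c * H) + 8 * K * (b * H) ≡ (8 * K + 2 * c) * (b * H)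
    collect = solve-∀
    D≤ : D ≤ K j * (d * (b * h ^ suc t))
    D≤ = begin
      D ≤⟨ departures≤arrivals κ bs η ⟩
      arrivals κ bs η ≤⟨ arrivals-bound η tame κ bs vbs (≤-trans (n≤1+n j) len) ⟩
      K j * h ^ (capExp k κ ∸ weight bs) ≡⟨ cong (λ m → K j * h ^ m) E∸′ ⟩
      K j * h ^ (digits s + (burstExp κ s + suc t))
        ≡⟨ cong (K j *_) (trans (^-distribˡ-+-* h (digits s) _) (cong (d *_) (^-distribˡ-+-* h (burstExp κ s) (suc t)))) ⟩
      K j * (d * (b * h ^ suc t)) ∎
    zD≤ : z * D ≤ q * h * h * Y
    zD≤ = begin
      z * D ≤⟨ *-monoʳ-≤ z D≤ ⟩
      z * (K j * (d * (b * h ^ suc t))) ≡⟨ reorder z (K j) d b (h ^ suc t) ⟩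
      z * d * b * (K j * h ^ suc t) ≡⟨ cong (_* (K j * h ^ suc t)) (zExp-spec h κ s) ⟩
      h * h * h * (K j * h ^ suc t) ≡⟨ cong (λ m → m * h * h * (K j * h ^ suc t)) h≡4q ⟩
      4 * q * h * h * (K j * h ^ suc t) ≡⟨ reorder′ q h (K j * h ^ suc t) ⟩
      q * h * h * Y ∎
      where
      reorder : ∀ z K d b H → z * (K * (d * (b * H))) ≡ z * d * b * (K * H)
      reorder = solve-∀
      reorder′ : ∀ q h K → 4 * q * h * h * K ≡ q * h * h * (4 * K)
      reorder′ = solve-∀
    4x≡Λ : 4 * (q * h * h) ≡ 2 + R
    4x≡Λ = trans (assoc q h) (trans (cong (λ m → m * h * h) (sym h≡4q)) (sym Λ≡h³))
      where
      assoc : ∀ q h → 4 * (q * h * h) ≡ 4 * q * h * h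
      assoc = solve-∀
    ν≤ : potential (κ , s , bs) η ≤ 2 ^ ℓ * unit ^ length η
    ν≤ = begin
      potential (κ , s , bs) η        ≤⟨ ∑-∈ (λ ν → potential ν η) (complete vs vbs len) ⟩
      ∑ nodes (λ ν → potential ν η)   ≤⟨ tame ⟩
      length nodes * unit ^ length η  ≤⟨ *-monoˡ-≤ (unit ^ length η) nodes≤ ⟩
      2 ^ ℓ * unit ^ length η         ∎
    powers : suc (2 * Γ) ^ (v * α) * R ^ (z * D) ≤ 2 ^ ℓ * ((2 * Γ) ^ (v * α) * Λ ^ (z * D))
    powers = *-cancelˡ-≤′ (unit ^ length η) (^-positive unit (length η) 0<unit) (begin
      unit ^ length η * (suc (2 * Γ) ^ (v * α) * R ^ (z * D)) ≡⟨ *-comm (unit ^ length η) _ ⟩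
      suc (2 * Γ) ^ (v * α) * R ^ (z * D) * unit ^ length η ≡⟨ potential-closed κ s bs η ⟨
      potential (κ , s , bs) η * ((2 * Γ) ^ (v * α) * Λ ^ (z * D))
        ≤⟨ *-monoˡ-≤ ((2 * Γ) ^ (v * α) * Λ ^ (z * D)) ν≤ ⟩
      2 ^ ℓ * unit ^ length η * ((2 * Γ) ^ (v * α) * Λ ^ (z * D)) ≡⟨ reorder (2 ^ ℓ) (unit ^ length η) _ ⟩
      unit ^ length η * (2 ^ ℓ * ((2 * Γ) ^ (v * α) * Λ ^ (z * D))) ∎)
      where
      reorder : ∀ a b c → a * b * c ≡ b * (a * c)
      reorder = solve-∀
    vA< : v * α < v * (2 * b * (ℓ + Y + 1))
    vA< = begin-strict
      v * α
        <⟨ potential-bound Γ R (q * h * h) ℓ Y (v * α) (z * D) 0<Γ (*-positive (*-positive 0<q 0<h) 0<h) 0<R 4x≡Λ zD≤ powers ⟩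
      2 * Γ * (ℓ + Y + 1) ≡⟨ cong (λ m → 2 * m * (ℓ + Y + 1)) (vExp-spec h κ s) ⟨
      2 * (v * b) * (ℓ + Y + 1) ≡⟨ reorder v b (ℓ + Y + 1) ⟩
      v * (2 * b * (ℓ + Y + 1)) ∎
      where
      reorder : ∀ v b x → 2 * (v * b) * x ≡ v * (2 * b * x)
      reorder = solve-∀

  -- The vertices x whose words are completed by colouring y.
  critical : History → Fin n → Fin n → ℕ
  critical η y x = token light y x * 𝟙 (length (cur x η) ≟ k)

  -- The factor `2 * suc k` over the bound for the mean leaves each critical vertex at most a share
  -- `1/(2(k+1))` of spoilt colours, hence one half for `k + 1` of them.
  threshold : History → Fin n → Fin n → ℕ
  threshold η y x = 2 * suc k * K k * h ^ (capExp k light ∸ (digitsAs light (kind y) + weight (cur x η)))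

  bad : History → Fin n → Colour → ℕ
  bad η y γ = ∑ V (λ x → critical η y x * 𝟙 (suc (threshold η y x) ≤? arrivals⁺ light (mark x y γ) (cur x η) η))

  -- Markov's inequality over the colours of `y`. By `arrivals-spread` the mean past load of the
  -- completed word is governed by the departures from `cur x η`, a word of length `k`, which
  -- `arrivals-bound` still covers.
  critical-bad : ∀ η y x → Tame η → Coloured η → kind x ≡ light → length (cur x η) ≡ k →
    ∑ (colours h) (λ γ → 𝟙 (suc (threshold η y x) ≤? arrivals⁺ light (mark x y γ) (cur x η) η)) * (2 * suc k) ≤ h * h
  critical-bad η y x tame col κ≡ len = *-cancelˡ-≤′ (K k * H) (*-positive (levelConst-positive k c k) (0<h^ E′)) (begin
    K k * H * (N * (2 * suc k))          ≡⟨ reorder (K k) H N (2 * suc k) ⟩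
    N * threshold η y x                  ≤⟨ *-monoʳ-≤ N (n≤1+n _) ⟩
    N * suc (threshold η y x)
      ≤⟨ ∑-markov (colours h) (λ γ → arrivals⁺ light (mark x y γ) bs η) (threshold η y x) ⟩
    ∑ (colours h) (λ γ → arrivals⁺ light (mark x y γ) bs η) ≤⟨ *-cancelˡ-≤′ (h ^ d) (0<h^ d) spread ⟩
    K k * H * (h * h)                    ∎)
    where
    open ≤-Reasoning
    bs : List Mark
    bs = cur x η
    d E′ H N : ℕ
    d = digitsAs light (kind y)
    E′ = capExp k light ∸ (d + weight bs)
    H = h ^ E′
    N = ∑ (colours h) (λ γ → 𝟙 (suc (threshold η y x) ≤? arrivals⁺ light (mark x y γ) bs η))
    reorder : ∀ K H N t → K * H * (N * t) ≡ N * (t * K * H)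
    reorder = solve-∀
    reorder′ : ∀ g K d H → g * (K * (d * H)) ≡ d * (K * H * g)
    reorder′ = solve-∀
    d≤2 : d ≤ 2
    d≤2 with kind y
    ... | light = ≤-refl
    ... | hub   = s≤s z≤n
    fits : d + weight bs ≤ capExp k light
    fits = ≤-trans (+-mono-≤ d≤2 (≤-trans (weight≤2*length bs) (≤-reflexive (cong (2 *_) len)))) (≤-reflexive (+-comm 2 (2 * k)))
    E∸ : capExp k light ∸ weight bs ≡ d + E′
    E∸ = trans (cong (_∸ weight bs) (trans (sym (m+[n∸m]≡n fits)) (rearrange d (weight bs) E′))) (m+n∸m≡n (weight bs) (d + E′))
      where
      rearrange : ∀ d w t → d + w + t ≡ w + (d + t)
      rearrange = solve-∀
    spread : h ^ d * ∑ (colours h) (λ γ → arrivals⁺ light (mark x y γ) bs η) ≤ h ^ d * (K k * H * (h * h))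
    spread = begin
      h ^ d * ∑ (colours h) (λ γ → arrivals⁺ light (mark x y γ) bs η) ≡⟨ *-comm (h ^ d) _ ⟩
      ∑ (colours h) (λ γ → arrivals⁺ light (mark x y γ) bs η) * h ^ d
        ≡⟨ cong (λ κ → ∑ (colours h) (λ γ → arrivals⁺ light (mark x y γ) bs η) * h ^ digitsAs κ (kind y)) κ≡ ⟨
      ∑ (colours h) (λ γ → arrivals⁺ light (mark x y γ) bs η) * h ^ digitsAs (kind x) (kind y)
        ≤⟨ arrivals-spread light x y bs η ⟩
      h * h * departures light bs η ≤⟨ *-monoʳ-≤ (h * h) (departures≤arrivals light bs η) ⟩
      h * h * arrivals light bs η
        ≤⟨ *-monoʳ-≤ (h * h) (arrivals-bound η tame light bs (subst (λ κ → All (Valid h κ) bs) κ≡ (cur-valid x col)) (≤-reflexive len)) ⟩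
      h * h * (K (length bs) * h ^ (capExp k light ∸ weight bs))
        ≡⟨ cong₂ (λ j m → h * h * (K j * h ^ m)) len E∸ ⟩
      h * h * (K k * h ^ (d + E′)) ≡⟨ cong (λ m → h * h * (K k * m)) (^-distribˡ-+-* h d E′) ⟩
      h * h * (K k * (h ^ d * H)) ≡⟨ reorder′ (h * h) (K k) (h ^ d) H ⟩
      h ^ d * (K k * H * (h * h)) ∎

  critical⁻ : ∀ η y x → 0 < critical η y x → kind x ≡ light × length (cur x η) ≡ k
  critical⁻ η y x 0<c = 𝟙⁻ (kind x ≟ᶜ light) (0<m*n⇒0<m (is light x) (0<m*n⇒0<m (token light y x) 0<c)) ,
                        𝟙⁻ (length (cur x η) ≟ k) (0<m*n⇒0<n (token light y x) 0<c)

  bad-few : ∀ η y → Tame η → Coloured η → ∑ V (critical η y) ≤ suc k → 2 * ∑ (colours h) (bad η y) ≤ h * h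
  bad-few η y tame col few = *-cancelˡ-≤′ (suc k) (s≤s z≤n) (begin
    suc k * (2 * ∑ (colours h) (bad η y))                      ≡⟨ reorder (suc k) (∑ (colours h) (bad η y)) ⟩
    ∑ (colours h) (bad η y) * (2 * suc k)
      ≡⟨ cong (_* (2 * suc k)) (trans (∑-swap (colours h) V _) (∑-cong V (λ x → ∑-*ˡ (colours h) (critical η y x) _))) ⟩
    ∑ V (λ x → critical η y x * N x) * (2 * suc k)             ≡⟨ ∑-*ʳ V (2 * suc k) _ ⟨
    ∑ V (λ x → critical η y x * N x * (2 * suc k))             ≤⟨ ∑-mono V pointwise ⟩
    ∑ V (λ x → critical η y x * (h * h))                       ≡⟨ ∑-*ʳ V (h * h) _ ⟩
    ∑ V (critical η y) * (h * h)                               ≤⟨ *-monoˡ-≤ (h * h) few ⟩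
    suc k * (h * h)                                            ∎)
    where
    open ≤-Reasoning
    N : Fin n → ℕ
    N x = ∑ (colours h) (λ γ → 𝟙 (suc (threshold η y x) ≤? arrivals⁺ light (mark x y γ) (cur x η) η))
    reorder : ∀ a b → a * (2 * b) ≡ b * (2 * a)
    reorder = solve-∀
    pointwise : ∀ x → critical η y x * N x * (2 * suc k) ≤ critical η y x * (h * h)
    pointwise x = ≤-trans (≤-reflexive (*-assoc (critical η y x) (N x) (2 * suc k))) (cases (0 <? critical η y x))
      where
      cases : Dec (0 < critical η y x) → critical η y x * (N x * (2 * suc k)) ≤ critical η y x * (h * h)
      cases (yes 0<c) with critical⁻ η y x 0<c
      ... | κ≡ , len = *-monoʳ-≤ (critical η y x) (critical-bad η y x tame col κ≡ len)
      cases (no ¬0<c) = subst (λ t → t * (N x * (2 * suc k)) ≤ t * (h * h)) (sym (n≤0⇒n≡0 (≮⇒≥ ¬0<c))) z≤n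

  good : History → Fin n → Colour → ℕ
  good η y γ = 𝟙 (bad η y γ ≟ 0)

  good-half : ∀ η y → Tame η → Coloured η → ∑ V (critical η y) ≤ suc k → h * h ≤ 2 * ∑ (colours h) (good η y)
  good-half η y tame col few = +-cancelʳ-≤ (h * h) _ _ (begin
    h * h + h * h
      ≡⟨ cong (h * h +_) (sym (+-identityʳ (h * h))) ⟩
    2 * (h * h)                                                      ≡⟨ cong (2 *_) (∑-colours-1 h) ⟨
    2 * ∑ (colours h) (λ _ → 1)
      ≤⟨ *-monoʳ-≤ 2 (∑-mono (colours h) good-or-bad) ⟩
    2 * ∑ (colours h) (λ γ → good η y γ + bad η y γ)                 ≡⟨ cong (2 *_) (∑-+ (colours h) _ _) ⟩
    2 * (∑ (colours h) (good η y) + ∑ (colours h) (bad η y))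
      ≡⟨ *-distribˡ-+ 2 (∑ (colours h) (good η y)) _ ⟩
    2 * ∑ (colours h) (good η y) + 2 * ∑ (colours h) (bad η y)
      ≤⟨ +-monoʳ-≤ _ (bad-few η y tame col few) ⟩
    2 * ∑ (colours h) (good η y) + h * h                             ∎)
    where
    open ≤-Reasoning
    good-or-bad : ∀ γ → 1 ≤ good η y γ + bad η y γ
    good-or-bad γ with bad η y γ
    ... | zero  = ≤-refl
    ... | suc m = s≤s z≤n

  LeafBound : History → Set
  LeafBound η = ∀ s bs → length bs ≡ k → arrivals⁺ light s bs η ≤ leafConst k c * h ^ (capExp k light ∸ weight (s ∷ bs))

  -- The load of a complete word changes only if some critical vertex moves there. Since `γ` is not
  -- bad for that vertex, the load was at most the threshold before, and each critical vertex adds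
  -- at most 1.
  leaf-step : ∀ η y γ → LeafBound η → ∑ V (critical η y) ≤ suc k → bad η y γ ≡ 0 → LeafBound ((y , γ) ∷ η)
  leaf-step η y γ leaf few ok s bs len with 0 <? arr light s bs η y γ
  ... | no ¬0< = ≤-trans (≤-reflexive (trans (cong (arrivals⁺ light s bs η +_) (n≤0⇒n≡0 (≮⇒≥ ¬0<))) (+-identityʳ _))) (leaf s bs len)
  ... | yes 0< with ∑-positive V _ 0<
  ...   | x , _ , 0<t = begin
    arrivals⁺ light s bs η + arr light s bs η y γ ≤⟨ +-mono-≤ below (≤-trans (∑-mono V arr≤critical) few) ⟩
    2 * suc k * K k * h ^ E′ + suc k
      ≤⟨ +-monoʳ-≤ (2 * suc k * K k * h ^ E′) (≤-trans (≤-reflexive (sym (*-identityʳ (suc k)))) (*-monoʳ-≤ (suc k) (0<h^ E′))) ⟩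
    2 * suc k * K k * h ^ E′ + suc k * h ^ E′     ≡⟨ *-distribʳ-+ (h ^ E′) (2 * suc k * K k) (suc k) ⟨
    leafConst k c * h ^ E′                        ∎
    where
    open ≤-Reasoning
    E′ : ℕ
    E′ = capExp k light ∸ (digits s + weight bs)
    0<token : 0 < token light y x
    0<token = 0<m*n⇒0<m (token light y x) (0<m*n⇒0<m (token light y x * 𝟙 (cur x η ≟ʷ bs)) 0<t)
    κ≡ : kind x ≡ light
    κ≡ = 𝟙⁻ (kind x ≟ᶜ light) (0<m*n⇒0<m (is light x) 0<token)
    s≡ : mark x y γ ≡ s
    s≡ = 𝟙⁻ (mark x y γ ≟ᵐ s) (0<m*n⇒0<n (token light y x * 𝟙 (cur x η ≟ʷ bs)) 0<t)
    bs≡ : cur x η ≡ bs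
    bs≡ = 𝟙⁻ (cur x η ≟ʷ bs) (0<m*n⇒0<n (token light y x) (0<m*n⇒0<m (token light y x * 𝟙 (cur x η ≟ʷ bs)) 0<t))
    digits≡ : digitsAs light (kind y) ≡ digits s
    digits≡ = trans (cong (λ κ → digitsAs κ (kind y)) (sym κ≡)) (trans (sym (digits-markAs (kind x) (kind y) γ)) (cong digits s≡))
    0<critical : 0 < critical η y x
    0<critical = *-positive 0<token (≤-reflexive (sym (𝟙-yes (length (cur x η) ≟ k) (trans (cong length bs≡) len))))
    below′ : arrivals⁺ light (mark x y γ) (cur x η) η ≤ threshold η y x
    below′ = ≮⇒≥ (λ lt → <-irrefl (sym ok) (≤-trans
      (*-positive 0<critical (≤-reflexive (sym (𝟙-yes (suc (threshold η y x) ≤? arrivals⁺ light (mark x y γ) (cur x η) η) lt))))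
      (∑-∈ (λ x → critical η y x * 𝟙 (suc (threshold η y x) ≤? arrivals⁺ light (mark x y γ) (cur x η) η)) (∈-allFin x))))
    below : arrivals⁺ light s bs η ≤ 2 * suc k * K k * h ^ E′
    below = subst₂ (λ s′ bs′ → arrivals⁺ light s′ bs′ η ≤ 2 * suc k * K k * h ^ E′) s≡ bs≡
              (≤-trans below′ (≤-reflexive (cong₂ (λ d bs → 2 * suc k * K k * h ^ (capExp k light ∸ (d + weight bs))) digits≡ bs≡)))
    arr≤critical : ∀ x → token light y x * 𝟙 (cur x η ≟ʷ bs) * 𝟙 (mark x y γ ≟ᵐ s) ≤ critical η y x
    arr≤critical x = ≤-trans (*-monoʳ-≤ (token light y x * 𝟙 (cur x η ≟ʷ bs)) (𝟙≤1 (mark x y γ ≟ᵐ s)))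
      (≤-trans (≤-reflexive (*-identityʳ _)) (*-monoʳ-≤ (token light y x) (𝟙-mono (cur x η ≟ʷ bs) (length (cur x η) ≟ k) (λ p → trans (cong length p) len))))

  step-average : ∀ η y (ω : Colour → ℕ) → (∀ γ → ω γ ≤ 1) → h * h ≤ 2 * ∑ (colours h) ω → Tame η →
    ∑ (colours h) (λ γ → ω γ * ∑ nodes (λ ν → potential ν ((y , γ) ∷ η))) ≤ ∑ (colours h) ω * (length nodes * unit ^ suc (length η))
  step-average η y ω ω≤1 half tame = begin
    ∑ (colours h) (λ γ → ω γ * ∑ nodes (λ ν → potential ν ((y , γ) ∷ η)))
      ≡⟨ ∑-cong (colours h) (λ γ → sym (∑-*ˡ nodes (ω γ) (λ ν → potential ν ((y , γ) ∷ η)))) ⟩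
    ∑ (colours h) (λ γ → ∑ nodes (λ ν → ω γ * potential ν ((y , γ) ∷ η)))
      ≡⟨ ∑-swap (colours h) nodes (λ γ ν → ω γ * potential ν ((y , γ) ∷ η)) ⟩
    ∑ nodes (λ ν → ∑ (colours h) (λ γ → ω γ * potential ν ((y , γ) ∷ η)))     ≤⟨ ∑-mono nodes pointwise ⟩
    ∑ nodes (λ ν → potential ν η * (∑ (colours h) ω * unit))
      ≡⟨ ∑-*ʳ nodes (∑ (colours h) ω * unit) (λ ν → potential ν η) ⟩
    ∑ nodes (λ ν → potential ν η) * (∑ (colours h) ω * unit)
      ≤⟨ *-monoˡ-≤ (∑ (colours h) ω * unit) tame ⟩
    length nodes * unit ^ length η * (∑ (colours h) ω * unit)
      ≡⟨ reorder (length nodes) (unit ^ length η) (∑ (colours h) ω) unit ⟩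
    ∑ (colours h) ω * (length nodes * (unit * unit ^ length η))               ∎
    where
    open ≤-Reasoning
    reorder : ∀ a b c u → a * b * (c * u) ≡ c * (a * (u * b))
    reorder = solve-∀
    exchange : ∀ a b c → a * (b * c) ≡ b * (a * c)
    exchange = solve-∀
    pointwise : ∀ ν → ∑ (colours h) (λ γ → ω γ * potential ν ((y , γ) ∷ η)) ≤ potential ν η * (∑ (colours h) ω * unit)
    pointwise (κ , s , bs) = begin
      ∑ (colours h) (λ γ → ω γ * (potential (κ , s , bs) η * f γ))
        ≡⟨ ∑-cong (colours h) (λ γ → exchange (ω γ) (potential (κ , s , bs) η) (f γ)) ⟩
      ∑ (colours h) (λ γ → potential (κ , s , bs) η * (ω γ * f γ))
        ≡⟨ ∑-*ˡ (colours h) (potential (κ , s , bs) η) (λ γ → ω γ * f γ) ⟩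
      potential (κ , s , bs) η * ∑ (colours h) (λ γ → ω γ * f γ)
        ≤⟨ *-monoʳ-≤ (potential (κ , s , bs) η) (factor-average κ s bs η y ω ω≤1 half) ⟩
      potential (κ , s , bs) η * (∑ (colours h) ω * unit) ∎
      where
      f : Colour → ℕ
      f γ = factor κ s (arr κ s bs η y γ) (dep κ bs η y)

  step : ∀ η y → Tame η → Coloured η → LeafBound η → ∑ V (critical η y) ≤ suc k →
         ∃ λ γ → γ ∈ colours h × Tame ((y , γ) ∷ η) × LeafBound ((y , γ) ∷ η)
  step η y tame col leaf few = choose (∑-average (colours h) (good η y) (λ γ → ∑ nodes (λ ν → potential ν ((y , γ) ∷ η)))
                                         (length nodes * unit ^ suc (length η)) (0<m*n⇒0<n 2 (≤-trans 0<Γ half))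
                                         (step-average η y (good η y) (λ γ → 𝟙≤1 (bad η y γ ≟ 0)) half tame))
    where
    half : h * h ≤ 2 * ∑ (colours h) (good η y)
    half = good-half η y tame col few
    choose : (∃ λ γ → γ ∈ colours h × 0 < good η y γ × ∑ nodes (λ ν → potential ν ((y , γ) ∷ η)) ≤ length nodes * unit ^ suc (length η)) →
             ∃ λ γ → γ ∈ colours h × Tame ((y , γ) ∷ η) × LeafBound ((y , γ) ∷ η)
    choose (γ , γ∈ , 0<good , le) = γ , γ∈ , le , leaf-step η y γ leaf few (𝟙⁻ (bad η y γ ≟ 0) 0<good)

  -- The bound on critical vertices in terms of the order alone: the length of a word depends on
  -- which vertices have been coloured, not on their colours.
  data Schedule : List (Fin n) → Set where
    []  : Schedule []
    _∷_ : ∀ {y ys} → ∑ V (λ x → token light y x * 𝟙 (∑ ys (λ z → ⟦ rel x z ⟧) ≟ k)) ≤ suc k →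
          Schedule ys → Schedule (y ∷ ys)

  length-cur : ∀ x η → length (cur x η) ≡ ∑ (map proj₁ η) (λ z → ⟦ rel x z ⟧)
  length-cur x [] = refl
  length-cur x ((y , γ) ∷ η) with rel x y
  ... | true  = cong suc (length-cur x η)
  ... | false = length-cur x η

  Outcome : List (Fin n) → Set
  Outcome ys = ∃ λ η → map proj₁ η ≡ ys × Coloured η × Tame η × LeafBound η

  prolong : ∀ {y ys} → ∑ V (λ x → token light y x * 𝟙 (∑ ys (λ z → ⟦ rel x z ⟧) ≟ k)) ≤ suc k → Outcome ys → Outcome (y ∷ ys)
  prolong {y} {ys} few (η , eq , col , tame , leaf) = attach (step η y tame col leaf few′)
    where
    same : ∀ x → critical η y x ≡ token light y x * 𝟙 (∑ ys (λ z → ⟦ rel x z ⟧) ≟ k)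
    same x = cong (λ l → token light y x * 𝟙 (l ≟ k)) (trans (length-cur x η) (cong (λ zs → ∑ zs (λ z → ⟦ rel x z ⟧)) eq))
    few′ : ∑ V (critical η y) ≤ suc k
    few′ = ≤-trans (≤-reflexive (∑-cong V same)) few
    attach : (∃ λ γ → γ ∈ colours h × Tame ((y , γ) ∷ η) × LeafBound ((y , γ) ∷ η)) → Outcome (y ∷ ys)
    attach (γ , γ∈ , tame′ , leaf′) = (y , γ) ∷ η , cong (y ∷_) eq , γ∈ ∷ col , tame′ , leaf′

  tame-[] : Tame []
  tame-[] = ≤-reflexive (∑-const nodes 1)

  run : ∀ {ys} → Schedule ys → Outcome ys
  run []          = [] , refl , [] , tame-[] , λ s bs len → z≤n
  run (few ∷ sch) = prolong few (run sch)

  level-mono : ∀ {i j} → i ≤ j → K i ≤ K j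
  level-mono {j = zero}  z≤n = ≤-refl
  level-mono {i} {suc j} i≤  with i ≟ suc j
  ... | yes refl = ≤-refl
  ... | no i≢    = ≤-trans (level-mono {i} {j} (≤-pred (≤∧≢⇒< i≤ i≢))) (≤-trans (m≤n*m (K j) 8) (m≤m+n _ _))

  load-bound : ∀ η → Tame η → LeafBound η → ∀ κ bs → All (Valid h κ) bs → length bs ≤ suc k →
               present κ bs η ≤ wordConst k c * h ^ (capExp k κ ∸ weight bs)
  load-bound η tame leaf κ bs vbs len = ≤-trans (present≤arrivals κ bs η) (cases κ bs vbs len)
    where
    level : ∀ κ bs → All (Valid h κ) bs → length bs ≤ maxLen k κ → length bs ≤ suc k →
            arrivals κ bs η ≤ wordConst k c * h ^ (capExp k κ ∸ weight bs)
    level κ bs vbs len len′ = ≤-trans (arrivals-bound η tame κ bs vbs len)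
      (*-monoˡ-≤ (h ^ (capExp k κ ∸ weight bs)) (≤-trans (level-mono len′) (m≤n+m _ (leafConst k c))))
    cases : ∀ κ bs → All (Valid h κ) bs → length bs ≤ suc k → arrivals κ bs η ≤ wordConst k c * h ^ (capExp k κ ∸ weight bs)
    cases hub bs vbs len = level hub bs vbs len len
    cases light [] vbs len = level light [] vbs z≤n len
    cases light (s ∷ bs) vbs len with length bs ≟ k
    ... | yes eq = ≤-trans (leaf s bs eq) (*-monoˡ-≤ (h ^ (capExp k light ∸ weight (s ∷ bs))) (m≤m+n (leafConst k c) _))
    ... | no ne  = level light (s ∷ bs) vbs (≤∧≢⇒< (≤-pred len) ne) len

-- Counting words

coarseMarks fineMarks : ℕ → List Mark
coarseMarks h = map coarse (upTo h)
fineMarks   h = map (λ γ → fine (proj₁ γ) (proj₂ γ)) (colours h)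

marks : ℕ → Class → List Mark
marks h light = coarseMarks h ++ fineMarks h
marks h hub   = coarseMarks h

words : ℕ → Class → ℕ → List (List Mark)
words h κ zero    = [] ∷ []
words h κ (suc r) = concatMap (λ s → map (s ∷_) (words h κ r)) (marks h κ)

∑-words : ∀ h κ r (f : List Mark → ℕ) → ∑ (words h κ (suc r)) f ≡ ∑ (marks h κ) (λ s → ∑ (words h κ r) (λ bs → f (s ∷ bs)))
∑-words h κ r f = trans (∑-concatMap (marks h κ) _ f) (∑-cong (marks h κ) (λ s → ∑-map (words h κ r) (s ∷_) f))

∑-coarse : ∀ h (f : Mark → ℕ) → ∑ (coarseMarks h) f ≡ ∑ (upTo h) (λ i → f (coarse i))
∑-coarse h f = ∑-map (upTo h) coarse f

∑-fine : ∀ h (f : Mark → ℕ) → ∑ (fineMarks h) f ≡ ∑ (upTo h) (λ i → ∑ (upTo h) (λ j → f (fine i j)))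
∑-fine h f = trans (∑-map (colours h) _ f) (∑-colours h _)

∈-colours⁺ : ∀ {h i j} → i < h → j < h → (i , j) ∈ colours h
∈-colours⁺ {h} {i} {j} i< j< = ∈-concatMap⁺ _ (lose (∈-upTo⁺ i<) (∈-map⁺ (i ,_) (∈-upTo⁺ j<)))

∈-marks : ∀ {h κ s} → Valid h κ s → s ∈ marks h κ
∈-marks {κ = light} (coarse i<)  = ∈-++⁺ˡ (∈-map⁺ coarse (∈-upTo⁺ i<))
∈-marks {κ = hub}   (coarse i<)  = ∈-map⁺ coarse (∈-upTo⁺ i<)
∈-marks {h}         (fine i< j<) = ∈-++⁺ʳ (coarseMarks h) (∈-map⁺ (λ γ → fine (proj₁ γ) (proj₂ γ)) (∈-colours⁺ i< j<))

∈-words : ∀ {h κ bs} → All (Valid h κ) bs → bs ∈ words h κ (length bs)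
∈-words []                 = here refl
∈-words {bs = s ∷ _} (v ∷ vs) = ∈-concatMap⁺ _ (lose (∈-marks v) (∈-map⁺ (s ∷_) (∈-words vs)))

maxDigits : Class → ℕ
maxDigits light = 2
maxDigits hub   = 1

digits≤maxDigits : ∀ h κ {s} → s ∈ marks h κ → digits s ≤ maxDigits κ
digits≤maxDigits h hub s∈ with ∈-map⁻ coarse s∈
... | _ , _ , refl = ≤-refl
digits≤maxDigits h light {coarse _} s∈ = s≤s z≤n
digits≤maxDigits h light {fine _ _} s∈ = ≤-refl

h*h^pred : ∀ h E → 1 ≤ E → h * h ^ (E ∸ 1) ≡ h ^ E
h*h^pred h (suc E) _ = refl

h²*h^pred : ∀ h E → 2 ≤ E → h * (h * h ^ (E ∸ 2)) ≡ h ^ E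
h²*h^pred h (suc (suc E)) _ = refl
h²*h^pred h (suc zero) (s≤s ())

∑-upTo-const : ∀ h c → ∑ (upTo h) (λ _ → c) ≡ h * c
∑-upTo-const h c = trans (∑-const (upTo h) c) (cong (_* c) (length-upTo h))

marks-mass : ∀ h κ E → maxDigits κ ≤ E → ∑ (marks h κ) (λ s → h ^ (E ∸ digits s)) ≤ 2 * h ^ E
marks-mass h hub E 1≤E = ≤-trans (≤-reflexive (trans (∑-coarse h _) (trans (∑-upTo-const h _) (h*h^pred h E 1≤E)))) (m≤m+n _ _)
marks-mass h light E 2≤E = ≤-reflexive (begin
  ∑ (coarseMarks h ++ fineMarks h) (λ s → h ^ (E ∸ digits s))       ≡⟨ ∑-++ (coarseMarks h) (fineMarks h) _ ⟩
  ∑ (coarseMarks h) (λ s → h ^ (E ∸ digits s)) + ∑ (fineMarks h) (λ s → h ^ (E ∸ digits s)) ≡⟨ cong₂ _+_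
    (trans (∑-coarse h _) (trans (∑-upTo-const h _) (h*h^pred h E (<⇒≤ 2≤E))))
    (trans (∑-fine h _) (trans (∑-cong (upTo h) (λ _ → ∑-upTo-const h _)) (trans (∑-upTo-const h _) (h²*h^pred h E 2≤E)))) ⟩
  h ^ E + h ^ E                                                     ≡⟨ cong (h ^ E +_) (+-identityʳ (h ^ E)) ⟨
  2 * h ^ E                                                         ∎)
  where open ≡-Reasoning

room : ∀ m r {d E} → d ≤ m → m * suc r ≤ E → m * r ≤ E ∸ d
room m r {d} {E} d≤m le = m+n≤o⇒m≤o∸n (m * r) (≤-trans (+-monoʳ-≤ (m * r) d≤m) (≤-trans (≤-reflexive (trans (+-comm (m * r) m) (sym (*-suc m r)))) le))

-- For each class, the sum of `h^(− digits s)` over its marks is at most 2, namely at most 1 for the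
-- coarse and 1 for the fine marks; `r` marks give `2^r`.
words-mass : ∀ h κ r E → maxDigits κ * r ≤ E → ∑ (words h κ r) (λ bs → h ^ (E ∸ weight bs)) ≤ 2 ^ r * h ^ E
words-mass h κ zero    E _  = ≤-refl
words-mass h κ (suc r) E le = begin
  ∑ (words h κ (suc r)) (λ bs → h ^ (E ∸ weight bs))                         ≡⟨ ∑-words h κ r _ ⟩
  ∑ (marks h κ) (λ s → ∑ (words h κ r) (λ bs → h ^ (E ∸ (digits s + weight bs))))
    ≡⟨ ∑-cong (marks h κ) (λ s → ∑-cong (words h κ r) (λ bs → cong (h ^_) (∸-+-assoc E (digits s) (weight bs)))) ⟨
  ∑ (marks h κ) (λ s → ∑ (words h κ r) (λ bs → h ^ (E ∸ digits s ∸ weight bs)))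
    ≤⟨ ∑-mono∈ (marks h κ) (λ {s} s∈ → words-mass h κ r (E ∸ digits s) (room (maxDigits κ) r (digits≤maxDigits h κ s∈) le)) ⟩
  ∑ (marks h κ) (λ s → 2 ^ r * h ^ (E ∸ digits s))                           ≡⟨ ∑-*ˡ (marks h κ) (2 ^ r) _ ⟩
  2 ^ r * ∑ (marks h κ) (λ s → h ^ (E ∸ digits s))
    ≤⟨ *-monoʳ-≤ (2 ^ r) (marks-mass h κ E (≤-trans (≤-trans (≤-reflexive (sym (*-identityʳ _))) (*-monoʳ-≤ (maxDigits κ) (s≤s z≤n))) le)) ⟩
  2 ^ r * (2 * h ^ E)                                                        ≡⟨ reorder (2 ^ r) (h ^ E) ⟩
  2 * 2 ^ r * h ^ E                                                          ∎
  where
  open ≤-Reasoning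
  reorder : ∀ a b → a * (2 * b) ≡ 2 * a * b
  reorder = solve-∀

words-occurrence : ∀ h κ p b (φ : Mark → ℕ) →
  (∀ E → maxDigits κ ≤ E → ∑ (marks h κ) (λ s → φ s * h ^ (E ∸ digits s)) * h ^ p ≤ b * h ^ E) →
  ∀ r E → maxDigits κ * r ≤ E → ∑ (words h κ r) (λ bs → h ^ (E ∸ weight bs) * ∑ bs φ) * h ^ p ≤ r * 2 ^ r * b * h ^ E
words-occurrence h κ p b φ rare zero    E _  = ≤-trans (≤-reflexive (cong (_* h ^ p) (trans (+-identityʳ _) (*-zeroʳ (h ^ E))))) z≤n
words-occurrence h κ p b φ rare (suc r) E le = begin
  ∑ (words h κ (suc r)) (λ bs → h ^ (E ∸ weight bs) * ∑ bs φ) * H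
    ≡⟨ cong (_* H) (trans (∑-words h κ r _) (∑-cong M split)) ⟩
  ∑ M (λ s → φ s * mass s + occ s) * H                             ≡⟨ cong (_* H) (∑-+ M _ occ) ⟩
  (∑ M (λ s → φ s * mass s) + ∑ M occ) * H
    ≡⟨ *-distribʳ-+ H (∑ M (λ s → φ s * mass s)) (∑ M occ) ⟩
  ∑ M (λ s → φ s * mass s) * H + ∑ M occ * H
    ≡⟨ cong (∑ M (λ s → φ s * mass s) * H +_) (∑-*ʳ M H occ) ⟨
  ∑ M (λ s → φ s * mass s) * H + ∑ M (λ s → occ s * H)
    ≤⟨ +-mono-≤ (*-monoˡ-≤ H (∑-mono∈ M (λ {s} s∈ → *-monoʳ-≤ (φ s) (words-mass h κ r (E ∸ digits s) (room (maxDigits κ) r (digits≤maxDigits h κ s∈) le)))))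
                                                                               (∑-mono∈ M (λ {s} s∈ → words-occurrence h κ p b φ rare r (E ∸ digits s) (room (maxDigits κ) r (digits≤maxDigits h κ s∈) le))) ⟩
  ∑ M (λ s → φ s * (2 ^ r * h ^ (E ∸ digits s))) * H + ∑ M (λ s → r * 2 ^ r * b * h ^ (E ∸ digits s))
    ≡⟨ cong₂ _+_ (cong (_* H) (trans (∑-cong M (λ s → exchange (φ s) (2 ^ r) _)) (∑-*ˡ M (2 ^ r) _))) (∑-*ˡ M (r * 2 ^ r * b) _) ⟩
  2 ^ r * ∑ M (λ s → φ s * h ^ (E ∸ digits s)) * H + r * 2 ^ r * b * ∑ M (λ s → h ^ (E ∸ digits s))
    ≤⟨ +-mono-≤ (≤-trans (≤-reflexive (*-assoc (2 ^ r) _ H)) (*-monoʳ-≤ (2 ^ r) (rare E small))) (*-monoʳ-≤ (r * 2 ^ r * b) (marks-mass h κ E small)) ⟩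
  2 ^ r * (b * h ^ E) + r * 2 ^ r * b * (2 * h ^ E)
    ≤⟨ +-monoˡ-≤ (r * 2 ^ r * b * (2 * h ^ E)) (m≤m+n _ (2 ^ r * (b * h ^ E))) ⟩
  2 ^ r * (b * h ^ E) + 2 ^ r * (b * h ^ E) + r * 2 ^ r * b * (2 * h ^ E) ≡⟨ collect r (2 ^ r) b (h ^ E) ⟩
  suc r * (2 * 2 ^ r) * b * h ^ E                                  ∎
  where
  open ≤-Reasoning
  M : List Mark
  M = marks h κ
  H : ℕ
  H = h ^ p
  mass occ : Mark → ℕ
  mass s = ∑ (words h κ r) (λ bs → h ^ (E ∸ digits s ∸ weight bs))
  occ s = ∑ (words h κ r) (λ bs → h ^ (E ∸ digits s ∸ weight bs) * ∑ bs φ)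
  small : maxDigits κ ≤ E
  small = ≤-trans (≤-trans (≤-reflexive (sym (*-identityʳ _))) (*-monoʳ-≤ (maxDigits κ) (s≤s z≤n))) le
  exchange : ∀ a b c → a * (b * c) ≡ b * (a * c)
  exchange = solve-∀
  collect : ∀ r t b H → t * (b * H) + t * (b * H) + r * t * b * (2 * H) ≡ suc r * (2 * t) * b * H
  collect = solve-∀
  pointwise : ∀ s bs → h ^ (E ∸ (digits s + weight bs)) * (φ s + ∑ bs φ) ≡ φ s * h ^ (E ∸ digits s ∸ weight bs) + h ^ (E ∸ digits s ∸ weight bs) * ∑ bs φ
  pointwise s bs = trans (cong (λ x → h ^ x * (φ s + ∑ bs φ)) (sym (∸-+-assoc E (digits s) (weight bs))))
                         (expand (h ^ (E ∸ digits s ∸ weight bs)) (φ s) (∑ bs φ))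
    where
    expand : ∀ a b c → a * (b + c) ≡ b * a + a * c
    expand = solve-∀
  split : ∀ s → ∑ (words h κ r) (λ bs → h ^ (E ∸ (digits s + weight bs)) * (φ s + ∑ bs φ)) ≡ φ s * mass s + occ s
  split s = trans (∑-cong (words h κ r) (pointwise s)) (trans (∑-+ (words h κ r) _ _) (cong (_+ occ s) (∑-*ˡ (words h κ r) (φ s) _)))

first : Mark → ℕ
first (coarse i) = i
first (fine i j) = i

-- Along an arc between light vertices both ends record the colour of the head in full, so agreement
-- of both digits can be demanded. Once a hub is involved, only the first digit is sure to be
-- recorded at both ends.
matched : Class → Class → Mark → Mark → ℕ
matched light light (fine i j) (fine i′ j′) = 𝟙 (i′ ≟ i) * 𝟙 (j′ ≟ j)
matched light light _          _            = 0
matched light hub   s          s′           = 𝟙 (first s′ ≟ first s)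
matched hub   _     s          s′           = 𝟙 (first s′ ≟ first s)

matchExp : Class → Class → ℕ
matchExp light light = 2
matchExp light hub   = 1
matchExp hub   _     = 1

∑-upTo-𝟙 : ∀ h i → ∑ (upTo h) (λ i′ → 𝟙 (i′ ≟ i)) ≤ 1
∑-upTo-𝟙 h i = NoRepeat-upTo h i

first-rare-coarse : ∀ h i E → 1 ≤ E → ∑ (coarseMarks h) (λ s → 𝟙 (first s ≟ i) * h ^ (E ∸ digits s)) * h ^ 1 ≤ h ^ E
first-rare-coarse h i E 1≤E = begin
  ∑ (coarseMarks h) (λ s → 𝟙 (first s ≟ i) * h ^ (E ∸ digits s)) * h ^ 1
    ≡⟨ cong₂ _*_ (trans (∑-coarse h _) (∑-*ʳ (upTo h) (h ^ (E ∸ 1)) _)) (*-identityʳ h) ⟩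
  ∑ (upTo h) (λ i′ → 𝟙 (i′ ≟ i)) * h ^ (E ∸ 1) * h
    ≤⟨ *-monoˡ-≤ h (*-monoˡ-≤ (h ^ (E ∸ 1)) (∑-upTo-𝟙 h i)) ⟩
  1 * h ^ (E ∸ 1) * h                                                     ≡⟨ reorder h (h ^ (E ∸ 1)) ⟩
  h * h ^ (E ∸ 1)                                                         ≡⟨ h*h^pred h E 1≤E ⟩
  h ^ E ∎
  where
  open ≤-Reasoning
  reorder : ∀ h a → 1 * a * h ≡ h * a
  reorder = solve-∀

first-rare-fine : ∀ h i E → 2 ≤ E → ∑ (fineMarks h) (λ s → 𝟙 (first s ≟ i) * h ^ (E ∸ digits s)) * h ^ 1 ≤ h ^ E
first-rare-fine h i E 2≤E = begin
  ∑ (fineMarks h) (λ s → 𝟙 (first s ≟ i) * h ^ (E ∸ digits s)) * h ^ 1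
    ≡⟨ cong₂ _*_ (trans (∑-fine h _) (trans (∑-cong (upTo h) (λ i′ → ∑-upTo-const h _)) (trans (∑-cong (upTo h) (λ i′ → exchange h (𝟙 (i′ ≟ i)) (h ^ (E ∸ 2)))) (∑-*ʳ (upTo h) (h * h ^ (E ∸ 2)) _)))) (*-identityʳ h) ⟩
  ∑ (upTo h) (λ i′ → 𝟙 (i′ ≟ i)) * (h * h ^ (E ∸ 2)) * h
    ≤⟨ *-monoˡ-≤ h (*-monoˡ-≤ (h * h ^ (E ∸ 2)) (∑-upTo-𝟙 h i)) ⟩
  1 * (h * h ^ (E ∸ 2)) * h                                               ≡⟨ reorder h (h * h ^ (E ∸ 2)) ⟩
  h * (h * h ^ (E ∸ 2))                                                   ≡⟨ h²*h^pred h E 2≤E ⟩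
  h ^ E ∎
  where
  open ≤-Reasoning
  exchange : ∀ a b c → a * (b * c) ≡ b * (a * c)
  exchange = solve-∀
  reorder : ∀ h a → 1 * a * h ≡ h * a
  reorder = solve-∀

first-rare : ∀ h κ i E → maxDigits κ ≤ E → ∑ (marks h κ) (λ s → 𝟙 (first s ≟ i) * h ^ (E ∸ digits s)) * h ^ 1 ≤ 2 * h ^ E
first-rare h hub   i E 1≤E = ≤-trans (first-rare-coarse h i E 1≤E) (m≤m+n _ _)
first-rare h light i E 2≤E = begin
  ∑ (coarseMarks h ++ fineMarks h) f * h ^ 1
    ≡⟨ cong (_* h ^ 1) (∑-++ (coarseMarks h) (fineMarks h) f) ⟩
  (∑ (coarseMarks h) f + ∑ (fineMarks h) f) * h ^ 1
    ≡⟨ *-distribʳ-+ (h ^ 1) (∑ (coarseMarks h) f) _ ⟩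
  ∑ (coarseMarks h) f * h ^ 1 + ∑ (fineMarks h) f * h ^ 1
    ≤⟨ +-mono-≤ (first-rare-coarse h i E (<⇒≤ 2≤E)) (first-rare-fine h i E 2≤E) ⟩
  h ^ E + h ^ E
    ≡⟨ cong (h ^ E +_) (+-identityʳ (h ^ E)) ⟨
  2 * h ^ E ∎
  where
  open ≤-Reasoning
  f : Mark → ℕ
  f s = 𝟙 (first s ≟ i) * h ^ (E ∸ digits s)

matched-rare : ∀ h κ κ′ s E → maxDigits κ′ ≤ E →
               ∑ (marks h κ′) (λ s′ → matched κ κ′ s s′ * h ^ (E ∸ digits s′)) * h ^ matchExp κ κ′ ≤ 2 * h ^ E
matched-rare h light hub   s E le = first-rare h hub (first s) E le
matched-rare h hub   κ′    s E le = first-rare h κ′ (first s) E le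
matched-rare h light light (coarse _) E le = ≤-trans (≤-reflexive (cong (_* h ^ 2) (∑-zero (marks h light)))) z≤n
matched-rare h light light (fine i j) E le = begin
  ∑ (coarseMarks h ++ fineMarks h) f * h ^ 2
    ≡⟨ cong (_* h ^ 2) (trans (∑-++ (coarseMarks h) (fineMarks h) f) (cong₂ _+_ (trans (∑-coarse h f) (∑-zero (upTo h))) (∑-fine h f))) ⟩
  ∑ (upTo h) (λ i′ → ∑ (upTo h) (λ j′ → 𝟙 (i′ ≟ i) * 𝟙 (j′ ≟ j) * h ^ (E ∸ 2))) * h ^ 2
    ≡⟨ cong (_* h ^ 2) (trans (∑-cong (upTo h) (λ i′ → trans (∑-*ʳ (upTo h) (h ^ (E ∸ 2)) _) (cong (_* h ^ (E ∸ 2)) (∑-*ˡ (upTo h) (𝟙 (i′ ≟ i)) _)))) (trans (∑-*ʳ (upTo h) (h ^ (E ∸ 2)) _) (cong (_* h ^ (E ∸ 2)) (∑-*ʳ (upTo h) _ _)))) ⟩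
  ∑ (upTo h) (λ i′ → 𝟙 (i′ ≟ i)) * ∑ (upTo h) (λ j′ → 𝟙 (j′ ≟ j)) * h ^ (E ∸ 2) * h ^ 2
    ≤⟨ *-monoˡ-≤ (h ^ 2) (*-monoˡ-≤ (h ^ (E ∸ 2)) (*-mono-≤ (∑-upTo-𝟙 h i) (∑-upTo-𝟙 h j))) ⟩
  1 * h ^ (E ∸ 2) * h ^ 2                              ≡⟨ reorder h (h ^ (E ∸ 2)) ⟩
  h * (h * h ^ (E ∸ 2))                                ≡⟨ h²*h^pred h E le ⟩
  h ^ E                                                ≤⟨ m≤m+n _ _ ⟩
  2 * h ^ E                                            ∎
  where
  open ≤-Reasoning
  f : Mark → ℕ
  f s′ = matched light light (fine i j) s′ * h ^ (E ∸ digits s′)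
  reorder : ∀ h a → 1 * a * (h * (h * 1)) ≡ h * (h * a)
  reorder = solve-∀

-- The host graph

data Vertex : Set where
  super : ℕ → Vertex
  item  : Class → List Mark → ℕ → Vertex

-- A number of coincidences rather than a truth value, so that summing it bounds the number of edges
-- without further work.
common : Class → Class → List Mark → List Mark → ℕ
common hub   hub   _  _   = 1
common hub   light bs bs′ = ∑ bs (λ s → ∑ bs′ (matched hub light s))
common light κ     bs bs′ = ∑ bs (λ s → ∑ bs′ (matched light κ s))

links : Vertex → Vertex → ℕ
links (super _)     _              = 1
links (item _ _ _)  (super _)      = 1
links (item κ bs _) (item κ′ bs′ _) = common κ κ′ bs bs′

word : Vertex → List Mark
word (super _)     = []
word (item _ bs _) = bs

does-cong : (d : Dec P₁) (d′ : Dec P₂) → (P₁ → P₂) → (P₂ → P₁) → does d ≡ does d′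
does-cong (yes _) (yes _) f g = refl
does-cong (yes p) (no ¬q) f g = ⊥-elim (¬q (f p))
does-cong (no ¬p) (yes q) f g = ⊥-elim (¬p (g q))
does-cong (no _)  (no _)  f g = refl

words-length : ∀ h κ r {bs} → bs ∈ words h κ r → length bs ≡ r
words-length h κ zero (here refl) = refl
words-length h κ (suc r) bs∈ with find (∈-concatMap⁻ (λ s → map (s ∷_) (words h κ r)) {xs = marks h κ} bs∈)
... | s , _ , q with ∈-map⁻ (s ∷_) q
...   | bs , bs∈′ , refl = cong suc (words-length h κ r bs∈′)

-- In `sizeConst` there are `2 + k` word lengths, a factor `(2 + k) * 2 ^ (2 + k) * 2` from
-- `words-occurrence` for each, and `W` copies per unit of average load. In `linkConst` the first
-- term counts the links of super vertices from either side, the second the four pairs of classes.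
sizeConst linkConst : ℕ → ℕ → ℕ
sizeConst k W = (2 + k) * (2 + k) * 2 ^ (2 + k) * 2 * W
linkConst k W = 2 * (k * (k + 2 * sizeConst k W)) + 4 * ((2 + k) * sizeConst k W * sizeConst k W)

module HostGraph (h k W : ℕ) (0<h : 0 < h) where

  slots : Class → List Mark → ℕ
  slots κ bs = W * h ^ (capExp k κ ∸ weight bs)

  block : Class → List Mark → List Vertex
  block κ bs = map (item κ bs) (upTo (slots κ bs))

  layer : Class → ℕ → List Vertex
  layer κ r = concatMap (block κ) (words h κ r)

  items : Class → List Vertex
  items κ = concatMap (layer κ) (upTo (2 + k))

  -- Room for the giants: among at most `k * h ^ (2 * k + 2)` arcs, at most `k * h ^ (2 * k)`
  -- vertices can have indegree `h²`.
  supers : List Vertex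
  supers = map super (upTo (k * h ^ (2 * k)))

  vertices : List Vertex
  vertices = supers ++ items light ++ items hub

  ∑-items : ∀ κ (f : Vertex → ℕ) → ∑ (items κ) f ≡
            ∑ (upTo (2 + k)) (λ r → ∑ (words h κ r) (λ bs → ∑ (upTo (slots κ bs)) (λ i → f (item κ bs i))))
  ∑-items κ f = trans (∑-concatMap (upTo (2 + k)) (layer κ) f) (∑-cong (upTo (2 + k)) (λ r →
    trans (∑-concatMap (words h κ r) (block κ) f) (∑-cong (words h κ r) (λ bs → ∑-map (upTo (slots κ bs)) (item κ bs) f))))

  ∑-vertices : ∀ (f : Vertex → ℕ) → ∑ vertices f ≡ ∑ supers f + (∑ (items light) f + ∑ (items hub) f)
  ∑-vertices f = trans (∑-++ supers (items light ++ items hub) f) (cong (∑ supers f +_) (∑-++ (items light) (items hub) f))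

  size : Class → ℕ
  size κ = ∑ (items κ) (λ _ → 1)

  ∑-items-bound : ∀ κ (f : Vertex → ℕ) b → (∀ bs i → length bs ≤ suc k → f (item κ bs i) ≤ b) → ∑ (items κ) f ≤ size κ * b
  ∑-items-bound κ f b f≤ = begin
    ∑ (items κ) f ≡⟨ ∑-items κ f ⟩
    ∑ (upTo (2 + k)) (λ r → ∑ (words h κ r) (λ bs → ∑ (upTo (slots κ bs)) (λ i → f (item κ bs i))))
      ≤⟨ ∑-mono∈ (upTo (2 + k)) (λ {r} r∈ → ∑-mono∈ (words h κ r) (λ {bs} bs∈ → ∑-mono (upTo (slots κ bs)) (λ i → ≤-trans (f≤ bs i (≤-trans (≤-reflexive (words-length h κ r bs∈)) (≤-pred (∈-upTo⁻ r∈)))) (≤-reflexive (sym (*-identityˡ b)))))) ⟩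
    ∑ (upTo (2 + k)) (λ r → ∑ (words h κ r) (λ bs → ∑ (upTo (slots κ bs)) (λ i → 1 * b)))
      ≡⟨ ∑-items κ (λ _ → 1 * b) ⟨
    ∑ (items κ) (λ _ → 1 * b) ≡⟨ ∑-*ʳ (items κ) b _ ⟩
    size κ * b ∎
    where open ≤-Reasoning

  private
    Z : ℕ
    Z = sizeConst k W

  fits : ∀ κ r → r ≤ suc k → maxDigits κ * r ≤ capExp k κ
  fits light r r≤ = ≤-trans (*-monoʳ-≤ 2 r≤) (≤-reflexive (double k))
    where
    double : ∀ k → 2 * suc k ≡ 2 * k + 2
    double = solve-∀
  fits hub r r≤ = ≤-trans (≤-reflexive (*-identityˡ r)) (≤-trans r≤ (≤-trans (s≤s (m≤m+n k (k + 0))) (≤-reflexive (+-comm 1 (2 * k)))))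

  items-occurrence : ∀ κ p (φ : Mark → ℕ) →
    (∀ E → maxDigits κ ≤ E → ∑ (marks h κ) (λ s → φ s * h ^ (E ∸ digits s)) * h ^ p ≤ 2 * h ^ E) →
    ∑ (items κ) (λ w → ∑ (word w) φ) * h ^ p ≤ Z * h ^ capExp k κ
  items-occurrence κ p φ rare = begin
    ∑ (items κ) (λ w → ∑ (word w) φ) * h ^ p
      ≡⟨ cong (_* h ^ p) (trans (∑-items κ _) (trans (∑-cong U (λ r → trans (∑-cong (words h κ r) slot) (∑-*ˡ (words h κ r) W _))) (∑-*ˡ U W _))) ⟩
    W * ∑ U occ * h ^ p
      ≡⟨ trans (*-assoc W _ (h ^ p)) (cong (W *_) (sym (∑-*ʳ U (h ^ p) occ))) ⟩
    W * ∑ U (λ r → occ r * h ^ p)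
      ≤⟨ *-monoʳ-≤ W (∑-bound U _ (λ {r} r∈ → level r (≤-pred (∈-upTo⁻ r∈)))) ⟩
    W * (length U * ((2 + k) * 2 ^ (2 + k) * 2 * h ^ capExp k κ))
      ≡⟨ cong (λ l → W * (l * ((2 + k) * 2 ^ (2 + k) * 2 * h ^ capExp k κ))) (length-upTo (2 + k)) ⟩
    W * ((2 + k) * ((2 + k) * 2 ^ (2 + k) * 2 * h ^ capExp k κ))
      ≡⟨ reorder W (2 + k) (2 ^ (2 + k)) (h ^ capExp k κ) ⟩
    Z * h ^ capExp k κ ∎
    where
    open ≤-Reasoning
    U : List ℕ
    U = upTo (2 + k)
    occ : ℕ → ℕ
    occ r = ∑ (words h κ r) (λ bs → h ^ (capExp k κ ∸ weight bs) * ∑ bs φ)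
    reorder : ∀ w a b c → w * (a * (a * b * 2 * c)) ≡ a * a * b * 2 * w * c
    reorder = solve-∀
    slot : ∀ bs → ∑ (upTo (slots κ bs)) (λ _ → ∑ bs φ) ≡ W * (h ^ (capExp k κ ∸ weight bs) * ∑ bs φ)
    slot bs = trans (∑-upTo-const (slots κ bs) (∑ bs φ)) (*-assoc W _ _)
    level : ∀ r → r ≤ suc k → occ r * h ^ p ≤ (2 + k) * 2 ^ (2 + k) * 2 * h ^ capExp k κ
    level r r≤ = ≤-trans (words-occurrence h κ p 2 φ rare r (capExp k κ) (fits κ r r≤))
      (*-monoˡ-≤ (h ^ capExp k κ) (*-monoˡ-≤ 2 (*-mono-≤ (m≤n⇒m≤1+n r≤) (^-monoʳ-≤ 2 (m≤n⇒m≤1+n r≤)))))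

  size≤ : ∀ κ → size κ ≤ Z * h ^ capExp k κ
  size≤ κ = begin
    ∑ (items κ) (λ _ → 1)
      ≡⟨ trans (∑-items κ _) (trans (∑-cong U (λ r → trans (∑-cong (words h κ r) (λ bs → trans (∑-upTo-const (slots κ bs) 1) (*-identityʳ (slots κ bs)))) (∑-*ˡ (words h κ r) W _))) (∑-*ˡ U W _)) ⟩
    W * ∑ U (λ r → ∑ (words h κ r) (λ bs → h ^ (capExp k κ ∸ weight bs)))
      ≤⟨ *-monoʳ-≤ W (∑-bound U _ (λ {r} r∈ → level r (≤-pred (∈-upTo⁻ r∈)))) ⟩
    W * (length U * ((2 + k) * 2 ^ (2 + k) * 2 * h ^ capExp k κ))
      ≡⟨ cong (λ l → W * (l * ((2 + k) * 2 ^ (2 + k) * 2 * h ^ capExp k κ))) (length-upTo (2 + k)) ⟩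
    W * ((2 + k) * ((2 + k) * 2 ^ (2 + k) * 2 * h ^ capExp k κ))
      ≡⟨ reorder W (2 + k) (2 ^ (2 + k)) (h ^ capExp k κ) ⟩
    Z * h ^ capExp k κ ∎
    where
    open ≤-Reasoning
    U : List ℕ
    U = upTo (2 + k)
    reorder : ∀ w a b c → w * (a * (a * b * 2 * c)) ≡ a * a * b * 2 * w * c
    reorder = solve-∀
    inflate : ∀ t → t ≤ (2 + k) * t * 2
    inflate t = ≤-trans (m≤n*m t (2 + k)) (m≤m*n ((2 + k) * t) 2)
    level : ∀ r → r ≤ suc k → ∑ (words h κ r) (λ bs → h ^ (capExp k κ ∸ weight bs)) ≤ (2 + k) * 2 ^ (2 + k) * 2 * h ^ capExp k κ
    level r r≤ = ≤-trans (words-mass h κ r (capExp k κ) (fits κ r r≤))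
      (*-monoˡ-≤ (h ^ capExp k κ) (≤-trans (^-monoʳ-≤ 2 (m≤n⇒m≤1+n r≤)) (inflate (2 ^ (2 + k)))))

  linkCount : Class → Class → ℕ
  linkCount κ κ′ = ∑ (items κ) (λ u → ∑ (items κ′) (links u))

  private
    Zpair : ℕ
    Zpair = (2 + k) * Z * Z

  -- Up to constants there are `h^(capExp k κ + capExp k κ′)` pairs, and a given mark finds a match
  -- in a fraction `h^(− matchExp κ κ′)` of them. The remaining exponent is `4k + 2` in every case.
  matched-links : ∀ κ κ′ → (∀ bs bs′ → common κ κ′ bs bs′ ≡ ∑ bs (λ s → ∑ bs′ (matched κ κ′ s))) →
                  capExp k κ + capExp k κ′ ≡ 4 * k + 2 + matchExp κ κ′ → linkCount κ κ′ ≤ Zpair * h ^ (4 * k + 2)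
  matched-links κ κ′ common≡ exp≡ = *-cancelˡ-≤′ H (^-positive h (matchExp κ κ′) 0<h) (begin
    H * linkCount κ κ′                                ≡⟨ trans (*-comm H _) (sym (∑-*ʳ (items κ) H _)) ⟩
    ∑ (items κ) (λ u → ∑ (items κ′) (links u) * H)
      ≤⟨ ∑-items-bound κ _ (suc k * (Z * h ^ capExp k κ′)) row ⟩
    size κ * (suc k * (Z * h ^ capExp k κ′))
      ≤⟨ *-mono-≤ (size≤ κ) (*-monoˡ-≤ (Z * h ^ capExp k κ′) (n≤1+n (suc k))) ⟩
    Z * h ^ capExp k κ * ((2 + k) * (Z * h ^ capExp k κ′))
      ≡⟨ reorder Z (h ^ capExp k κ) (2 + k) (h ^ capExp k κ′) ⟩
    Zpair * (h ^ capExp k κ * h ^ capExp k κ′)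
      ≡⟨ cong (Zpair *_) (trans (sym (^-distribˡ-+-* h (capExp k κ) (capExp k κ′))) (trans (cong (h ^_) exp≡) (^-distribˡ-+-* h (4 * k + 2) (matchExp κ κ′)))) ⟩
    Zpair * (h ^ (4 * k + 2) * H)                     ≡⟨ reorder′ Zpair (h ^ (4 * k + 2)) H ⟩
    H * (Zpair * h ^ (4 * k + 2))                     ∎)
    where
    open ≤-Reasoning
    H : ℕ
    H = h ^ matchExp κ κ′
    reorder : ∀ z a t b → z * a * (t * (z * b)) ≡ t * z * z * (a * b)
    reorder = solve-∀
    reorder′ : ∀ a b c → a * (b * c) ≡ c * (a * b)
    reorder′ = solve-∀
    links≡ : ∀ bs i κ″ → (∀ bs bs′ → common κ κ″ bs bs′ ≡ ∑ bs (λ s → ∑ bs′ (matched κ κ″ s))) →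
             ∑ (items κ″) (links (item κ bs i)) ≡ ∑ (items κ″) (λ w → ∑ bs (λ s → ∑ (word w) (matched κ κ″ s)))
    links≡ bs i κ″ eq = trans (∑-items κ″ _) (trans (∑-cong (upTo (2 + k)) (λ r → ∑-cong (words h κ″ r) (λ bs′ → ∑-cong (upTo (slots κ″ bs′)) (λ _ → eq bs bs′)))) (sym (∑-items κ″ _)))
    row : ∀ bs i → length bs ≤ suc k → ∑ (items κ′) (links (item κ bs i)) * H ≤ suc k * (Z * h ^ capExp k κ′)
    row bs i len = begin
      ∑ (items κ′) (links (item κ bs i)) * H
        ≡⟨ cong (_* H) (trans (links≡ bs i κ′ common≡) (∑-swap (items κ′) bs _)) ⟩
      ∑ bs (λ s → ∑ (items κ′) (λ w → ∑ (word w) (matched κ κ′ s))) * H ≡⟨ ∑-*ʳ bs H _ ⟨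
      ∑ bs (λ s → ∑ (items κ′) (λ w → ∑ (word w) (matched κ κ′ s)) * H)
        ≤⟨ ∑-bound bs (Z * h ^ capExp k κ′) (λ {s} _ → items-occurrence κ′ (matchExp κ κ′) (matched κ κ′ s) (matched-rare h κ κ′ s)) ⟩
      length bs * (Z * h ^ capExp k κ′) ≤⟨ *-monoˡ-≤ (Z * h ^ capExp k κ′) len ⟩
      suc k * (Z * h ^ capExp k κ′) ∎

  linkCount≤ : ∀ κ κ′ → linkCount κ κ′ ≤ Zpair * h ^ (4 * k + 2)
  linkCount≤ light light = matched-links light light (λ _ _ → refl) (exponents k)
    where
    exponents : ∀ k → 2 * k + 2 + (2 * k + 2) ≡ 4 * k + 2 + 2
    exponents = solve-∀
  linkCount≤ light hub = matched-links light hub (λ _ _ → refl) (exponents k)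
    where
    exponents : ∀ k → 2 * k + 2 + (2 * k + 1) ≡ 4 * k + 2 + 1
    exponents = solve-∀
  linkCount≤ hub light = matched-links hub light (λ _ _ → refl) (exponents k)
    where
    exponents : ∀ k → 2 * k + 1 + (2 * k + 2) ≡ 4 * k + 2 + 1
    exponents = solve-∀
  linkCount≤ hub hub = begin
    linkCount hub hub
      ≤⟨ ∑-items-bound hub _ (size hub) (λ bs i _ → ≤-trans (∑-items-bound hub (links (item hub bs i)) 1 (λ _ _ _ → ≤-refl)) (≤-reflexive (*-identityʳ (size hub)))) ⟩
    size hub * size hub ≤⟨ *-mono-≤ (size≤ hub) (size≤ hub) ⟩
    Z * h ^ (2 * k + 1) * (Z * h ^ (2 * k + 1)) ≡⟨ reorder Z (h ^ (2 * k + 1)) ⟩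
    Z * Z * (h ^ (2 * k + 1) * h ^ (2 * k + 1))
      ≡⟨ cong (Z * Z *_) (trans (sym (^-distribˡ-+-* h (2 * k + 1) (2 * k + 1))) (cong (h ^_) (exponents k))) ⟩
    Z * Z * h ^ (4 * k + 2) ≤⟨ *-monoˡ-≤ (h ^ (4 * k + 2)) (*-monoˡ-≤ Z (m≤n*m Z (2 + k))) ⟩
    Zpair * h ^ (4 * k + 2) ∎
    where
    open ≤-Reasoning
    reorder : ∀ z a → z * a * (z * a) ≡ z * z * (a * a)
    reorder = solve-∀
    exponents : ∀ k → 2 * k + 1 + (2 * k + 1) ≡ 4 * k + 2
    exponents = solve-∀

  total : ℕ
  total = ∑ vertices (λ _ → 1)

  superCount : ∑ supers (λ _ → 1) ≡ k * h ^ (2 * k)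
  superCount = trans (∑-map (upTo (k * h ^ (2 * k))) super _) (trans (∑-upTo-const (k * h ^ (2 * k)) 1) (*-identityʳ _))

  total≤ : total ≤ (k + 2 * Z) * h ^ (2 * k + 2)
  total≤ = begin
    total ≡⟨ ∑-vertices (λ _ → 1) ⟩
    ∑ supers (λ _ → 1) + (size light + size hub)
      ≤⟨ +-mono-≤ (≤-trans (≤-reflexive superCount) (*-monoʳ-≤ k (grow (2 * k) (m≤m+n (2 * k) 2))))
                                                     (+-mono-≤ (size≤ light) (≤-trans (size≤ hub) (*-monoʳ-≤ Z (grow (2 * k + 1) (+-monoʳ-≤ (2 * k) (s≤s z≤n)))))) ⟩
    k * H + (Z * H + Z * H) ≡⟨ collect k Z H ⟩
    (k + 2 * Z) * H ∎
    where
    open ≤-Reasoning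
    H : ℕ
    H = h ^ (2 * k + 2)
    grow : ∀ m → m ≤ 2 * k + 2 → h ^ m ≤ H
    grow m le = ≤-trans (m≤m*n (h ^ m) (h ^ (2 * k + 2 ∸ m)) {{>-nonZero (^-positive h (2 * k + 2 ∸ m) 0<h)}}) (≤-reflexive (^-split h le))
    collect : ∀ k z H → k * H + (z * H + z * H) ≡ (k + 2 * z) * H
    collect = solve-∀

  super-total : k * h ^ (2 * k) * total ≤ k * (k + 2 * Z) * h ^ (4 * k + 2)
  super-total = begin
    k * h ^ (2 * k) * total ≤⟨ *-monoʳ-≤ (k * h ^ (2 * k)) total≤ ⟩
    k * h ^ (2 * k) * ((k + 2 * Z) * h ^ (2 * k + 2))
      ≡⟨ reorder k (h ^ (2 * k)) (k + 2 * Z) (h ^ (2 * k + 2)) ⟩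
    k * (k + 2 * Z) * (h ^ (2 * k) * h ^ (2 * k + 2))
      ≡⟨ cong (k * (k + 2 * Z) *_) (trans (sym (^-distribˡ-+-* h (2 * k) (2 * k + 2))) (cong (h ^_) (exponents k))) ⟩
    k * (k + 2 * Z) * h ^ (4 * k + 2) ∎
    where
    open ≤-Reasoning
    reorder : ∀ k a z b → k * a * (z * b) ≡ k * z * (a * b)
    reorder = solve-∀
    exponents : ∀ k → 2 * k + (2 * k + 2) ≡ 4 * k + 2
    exponents = solve-∀

  items-row : ∀ κ → ∑ (items κ) (λ u → ∑ vertices (links u)) ≡ k * h ^ (2 * k) * size κ + (linkCount κ light + linkCount κ hub)
  items-row κ = begin
    ∑ (items κ) (λ u → ∑ vertices (links u))
      ≡⟨ ∑-cong (items κ) (λ u → ∑-vertices (links u)) ⟩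
    ∑ (items κ) (λ u → ∑ supers (links u) + (∑ (items light) (links u) + ∑ (items hub) (links u)))
      ≡⟨ ∑-+ (items κ) _ _ ⟩
    ∑ (items κ) (λ u → ∑ supers (links u)) + ∑ (items κ) (λ u → ∑ (items light) (links u) + ∑ (items hub) (links u))
      ≡⟨ cong₂ _+_ toSupers (∑-+ (items κ) _ _) ⟩
    k * h ^ (2 * k) * size κ + (linkCount κ light + linkCount κ hub) ∎
    where
    open ≡-Reasoning
    one : ∀ u i → links u (super i) ≡ 1
    one (super _)    i = refl
    one (item _ _ _) i = refl
    toSupers : ∑ (items κ) (λ u → ∑ supers (links u)) ≡ k * h ^ (2 * k) * size κ
    toSupers = trans (∑-cong (items κ) (λ u → trans (∑-map (upTo (k * h ^ (2 * k))) super (links u)) (trans (∑-cong (upTo (k * h ^ (2 * k))) (one u)) (trans (∑-upTo-const (k * h ^ (2 * k)) 1) (*-comm (k * h ^ (2 * k)) 1)))))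
                     (trans (∑-*ʳ (items κ) (k * h ^ (2 * k)) (λ _ → 1)) (*-comm (size κ) _))

  links-total : ∑ vertices (λ u → ∑ vertices (links u)) ≤ linkConst k W * h ^ (4 * k + 2)
  links-total = begin
    ∑ vertices (λ u → ∑ vertices (links u)) ≡⟨ ∑-vertices _ ⟩
    ∑ supers (λ u → ∑ vertices (links u)) + (∑ (items light) (λ u → ∑ vertices (links u)) + ∑ (items hub) (λ u → ∑ vertices (links u)))
      ≡⟨ cong₂ _+_ (trans (∑-map (upTo S) super _) (∑-upTo-const S total)) (cong₂ _+_ (items-row light) (items-row hub)) ⟩
    S * total + (S * size light + (linkCount light light + linkCount light hub) + (S * size hub + (linkCount hub light + linkCount hub hub)))
      ≡⟨ regroup S total (size light) (size hub) (linkCount light light) (linkCount light hub) (linkCount hub light) (linkCount hub hub) ⟩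
    S * total + S * (size light + size hub) + (linkCount light light + linkCount light hub + linkCount hub light + linkCount hub hub)
      ≤⟨ +-mono-≤ (+-mono-≤ super-total (≤-trans (*-monoʳ-≤ S (≤-trans (m≤n+m _ (∑ supers (λ _ → 1))) (≤-reflexive (sym (∑-vertices (λ _ → 1)))))) super-total))
                  (+-mono-≤ (+-mono-≤ (+-mono-≤ (linkCount≤ light light) (linkCount≤ light hub)) (linkCount≤ hub light)) (linkCount≤ hub hub)) ⟩
    T₁ * H + T₁ * H + (Zpair * H + Zpair * H + Zpair * H + Zpair * H) ≡⟨ collect T₁ Zpair H ⟩
    linkConst k W * H ∎
    where
    open ≤-Reasoning
    S T₁ H : ℕ
    S = k * h ^ (2 * k)
    T₁ = k * (k + 2 * Z)
    H = h ^ (4 * k + 2)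
    regroup : ∀ S t a b p q r s → S * t + (S * a + (p + q) + (S * b + (r + s))) ≡ S * t + S * (a + b) + (p + q + r + s)
    regroup = solve-∀
    collect : ∀ t z H → t * H + t * H + (z * H + z * H + z * H + z * H) ≡ (2 * t + 4 * z) * H
    collect = solve-∀

  Host : ℕ
  Host = length vertices

  vertex : Fin Host → Vertex
  vertex = lookup vertices

  linked : Fin Host → Fin Host → ℕ
  linked i j = links (vertex i) (vertex j) + links (vertex j) (vertex i)

  linked? : ∀ i j → Dec (i ≢ j × 1 ≤ linked i j)
  linked? i j = ¬? (i Finₚ.≟ j) ×-dec (1 ≤? linked i j)

  host : Graph Host
  host = record
    { adj    = λ i j → does (linked? i j)
    ; sym    = λ i j → does-cong (linked? i j) (linked? j i) (flipped i j) (flipped j i)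
    ; irrefl = λ i → dec-false (linked? i i) (λ p → proj₁ p refl)
    }
    where
    flipped : ∀ i j → i ≢ j × 1 ≤ linked i j → j ≢ i × 1 ≤ linked j i
    flipped i j (i≢j , l) = (λ p → i≢j (sym p)) , subst (1 ≤_) (+-comm (links (vertex i) (vertex j)) _) l

  host-edges : e host ≤ 2 * linkConst k W * h ^ (4 * k + 2)
  host-edges = begin
    e host ≡⟨ e≡∑ host ⟩
    ∑ (allFin Host) (λ i → ∑ (allFin Host) (λ j → ⟦ (toℕ i <ᵇ toℕ j) ∧ does (linked? i j) ⟧))
      ≤⟨ ∑-mono (allFin Host) (λ i → ∑-mono (allFin Host) (λ j → edge (toℕ i <ᵇ toℕ j) i j)) ⟩
    ∑ (allFin Host) (λ i → ∑ (allFin Host) (λ j → links (vertex i) (vertex j) + links (vertex j) (vertex i)))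
      ≡⟨ ∑-cong (allFin Host) (λ i → ∑-lookup vertices (λ w → links (vertex i) w + links w (vertex i))) ⟩
    ∑ (allFin Host) (λ i → ∑ vertices (λ w → links (vertex i) w + links w (vertex i)))
      ≡⟨ ∑-lookup vertices (λ u → ∑ vertices (λ w → links u w + links w u)) ⟩
    ∑ vertices (λ u → ∑ vertices (λ w → links u w + links w u))
      ≡⟨ trans (∑-cong vertices (λ u → ∑-+ vertices (links u) (λ w → links w u))) (∑-+ vertices _ _) ⟩
    L + ∑ vertices (λ u → ∑ vertices (λ w → links w u))
      ≡⟨ cong (L +_) (∑-swap vertices vertices (λ u w → links w u)) ⟩
    L + L ≤⟨ +-mono-≤ links-total links-total ⟩
    linkConst k W * h ^ (4 * k + 2) + linkConst k W * h ^ (4 * k + 2)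
      ≡⟨ double (linkConst k W) (h ^ (4 * k + 2)) ⟩
    2 * linkConst k W * h ^ (4 * k + 2) ∎
    where
    open ≤-Reasoning
    L : ℕ
    L = ∑ vertices (λ u → ∑ vertices (links u))
    double : ∀ a b → a * b + a * b ≡ 2 * a * b
    double = solve-∀
    positive : ∀ i j (d : Dec (i ≢ j × 1 ≤ linked i j)) → ⟦ does d ⟧ ≤ linked i j
    positive i j (yes (_ , l)) = l
    positive i j (no _)        = z≤n
    edge : ∀ b i j → ⟦ b ∧ does (linked? i j) ⟧ ≤ linked i j
    edge false i j = z≤n
    edge true  i j = positive i j (linked? i j)

  host-embeds : ∀ {n} (H : Graph n) (f : Fin n → Vertex) → (∀ x → f x ∈ vertices) → (∀ {x y} → f x ≡ f y → x ≡ y) →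
                (∀ x y → adj H x y ≡ true → 1 ≤ links (f x) (f y) + links (f y) (f x)) → H ⊆G host
  host-embeds H f f∈ inj link = (λ x → index (f∈ x)) , injective , edges
    where
    at : ∀ x → vertex (index (f∈ x)) ≡ f x
    at x = sym (lookup-index (f∈ x))
    injective : ∀ {x y} → index (f∈ x) ≡ index (f∈ y) → x ≡ y
    injective {x} {y} eq = inj (trans (sym (at x)) (trans (cong vertex eq) (at y)))
    edges : ∀ x y → adj H x y ≡ true → does (linked? (index (f∈ x)) (index (f∈ y))) ≡ true
    edges x y p = dec-true (linked? (index (f∈ x)) (index (f∈ y)))
      ((λ eq → adj-≢ (injective eq)) , subst₂ (λ u w → 1 ≤ links u w + links w u) (sym (at x)) (sym (at y)) (link x y p))
      where
      adj-≢ : x ≢ y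
      adj-≢ refl with trans (sym p) (irrefl H x)
      ... | ()

-- Enumeration of the nodes

nodesAbove : ℕ → Class → ℕ → Mark → List Node
nodesAbove h κ j s = map (λ bs → κ , s , bs) (words h κ j)

nodesOfLength : ℕ → Class → ℕ → List Node
nodesOfLength h κ j = concatMap (nodesAbove h κ j) (marks h κ)

nodesOfClass : ℕ → ℕ → Class → List Node
nodesOfClass h k κ = concatMap (nodesOfLength h κ) (upTo (maxLen k κ))

allNodes : ℕ → ℕ → List Node
allNodes h k = concatMap (nodesOfClass h k) (light ∷ hub ∷ [])

allNodes-complete : ∀ {h k κ s bs} → Valid h κ s → All (Valid h κ) bs → length bs < maxLen k κ → (κ , s , bs) ∈ allNodes h k
allNodes-complete {h} {k} {κ} {s} {bs} vs vbs len =
  ∈-concatMap⁺ (nodesOfClass h k) (lose (κ∈ κ) (∈-concatMap⁺ (nodesOfLength h κ) (lose (∈-upTo⁺ len) (∈-concatMap⁺ (nodesAbove h κ (length bs)) (lose (∈-marks vs) (∈-map⁺ (λ bs → κ , s , bs) (∈-words vbs)))))))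
  where
  κ∈ : ∀ κ → κ ∈ light ∷ hub ∷ []
  κ∈ light = here refl
  κ∈ hub   = there (here refl)

length≡∑ : ∀ (xs : List A) → length xs ≡ ∑ xs (λ _ → 1)
length≡∑ xs = sym (trans (∑-const xs 1) (*-identityʳ (length xs)))

marks-count : ∀ h κ → ∑ (marks h κ) (λ _ → 1) ≤ 2 * (h * h)
marks-count h = cases
  where
  open ≤-Reasoning
  m≤m*m : ∀ m → m ≤ m * m
  m≤m*m zero    = z≤n
  m≤m*m (suc m) = m≤m*n (suc m) (suc m)
  half : ∑ (coarseMarks h) (λ _ → 1) ≤ h * h
  half = ≤-trans (≤-reflexive (trans (∑-coarse h _) (trans (∑-upTo-const h 1) (*-identityʳ h)))) (m≤m*m h)
  cases : ∀ κ → ∑ (marks h κ) (λ _ → 1) ≤ 2 * (h * h)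
  cases hub   = ≤-trans half (m≤m+n (h * h) _)
  cases light = begin
    ∑ (coarseMarks h ++ fineMarks h) (λ _ → 1)                   ≡⟨ ∑-++ (coarseMarks h) (fineMarks h) _ ⟩
    ∑ (coarseMarks h) (λ _ → 1) + ∑ (fineMarks h) (λ _ → 1)
      ≤⟨ +-mono-≤ half (≤-reflexive (trans (∑-map (colours h) _ _) (∑-colours-1 h))) ⟩
    h * h + h * h                                                ≡⟨ cong (h * h +_) (+-identityʳ (h * h)) ⟨
    2 * (h * h)                                                  ∎

words-count : ∀ h κ r → ∑ (words h κ r) (λ _ → 1) ≤ (2 * (h * h)) ^ r
words-count h κ zero    = ≤-refl
words-count h κ (suc r) = begin
  ∑ (words h κ (suc r)) (λ _ → 1)                        ≡⟨ ∑-words h κ r _ ⟩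
  ∑ (marks h κ) (λ _ → ∑ (words h κ r) (λ _ → 1))
    ≡⟨ trans (∑-const (marks h κ) _) (cong (_* ∑ (words h κ r) (λ _ → 1)) (length≡∑ (marks h κ))) ⟩
  ∑ (marks h κ) (λ _ → 1) * ∑ (words h κ r) (λ _ → 1)    ≤⟨ *-mono-≤ (marks-count h κ) (words-count h κ r) ⟩
  2 * (h * h) * (2 * (h * h)) ^ r                        ∎
  where open ≤-Reasoning

-- The exponent of `2 * 2 ^ suc k * (2 * h²) ^ suc k` for `h = 2 ^ a`: two classes, at most
-- `k + 1 ≤ 2 ^ suc k` lengths, and at most `2 * h²` marks in each place.
nodeExp : ℕ → ℕ → ℕ
nodeExp k a = 1 + (suc k + (1 + 2 * a) * suc k)

n<2^n : ∀ n → n < 2 ^ n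
n<2^n zero    = s≤s z≤n
n<2^n (suc n) = begin-strict
  suc n          ≤⟨ n<2^n n ⟩
  2 ^ n          <⟨ m<m+n (2 ^ n) (m^n>0 2 n) ⟩
  2 ^ n + 2 ^ n  ≡⟨ cong (2 ^ n +_) (+-identityʳ (2 ^ n)) ⟨
  2 * 2 ^ n      ∎
  where open ≤-Reasoning

allNodes-count : ∀ a k → length (allNodes (2 ^ a) k) ≤ 2 ^ nodeExp k a
allNodes-count a k = begin
  length (allNodes h k)                          ≡⟨ length≡∑ (allNodes h k) ⟩
  ∑ (allNodes h k) (λ _ → 1)                     ≡⟨ ∑-concatMap (light ∷ hub ∷ []) (nodesOfClass h k) _ ⟩
  ∑ (nodesOfClass h k light) (λ _ → 1) + (∑ (nodesOfClass h k hub) (λ _ → 1) + 0)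
    ≤⟨ +-mono-≤ (class light (n≤1+n k)) (+-monoˡ-≤ 0 (class hub ≤-refl)) ⟩
  suc k * X ^ suc k + (suc k * X ^ suc k + 0)
    ≤⟨ *-monoʳ-≤ 2 (*-monoˡ-≤ (X ^ suc k) (<⇒≤ (n<2^n (suc k)))) ⟩
  2 * (2 ^ suc k * X ^ suc k)
    ≡⟨ cong (λ x → 2 * (2 ^ suc k * x)) (trans (cong (_^ suc k) X≡) (^-*-assoc 2 (1 + 2 * a) (suc k))) ⟩
  2 * (2 ^ suc k * 2 ^ ((1 + 2 * a) * suc k))
    ≡⟨ cong (2 *_) (^-distribˡ-+-* 2 (suc k) ((1 + 2 * a) * suc k)) ⟨
  2 ^ nodeExp k a                                ∎
  where
  open ≤-Reasoning
  h X : ℕ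
  h = 2 ^ a
  X = 2 * (h * h)
  X≡ : X ≡ 2 ^ (1 + 2 * a)
  X≡ = cong (2 *_) (trans (sym (^-distribˡ-+-* 2 a a)) (cong (λ t → 2 ^ (a + t)) (sym (+-identityʳ a))))
  1≤X : 1 ≤ X
  1≤X = *-positive {2} (s≤s z≤n) (*-positive (m^n>0 2 a) (m^n>0 2 a))
  len : ∀ κ j → j ≤ k → ∑ (nodesOfLength h κ j) (λ _ → 1) ≤ X ^ suc k
  len κ j j≤k = begin
    ∑ (nodesOfLength h κ j) (λ _ → 1)
      ≡⟨ trans (∑-concatMap (marks h κ) (nodesAbove h κ j) _) (∑-cong (marks h κ) (λ s → ∑-map (words h κ j) (λ bs → κ , s , bs) _)) ⟩
    ∑ (marks h κ) (λ _ → ∑ (words h κ j) (λ _ → 1))      ≡⟨ ∑-words h κ j (λ _ → 1) ⟨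
    ∑ (words h κ (suc j)) (λ _ → 1)                      ≤⟨ words-count h κ (suc j) ⟩
    X ^ suc j                                            ≤⟨ ^-monoʳ-≤ X {{>-nonZero 1≤X}} (s≤s j≤k) ⟩
    X ^ suc k                                            ∎
  class : ∀ κ → maxLen k κ ≤ suc k → ∑ (nodesOfClass h k κ) (λ _ → 1) ≤ suc k * X ^ suc k
  class κ max≤ = begin
    ∑ (nodesOfClass h k κ) (λ _ → 1)
      ≡⟨ ∑-concatMap (upTo (maxLen k κ)) (nodesOfLength h κ) _ ⟩
    ∑ (upTo (maxLen k κ)) (λ j → ∑ (nodesOfLength h κ j) (λ _ → 1))
      ≤⟨ ∑-bound (upTo (maxLen k κ)) (X ^ suc k) (λ {j} j∈ → len κ j (≤-pred (≤-trans (∈-upTo⁻ j∈) max≤))) ⟩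
    length (upTo (maxLen k κ)) * X ^ suc k
      ≤⟨ *-monoˡ-≤ (X ^ suc k) (≤-trans (≤-reflexive (length-upTo (maxLen k κ))) max≤) ⟩
    suc k * X ^ suc k                                    ∎

growthConst : ℕ → ℕ
growthConst k = 4 * k + 6

-- The exponent is linear in `a`, the logarithm of `h`, and already `a < 2 ^ a` is enough here.
nodeExp-bound : ∀ k a → suc (nodeExp k a) ≤ growthConst k * 2 ^ a
nodeExp-bound k a = begin
  2 + (suc k + (1 + 2 * a) * suc k)            ≡⟨ expand k a ⟩
  (2 * k + 4) * 1 + (2 * k + 2) * a
    ≤⟨ +-mono-≤ (*-monoʳ-≤ (2 * k + 4) (m^n>0 2 a)) (*-monoʳ-≤ (2 * k + 2) (<⇒≤ (n<2^n a))) ⟩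
  (2 * k + 4) * 2 ^ a + (2 * k + 2) * 2 ^ a    ≡⟨ collect k (2 ^ a) ⟩
  growthConst k * 2 ^ a                        ∎
  where
  open ≤-Reasoning
  expand : ∀ k a → 2 + (suc k + (1 + 2 * a) * suc k) ≡ (2 * k + 4) * 1 + (2 * k + 2) * a
  expand = solve-∀
  collect : ∀ k h → (2 * k + 4) * h + (2 * k + 2) * h ≡ (4 * k + 6) * h
  collect = solve-∀

module Rank {n} {K : Set} (_≟ᴷ_ : DecidableEquality K) (key : Fin n → K) where

  multiplicity : K → ℕ
  multiplicity κ = ∑ (allFin n) (λ z → 𝟙 (key z ≟ᴷ κ))

  -- Numbers the vertices of equal key; the rank becomes the slot, so it is enough that the slots of
  -- a label are no fewer than its multiplicity.
  rank : Fin n → ℕ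
  rank x = ∑ (allFin n) (λ z → 𝟙 (toℕ z <? toℕ x) * 𝟙 (key z ≟ᴷ key x))

  rank<multiplicity : ∀ x → rank x < multiplicity (key x)
  rank<multiplicity x = ∑-mono-< (allFin n) (λ z → ≤-trans (*-monoˡ-≤ _ (𝟙≤1 (toℕ z <? toℕ x))) (≤-reflexive (*-identityˡ _))) (∈-allFin x)
    (≤-trans (s≤s (≤-reflexive (cong (_* 𝟙 (key x ≟ᴷ key x)) (𝟙-no (toℕ x <? toℕ x) (<-irrefl refl)))))
             (≤-reflexive (sym (𝟙-yes (key x ≟ᴷ key x) refl))))

  rank-strict : ∀ {x y} → toℕ x < toℕ y → key x ≡ key y → rank x < rank y
  rank-strict {x} {y} x<y eq = ∑-mono-< (allFin n) (λ z → *-mono-≤ (𝟙-mono (toℕ z <? toℕ x) (toℕ z <? toℕ y) (λ p → <-trans p x<y))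
                                                                   (𝟙-mono (key z ≟ᴷ key x) (key z ≟ᴷ key y) (λ p → trans p eq))) (∈-allFin x)
    (≤-trans (s≤s (≤-reflexive (cong (_* 𝟙 (key x ≟ᴷ key x)) (𝟙-no (toℕ x <? toℕ x) (<-irrefl refl)))))
             (≤-reflexive (sym (cong₂ _*_ (𝟙-yes (toℕ x <? toℕ y) x<y) (𝟙-yes (key x ≟ᴷ key y) eq)))))

  rank-injective : ∀ {x y} → key x ≡ key y → rank x ≡ rank y → x ≡ y
  rank-injective {x} {y} keq req with <-cmp (toℕ x) (toℕ y)
  ... | tri< x<y _ _ = ⊥-elim (<-irrefl req (rank-strict x<y keq))
  ... | tri≈ _ x≡y _ = Finₚ.toℕ-injective x≡y
  ... | tri> _ _ y<x = ⊥-elim (<-irrefl (sym req) (rank-strict y<x (sym keq)))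

-- The embedding

⟦does⟧ : (d : Dec P₁) → ⟦ does d ⟧ ≡ 𝟙 d
⟦does⟧ (yes _) = refl
⟦does⟧ (no _)  = refl

matched-self : ∀ κx κy γ → κx ≢ hub ⊎ κy ≢ hub → matched κx κy (markAs κx κy γ) (markAs κy κy γ) ≡ 1
matched-self light light (i , j) _ = cong₂ _*_ (𝟙-yes (i ≟ i) refl) (𝟙-yes (j ≟ j) refl)
matched-self light hub   (i , j) _ = 𝟙-yes (i ≟ i) refl
matched-self hub   light (i , j) _ = 𝟙-yes (i ≟ i) refl
matched-self hub   hub   _ (inj₁ ne) = ⊥-elim (ne refl)
matched-self hub   hub   _ (inj₂ ne) = ⊥-elim (ne refl)

common-positive : ∀ κx κy bs bs′ γ → (κx ≡ hub → κy ≡ hub → ⊥) →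
                  markAs κx κy γ ∈ bs → markAs κy κy γ ∈ bs′ → 1 ≤ common κx κy bs bs′
common-positive hub   hub   bs bs′ γ ne s∈ s∈′ = ⊥-elim (ne refl refl)
common-positive light κy    bs bs′ γ ne s∈ s∈′ = ≤-trans (≤-reflexive (sym (matched-self light κy γ (inj₁ λ ()))))
  (≤-trans (∑-∈ (matched light κy (markAs light κy γ)) s∈′) (∑-∈ (λ s → ∑ bs′ (matched light κy s)) s∈))
common-positive hub   light bs bs′ γ ne s∈ s∈′ = ≤-trans (≤-reflexive (sym (matched-self hub light γ (inj₂ λ ()))))
  (≤-trans (∑-∈ (matched hub light (markAs hub light γ)) s∈′) (∑-∈ (λ s → ∑ bs′ (matched hub light s)) s∈))

module Embedding {n} {H : Graph n} (o : Orientation H) (k b h : ℕ) (0<h : 0 < h) (2≤k : 2 ≤ k) (out≤k : ∀ a → outdeg o a ≤ k)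
  (h≡ : h ≡ 2 ^ (2 + b)) (n≤ : n ≤ h ^ (2 * k + 2)) where

  open Orientation o using (indeg; arc-≢; adj⇒arc)

  c W : ℕ
  c = growthConst k
  W = wordConst k c

  V : List (Fin n)
  V = allFin n

  Giant : Fin n → Set
  Giant y = h * h ≤ indeg y

  giant? : ∀ y → Dec (Giant y)
  giant? y = h * h ≤? indeg y

  hub? : ∀ y → Dec (h ≤ indeg y)
  hub? y = h ≤? indeg y

  -- A giant is filed as `light`, but `Related` excludes it on both sides: its word stays empty and
  -- its colour is recorded nowhere.
  classify : Dec P₁ → Dec P₂ → Class
  classify (yes _) _       = light
  classify (no _)  (yes _) = hub
  classify (no _)  (no _)  = light

  kind : Fin n → Class
  kind y = classify (giant? y) (hub? y)

  kind-hub : ∀ y → kind y ≡ hub → h ≤ indeg y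
  kind-hub y eq = go (giant? y) (hub? y) eq
    where
    go : (d : Dec (Giant y)) (d′ : Dec (h ≤ indeg y)) → classify d d′ ≡ hub → h ≤ indeg y
    go (no _) (yes p) _ = p

  kind-light : ∀ y → ¬ Giant y → kind y ≡ light → indeg y < h
  kind-light y ¬g eq = go (giant? y) (hub? y) eq
    where
    go : (d : Dec (Giant y)) (d′ : Dec (h ≤ indeg y)) → classify d d′ ≡ light → indeg y < h
    go (yes g) _      _ = ⊥-elim (¬g g)
    go (no _) (no ¬p) _ = ≰⇒> ¬p

  -- Arcs between hubs are left out because hubs are pairwise adjacent in the host. If they were
  -- recorded, colouring one hub could extend more than `h` hub words, beyond the permitted burst.
  Related : Fin n → Fin n → Set
  Related x y = (¬ Giant x × ¬ Giant y) × (x ≡ y ⊎ (arc o x y ≡ true × ¬ (kind x ≡ hub × kind y ≡ hub)))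

  related? : ∀ x y → Dec (Related x y)
  related? x y = (¬? (giant? x) ×-dec ¬? (giant? y)) ×-dec
                 ((x Finₚ.≟ y) ⊎-dec ((arc o x y Boolₚ.≟ true) ×-dec ¬? ((kind x ≟ᶜ hub) ×-dec (kind y ≟ᶜ hub))))

  rel : Fin n → Fin n → Bool
  rel x y = does (related? x y)

  ⟦rel⟧ : ∀ x y → ⟦ rel x y ⟧ ≡ 𝟙 (related? x y)
  ⟦rel⟧ x y = ⟦does⟧ (related? x y)

  rel⁻ : ∀ x y → 0 < ⟦ rel x y ⟧ → Related x y
  rel⁻ x y p = 𝟙⁻ (related? x y) (subst (0 <_) (⟦rel⟧ x y) p)

  rel≤ : ∀ x y → ⟦ rel x y ⟧ ≤ 𝟙 (x Finₚ.≟ y) + ⟦ arc o x y ⟧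
  rel≤ x y = ≤-trans (≤-reflexive (⟦rel⟧ x y)) (go (related? x y))
    where
    go : (d : Dec (Related x y)) → 𝟙 d ≤ 𝟙 (x Finₚ.≟ y) + ⟦ arc o x y ⟧
    go (no _) = z≤n
    go (yes (_ , inj₁ p)) = ≤-trans (≤-reflexive (sym (𝟙-yes (x Finₚ.≟ y) p))) (m≤m+n _ _)
    go (yes (_ , inj₂ (p , _))) = ≤-trans (≤-reflexive (sym (cong ⟦_⟧ p))) (m≤n+m _ (𝟙 (x Finₚ.≟ y)))

  in-tokens : ∀ y → ∑ V (λ x → ⟦ rel x y ⟧) ≤ suc (indeg y)
  in-tokens y = ≤-trans (∑-mono V (λ x → rel≤ x y)) (≤-trans (≤-reflexive (∑-+ V _ _)) (+-monoˡ-≤ (indeg y) (NoRepeat-allFin n y)))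

  out-tokens : ∀ x → ∑ V (λ y → ⟦ rel x y ⟧) ≤ suc k
  out-tokens x = ≤-trans (∑-mono V (rel≤ x)) (≤-trans (≤-reflexive (∑-+ V _ _)) (+-mono-≤
    (≤-trans (∑-mono V (λ y → 𝟙-mono (x Finₚ.≟ y) (y Finₚ.≟ x) sym)) (NoRepeat-allFin n x)) (out≤k x)))

  tokenBound : ∀ κ y → ∑ V (λ x → 𝟙 (kind x ≟ᶜ κ) * ⟦ rel x y ⟧) ≤ h ^ tokenExp κ (kind y)
  tokenBound κ y = go (giant? y) κ (kind y) refl
    where
    drop : ∀ κ → ∑ V (λ x → 𝟙 (kind x ≟ᶜ κ) * ⟦ rel x y ⟧) ≤ ∑ V (λ x → ⟦ rel x y ⟧)
    drop κ = ∑-mono V (λ x → ≤-trans (*-monoˡ-≤ ⟦ rel x y ⟧ (𝟙≤1 (kind x ≟ᶜ κ))) (≤-reflexive (*-identityˡ _)))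
    small : kind y ≡ light → ¬ Giant y → ∀ κ → ∑ V (λ x → 𝟙 (kind x ≟ᶜ κ) * ⟦ rel x y ⟧) ≤ h ^ 1
    -- The vertex `y` is itself one of those whose word grows; the strict inequality `indeg y < h`
    -- makes room for it.
    small eq ¬g κ = ≤-trans (drop κ) (≤-trans (in-tokens y) (≤-trans (kind-light y ¬g eq) (≤-reflexive (sym (*-identityʳ h)))))
    onlySelf : kind y ≡ hub → ∀ x → 𝟙 (kind x ≟ᶜ hub) * ⟦ rel x y ⟧ ≤ 𝟙 (x Finₚ.≟ y)
    onlySelf eq x = ≤-trans (≤-reflexive (trans (cong (𝟙 (kind x ≟ᶜ hub) *_) (⟦rel⟧ x y)) (sym (𝟙-× (kind x ≟ᶜ hub) (related? x y)))))
      (𝟙-mono ((kind x ≟ᶜ hub) ×-dec related? x y) (x Finₚ.≟ y) λ { (_ , _ , inj₁ p) → p ; (q , _ , inj₂ (_ , ¬hubs)) → ⊥-elim (¬hubs (q , eq)) })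
    go : Dec (Giant y) → ∀ κ κ′ → kind y ≡ κ′ → ∑ V (λ x → 𝟙 (kind x ≟ᶜ κ) * ⟦ rel x y ⟧) ≤ h ^ tokenExp κ κ′
    go (yes g) κ κ′ eq = ≤-trans (drop κ) (≤-trans (≤-reflexive (trans (∑-cong V (λ x → trans (⟦rel⟧ x y) (𝟙-no (related? x y) (λ r → proj₂ (proj₁ r) g)))) (∑-zero V))) z≤n)
    go (no ¬g) light light eq = small eq ¬g light
    go (no ¬g) hub   light eq = small eq ¬g hub
    go (no ¬g) light hub eq = ≤-trans (drop light) (≤-trans (in-tokens y) (≤-trans (≰⇒> ¬g) (≤-reflexive (cong (h *_) (sym (*-identityʳ h))))))
    go (no ¬g) hub hub eq = ≤-trans (∑-mono V (onlySelf eq)) (≤-trans (NoRepeat-allFin n y) (≤-trans 0<h (≤-reflexive (sym (*-identityʳ h)))))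

  indeg-total : ∑ V indeg ≤ k * h ^ (2 * k + 2)
  indeg-total = begin
    ∑ V indeg             ≡⟨ ∑-swap V V (λ y x → ⟦ arc o x y ⟧) ⟩
    ∑ V (outdeg o)        ≤⟨ ∑-bound V k (λ {x} _ → out≤k x) ⟩
    length V * k          ≡⟨ cong (_* k) (length-allFin n) ⟩
    n * k                 ≤⟨ *-monoˡ-≤ k n≤ ⟩
    h ^ (2 * k + 2) * k   ≡⟨ *-comm _ k ⟩
    k * h ^ (2 * k + 2)   ∎
    where open ≤-Reasoning

  -- Markov's inequality for the indegrees, whose sum is at most `k n`.
  heavy-few : ∀ m {D : Fin n → Set} (D? : ∀ y → Dec (D y)) E → (∀ y → D y → h ^ m ≤ indeg y) → m + E ≡ 2 * k + 2 →
              ∑ V (λ y → 𝟙 (D? y)) ≤ k * h ^ E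
  heavy-few m D? E heavy eq = *-cancelˡ-≤′ (h ^ m) (^-positive h m 0<h) (begin
    h ^ m * ∑ V (λ y → 𝟙 (D? y))   ≡⟨ trans (*-comm (h ^ m) _) (sym (∑-*ʳ V (h ^ m) _)) ⟩
    ∑ V (λ y → 𝟙 (D? y) * h ^ m)   ≤⟨ ∑-mono V pointwise ⟩
    ∑ V indeg                      ≤⟨ indeg-total ⟩
    k * h ^ (2 * k + 2)            ≡⟨ cong (k *_) (trans (cong (h ^_) (sym eq)) (^-distribˡ-+-* h m E)) ⟩
    k * (h ^ m * h ^ E)            ≡⟨ exchange k (h ^ m) (h ^ E) ⟩
    h ^ m * (k * h ^ E)            ∎)
    where
    open ≤-Reasoning
    exchange : ∀ a b c → a * (b * c) ≡ b * (a * c)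
    exchange = solve-∀
    pointwise : ∀ y → 𝟙 (D? y) * h ^ m ≤ indeg y
    pointwise y with D? y
    ... | yes d = ≤-trans (≤-reflexive (*-identityˡ _)) (heavy y d)
    ... | no _  = z≤n

  classBound : ∀ κ → ∑ V (λ x → 𝟙 (kind x ≟ᶜ κ)) ≤ suc k * h ^ capExp k κ
  classBound light = begin
    ∑ V (λ x → 𝟙 (kind x ≟ᶜ light))    ≤⟨ ∑-bound V 1 (λ {x} _ → 𝟙≤1 (kind x ≟ᶜ light)) ⟩
    length V * 1                        ≡⟨ trans (*-identityʳ _) (length-allFin n) ⟩
    n                                   ≤⟨ n≤ ⟩
    h ^ (2 * k + 2)                     ≤⟨ m≤m+n _ _ ⟩
    suc k * h ^ (2 * k + 2)             ∎
    where open ≤-Reasoning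
  classBound hub = ≤-trans (heavy-few 1 (λ y → kind y ≟ᶜ hub) (2 * k + 1) (λ y p → ≤-trans (≤-reflexive (*-identityʳ h)) (kind-hub y p)) (odd+1 k))
                           (*-monoˡ-≤ (h ^ (2 * k + 1)) (n≤1+n k))
    where
    odd+1 : ∀ k → 1 + (2 * k + 1) ≡ 2 * k + 2
    odd+1 = solve-∀

  h≡4q : h ≡ 4 * 2 ^ b
  h≡4q = trans h≡ (four (2 ^ b))
    where
    four : ∀ t → 2 * (2 * t) ≡ 4 * t
    four = solve-∀

  nodeExp≤ : suc (nodeExp k (2 + b)) ≤ c * h
  nodeExp≤ = subst (λ t → suc (nodeExp k (2 + b)) ≤ c * t) (sym h≡) (nodeExp-bound k (2 + b))

  allNodes≤ : length (allNodes h k) ≤ 2 ^ nodeExp k (2 + b)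
  allNodes≤ = subst (λ t → length (allNodes t k) ≤ 2 ^ nodeExp k (2 + b)) (sym h≡) (allNodes-count (2 + b) k)

  module C = Colouring h k c (nodeExp k (2 + b)) (2 ^ b) kind rel h≡4q (m^n>0 2 b) 2≤k nodeExp≤
               tokenBound classBound (allNodes h k) allNodes≤ allNodes-complete
  open Process h k kind rel using (History; cur; mark; token; present; Coloured; cur-valid; is)

  -- If x is waiting only for y, then x itself has already been coloured unless x = y.
  schedule : ∀ {ys} → Eliminates o k ys → NoRepeat Finₚ._≟_ ys → C.Schedule ys
  schedule [] nr = C.[]
  schedule {y ∷ ys} (few ∷ el) nr = bound C.∷ schedule el (NoRepeat-tail Finₚ._≟_ {x = y} {xs = ys} nr)
    where
    t : Fin n → ℕ
    t x = token light y x * 𝟙 (∑ ys (λ z → ⟦ rel x z ⟧) ≟ k)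
    t≤1 : ∀ x → t x ≤ 1
    t≤1 x = *-mono-≤ (*-mono-≤ (𝟙≤1 (kind x ≟ᶜ light)) (⟦⟧≤1 (rel x y))) (𝟙≤1 (∑ ys (λ z → ⟦ rel x z ⟧) ≟ k))
    t⇒rel : ∀ x → 0 < t x → 0 < ⟦ rel x y ⟧
    t⇒rel x p = 0<m*n⇒0<n (is light x) (0<m*n⇒0<m (token light y x) p)
    y∉ : y ∉ ys
    y∉ = NoRepeat-head Finₚ._≟_ {xs = ys} nr
    open import Data.List.Membership.DecPropositional (Finₚ._≟_ {n}) using (_∈?_)
    -- `x` itself, `y` and the `k` coloured vertices related to `x` would be `k + 2` distinct ones,
    -- against the `k + 1` that `out-tokens` allows.
    overfull : ∀ x → x ∉ y ∷ ys → ¬ (0 < t x)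
    overfull x x∉ p = <-irrefl refl (begin-strict
      suc k                                                    <⟨ ≤-refl ⟩
      1 + (1 + k)
        ≤⟨ +-mono-≤ self (+-mono-≤ (t⇒rel x p) (≤-reflexive (sym (𝟙⁻ (∑ ys (λ z → ⟦ rel x z ⟧) ≟ k) (0<m*n⇒0<n (token light y x) p))))) ⟩
      ∑ (x ∷ y ∷ ys) (λ z → ⟦ rel x z ⟧)
        ≤⟨ ∑-support Finₚ._≟_ (x ∷ y ∷ ys) V (λ z → ⟦ rel x z ⟧) (NoRepeat-∷ Finₚ._≟_ x∉ nr) (λ _ _ → ∈-allFin _) ⟩
      ∑ V (λ z → ⟦ rel x z ⟧)                                  ≤⟨ out-tokens x ⟩
      suc k                                                    ∎)
      where
      open ≤-Reasoning
      ¬gx : ¬ Giant x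
      ¬gx = proj₁ (proj₁ (rel⁻ x y (t⇒rel x p)))
      self : 1 ≤ ⟦ rel x x ⟧
      self = ≤-reflexive (sym (trans (⟦rel⟧ x x) (𝟙-yes (related? x x) ((¬gx , ¬gx) , inj₁ refl))))
    inside : ∀ x → 0 < t x → x ∈ y ∷ ys
    inside x p with x ∈? (y ∷ ys)
    ... | yes x∈ = x∈
    ... | no x∉  = ⊥-elim (overfull x x∉ p)
    earlier : ∀ {x} → x ∈ ys → t x ≤ ⟦ arc o x y ⟧
    earlier {x} x∈ with 0 <? t x
    ... | no ¬p = ≤-trans (≮⇒≥ ¬p) z≤n
    ... | yes p with rel⁻ x y (t⇒rel x p)
    ...   | _ , inj₁ refl = ⊥-elim (y∉ x∈)
    ...   | _ , inj₂ (a , _) = ≤-trans (t≤1 x) (≤-reflexive (sym (cong ⟦_⟧ a)))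
    bound : ∑ V t ≤ suc k
    bound = ≤-trans (∑-support Finₚ._≟_ V (y ∷ ys) t (NoRepeat-allFin n) (λ {x} _ → inside x))
                    (+-mono-≤ (t≤1 y) (≤-trans (∑-mono∈ ys earlier) few))

  module Placement {ys : List (Fin n)} (ys↭ : ys ↭ V) (η : History) (η≡ : map proj₁ η ≡ ys)
    (coloured : Coloured η)
    (load : ∀ κ bs → All (Valid h κ) bs → length bs ≤ suc k → present κ bs η ≤ W * h ^ (capExp k κ ∸ weight bs)) where

    short : ∀ x → length (cur x η) ≤ suc k
    short x = begin
      length (cur x η)                         ≡⟨ C.length-cur x η ⟩
      ∑ (map proj₁ η) (λ z → ⟦ rel x z ⟧)      ≡⟨ cong (λ zs → ∑ zs (λ z → ⟦ rel x z ⟧)) η≡ ⟩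
      ∑ ys (λ z → ⟦ rel x z ⟧)                 ≡⟨ ∑-↭ ys↭ _ ⟩
      ∑ V (λ z → ⟦ rel x z ⟧)                  ≤⟨ out-tokens x ⟩
      suc k                                    ∎
      where open ≤-Reasoning

    colour-of : ∀ y → ∃ λ γ → (y , γ) ∈ η
    colour-of y with ∈-map⁻ proj₁ (subst (y ∈_) (sym η≡) (∈-resp-↭ (↭-sym ys↭) (∈-allFin y)))
    ... | (_ , γ) , γ∈ , refl = γ , γ∈

    mark∈cur : ∀ x y {γ η′} → (y , γ) ∈ η′ → rel x y ≡ true → mark x y γ ∈ cur x η′
    mark∈cur x y (here refl) p rewrite p = here refl
    mark∈cur x y (there {x = (y′ , _)} γ∈) p with rel x y′
    ... | true  = there (mark∈cur x y γ∈ p)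
    ... | false = mark∈cur x y γ∈ p

    Key : Set
    Key = Maybe (Class × List Mark)

    _≟ᵏ_ : DecidableEquality Key
    _≟ᵏ_ = Maybeₚ.≡-dec (×ₚ.≡-dec _≟ᶜ_ _≟ʷ_)

    keyAt : ∀ {x} → Dec (Giant x) → Key
    keyAt     (yes _) = nothing
    keyAt {x} (no _)  = just (kind x , cur x η)

    key : Fin n → Key
    key x = keyAt (giant? x)

    open Rank _≟ᵏ_ key
    open HostGraph h k W 0<h

    place : Key → ℕ → Vertex
    place nothing         i = super i
    place (just (κ , bs)) i = item κ bs i

    place-injective : ∀ {κ κ′ i i′} → place κ i ≡ place κ′ i′ → κ ≡ κ′ × i ≡ i′
    place-injective {nothing} {nothing} refl = refl , refl
    place-injective {just _}  {just _}  refl = refl , refl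
    place-injective {nothing} {just _}  ()
    place-injective {just _}  {nothing} ()

    position : Fin n → Vertex
    position x = place (key x) (rank x)

    position-injective : ∀ {x y} → position x ≡ position y → x ≡ y
    position-injective eq with place-injective eq
    ... | keq , req = rank-injective keq req

    keyAt-nothing : ∀ {x} (d : Dec (Giant x)) → keyAt d ≡ nothing → Giant x
    keyAt-nothing (yes g) _ = g

    keyAt-just : ∀ {x κ bs} (d : Dec (Giant x)) → keyAt d ≡ just (κ , bs) → kind x ≡ κ × cur x η ≡ bs
    keyAt-just (no _) refl = refl , refl

    giants-few : multiplicity nothing ≤ k * h ^ (2 * k)
    giants-few = heavy-few 2 (λ z → key z ≟ᵏ nothing) (2 * k)
      (λ y p → ≤-trans (≤-reflexive (cong (h *_) (*-identityʳ h))) (keyAt-nothing (giant? y) p)) (+-comm 2 (2 * k))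

    words-few : ∀ x → multiplicity (just (kind x , cur x η)) ≤ slots (kind x) (cur x η)
    words-few x = ≤-trans (∑-mono V pointwise) (load (kind x) (cur x η) (cur-valid x coloured) (short x))
      where
      pointwise : ∀ z → 𝟙 (key z ≟ᵏ just (kind x , cur x η)) ≤ is (kind x) z * 𝟙 (cur z η ≟ʷ cur x η)
      pointwise z = ≤-trans (𝟙-mono (key z ≟ᵏ just (kind x , cur x η)) ((kind z ≟ᶜ kind x) ×-dec (cur z η ≟ʷ cur x η)) (keyAt-just (giant? z)))
                            (≤-reflexive (𝟙-× (kind z ≟ᶜ kind x) (cur z η ≟ʷ cur x η)))

    item∈ : ∀ x i → i < slots (kind x) (cur x η) → item (kind x) (cur x η) i ∈ items (kind x)
    item∈ x i i< = ∈-concatMap⁺ (layer (kind x)) (lose (∈-upTo⁺ (s≤s (short x)))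
      (∈-concatMap⁺ (block (kind x)) (lose (∈-words (cur-valid x coloured)) (∈-map⁺ (item (kind x) (cur x η)) (∈-upTo⁺ i<)))))

    item∈vertices : ∀ κ {w} → w ∈ items κ → w ∈ vertices
    item∈vertices light w∈ = ∈-++⁺ʳ supers (∈-++⁺ˡ w∈)
    item∈vertices hub   w∈ = ∈-++⁺ʳ supers (∈-++⁺ʳ (items light) w∈)

    position∈ : ∀ x → position x ∈ vertices
    position∈ x = go (giant? x) (rank<multiplicity x)
      where
      go : (d : Dec (Giant x)) → rank x < multiplicity (keyAt d) → place (keyAt d) (rank x) ∈ vertices
      go (yes _) lt = ∈-++⁺ˡ (∈-map⁺ super (∈-upTo⁺ (<-≤-trans lt giants-few)))
      go (no _)  lt = item∈vertices (kind x) (item∈ x (rank x) (<-≤-trans lt (words-few x)))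

    arc-linked : ∀ x y → arc o x y ≡ true → 1 ≤ links (position x) (position y)
    arc-linked x y a = go (giant? x) (giant? y)
      where
      hubs : ∀ κ κ′ → κ ≡ hub → κ′ ≡ hub → 1 ≤ common κ κ′ (cur x η) (cur y η)
      hubs hub hub refl refl = ≤-refl
      items-linked : ¬ Giant x → ¬ Giant y → 1 ≤ common (kind x) (kind y) (cur x η) (cur y η)
      items-linked ¬gx ¬gy with (kind x ≟ᶜ hub) ×-dec (kind y ≟ᶜ hub) | colour-of y
      ... | yes (p , q) | _ = hubs (kind x) (kind y) p q
      -- Both words contain a mark of the same colour `γ`: `x` records its out-neighbour `y`, and
      -- `y` records itself.
      ... | no ¬hubs | γ , γ∈ = common-positive (kind x) (kind y) (cur x η) (cur y η) γ (λ p q → ¬hubs (p , q))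
        (mark∈cur x y γ∈ (dec-true (related? x y) ((¬gx , ¬gy) , inj₂ (a , ¬hubs))))
        (mark∈cur y y γ∈ (dec-true (related? y y) ((¬gy , ¬gy) , inj₁ refl)))
      go : (d : Dec (Giant x)) (d′ : Dec (Giant y)) → 1 ≤ links (place (keyAt d) (rank x)) (place (keyAt d′) (rank y))
      go (yes _) _       = ≤-refl
      go (no _)  (yes _) = ≤-refl
      go (no ¬gx) (no ¬gy) = items-linked ¬gx ¬gy

    embedded : H ⊆G host
    embedded = host-embeds H position position∈ position-injective λ x y p → linked-either x y (adj⇒arc x y p)
      where
      linked-either : ∀ x y → arc o x y ≡ true ⊎ arc o y x ≡ true → 1 ≤ links (position x) (position y) + links (position y) (position x)
      linked-either x y (inj₁ a) = ≤-trans (arc-linked x y a) (m≤m+n _ _)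
      linked-either x y (inj₂ a) = ≤-trans (arc-linked y x a) (m≤n+m _ (links (position x) (position y)))

  embedded : H ⊆G HostGraph.host h k W 0<h
  embedded = order (elimination o k out≤k n V (length-allFin n) (NoRepeat-allFin n))
    where
    colour : ∀ {ys} → ys ↭ V → C.Outcome ys → H ⊆G HostGraph.host h k W 0<h
    colour ys↭ (η , η≡ , coloured , tame , leaf) = Placement.embedded ys↭ η η≡ coloured (C.load-bound η tame leaf)
    order : (∃ λ ys → Eliminates o k ys × ys ↭ V) → H ⊆G HostGraph.host h k W 0<h
    order (ys , el , ys↭) = colour ys↭ (C.run (schedule el (λ z → ≤-trans (≤-reflexive (∑-↭ ys↭ _)) (NoRepeat-allFin n z))))

-- Choice of the scale and conclusion

power-scale : ∀ E n → 1 ≤ E → 1 ≤ n → ∃ λ b → n ≤ (2 ^ b) ^ E × (2 ^ b) ^ E ≤ 2 ^ E * n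
power-scale E (suc zero) 1≤E _ = 0 , ≤-reflexive (sym (^-zeroˡ E)) , ≤-trans (≤-reflexive (^-zeroˡ E)) (*-positive (m^n>0 2 E) (s≤s z≤n))
power-scale E (suc (suc m)) 1≤E _ with power-scale E (suc m) 1≤E (s≤s z≤n)
... | b , lo , hi with suc (suc m) ≤? (2 ^ b) ^ E
...   | yes p = b , p , ≤-trans hi (*-monoʳ-≤ (2 ^ E) (n≤1+n (suc m)))
-- Doubling the base multiplies the power by `2 ^ E`, which is at least 2 and hence enough to pass
-- from `suc m` to `suc (suc m)`.
...   | no ¬p = suc b , lower , upper
  where
  open ≤-Reasoning
  lower : suc (suc m) ≤ (2 ^ suc b) ^ E
  lower = begin
    suc (suc m)            ≤⟨ m≤m+n (suc (suc m)) m ⟩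
    suc (suc m) + m        ≡⟨ double m ⟩
    2 * suc m              ≤⟨ *-mono-≤ (≤-trans (≤-reflexive (sym (*-identityʳ 2))) (^-monoʳ-≤ 2 1≤E)) lo ⟩
    2 ^ E * (2 ^ b) ^ E    ≡⟨ ^-distrib-* 2 (2 ^ b) E ⟨
    (2 ^ suc b) ^ E        ∎
    where
    double : ∀ m → suc (suc m) + m ≡ 2 * suc m
    double = solve-∀
  upper : (2 ^ suc b) ^ E ≤ 2 ^ E * suc (suc m)
  upper = begin
    (2 ^ suc b) ^ E        ≡⟨ ^-distrib-* 2 (2 ^ b) E ⟩
    2 ^ E * (2 ^ b) ^ E    ≤⟨ *-monoʳ-≤ (2 ^ E) (<⇒≤ (≰⇒> ¬p)) ⟩
    2 ^ E * suc (suc m)    ∎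

-- Since `(4k+2)(k+1) = (2k+2)(2k+1)`, the `(k+1)`-st power of `h^(4k+2)` is the `(2k+1)`-st power
-- of `h^(2k+2)`, which is of order `n`. The 8 combines the 4 in `h = 4 * 2 ^ b` with the 2 lost in
-- rounding `n` up to a power.
final-bound : ∀ k L h n m → m ≤ L * h ^ (4 * k + 2) → h ^ (2 * k + 2) ≤ 8 ^ (2 * k + 2) * n →
              m ^ suc k ≤ (L * 8 ^ (4 * k + 2)) ^ suc k * n ^ (2 * k + 1)
final-bound k L h n m m≤ h≤ = begin
  m ^ suc k                                                         ≤⟨ ^-monoˡ-≤ (suc k) m≤ ⟩
  (L * h ^ (4 * k + 2)) ^ suc k
    ≡⟨ ^-distrib-* L (h ^ (4 * k + 2)) (suc k) ⟩
  L ^ suc k * (h ^ (4 * k + 2)) ^ suc k                             ≡⟨ cong (L ^ suc k *_) (transpose h) ⟩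
  L ^ suc k * (h ^ (2 * k + 2)) ^ (2 * k + 1)
    ≤⟨ *-monoʳ-≤ (L ^ suc k) (^-monoˡ-≤ (2 * k + 1) h≤) ⟩
  L ^ suc k * (8 ^ (2 * k + 2) * n) ^ (2 * k + 1)
    ≡⟨ cong (L ^ suc k *_) (^-distrib-* (8 ^ (2 * k + 2)) n (2 * k + 1)) ⟩
  L ^ suc k * ((8 ^ (2 * k + 2)) ^ (2 * k + 1) * n ^ (2 * k + 1))
    ≡⟨ cong (λ t → L ^ suc k * (t * n ^ (2 * k + 1))) (sym (transpose 8)) ⟩
  L ^ suc k * ((8 ^ (4 * k + 2)) ^ suc k * n ^ (2 * k + 1))         ≡⟨ *-assoc (L ^ suc k) _ _ ⟨
  L ^ suc k * (8 ^ (4 * k + 2)) ^ suc k * n ^ (2 * k + 1)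
    ≡⟨ cong (_* n ^ (2 * k + 1)) (^-distrib-* L (8 ^ (4 * k + 2)) (suc k)) ⟨
  (L * 8 ^ (4 * k + 2)) ^ suc k * n ^ (2 * k + 1)                   ∎
  where
  open ≤-Reasoning
  exponents : ∀ k → (4 * k + 2) * suc k ≡ (2 * k + 2) * (2 * k + 1)
  exponents = solve-∀
  transpose : ∀ t → (t ^ (4 * k + 2)) ^ suc k ≡ (t ^ (2 * k + 2)) ^ (2 * k + 1)
  transpose t = trans (^-*-assoc t (4 * k + 2) (suc k)) (trans (cong (t ^_) (exponents k)) (sym (^-*-assoc t (2 * k + 2) (2 * k + 1))))

edgeConst : ℕ → ℕ
edgeConst k = 2 * linkConst k (wordConst k (growthConst k))

emptyGraph : Graph 0
emptyGraph = record { adj = λ () ; sym = λ () ; irrefl = λ () }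

theorem1p3 : (d : ℚ) → 1ℚ ℚ.< d →
    Σ ℕ λ C → (n : ℕ) → Σ ℕ λ N → Σ (Graph N) λ G →
    (e G ^ suc (ceilℕ d) ≤ C ^ suc (ceilℕ d) * n ^ (2 * ceilℕ d + 1))
    × Universal d n G
theorem1p3 d 1<d = edgeConst k * 8 ^ (4 * k + 2) , construct
  where
  k : ℕ
  k = ceilℕ d
  Goal : ℕ → Set
  Goal n = Σ ℕ λ N → Σ (Graph N) λ G →
           (e G ^ suc k ≤ (edgeConst k * 8 ^ (4 * k + 2)) ^ suc k * n ^ (2 * k + 1)) × Universal d n G
  construct⁺ : ∀ n → (∃ λ b → suc n ≤ (2 ^ b) ^ (2 * k + 2) × (2 ^ b) ^ (2 * k + 2) ≤ 2 ^ (2 * k + 2) * suc n) → Goal (suc n)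
  construct⁺ n (b , lo , hi) = U.Host , U.host , final-bound k (edgeConst k) h (suc n) (e U.host) U.host-edges h≤ , universal
    where
    E h : ℕ
    E = 2 * k + 2
    -- The factor 4 over `2 ^ b` makes `h³/4`, the block length of the decay, an integer.
    h = 2 ^ (2 + b)
    0<h : 0 < h
    0<h = m^n>0 2 (2 + b)
    h≡4* : h ≡ 4 * 2 ^ b
    h≡4* = ^-distribˡ-+-* 2 2 b
    n≤ : suc n ≤ h ^ E
    n≤ = ≤-trans lo (^-monoˡ-≤ E (^-monoʳ-≤ 2 (m≤n+m b 2)))
    h≤ : h ^ E ≤ 8 ^ E * suc n
    h≤ = begin
      h ^ E                   ≡⟨ trans (cong (_^ E) h≡4*) (^-distrib-* 4 (2 ^ b) E) ⟩
      4 ^ E * (2 ^ b) ^ E     ≤⟨ *-monoʳ-≤ (4 ^ E) hi ⟩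
      4 ^ E * (2 ^ E * suc n) ≡⟨ *-assoc (4 ^ E) (2 ^ E) (suc n) ⟨
      4 ^ E * 2 ^ E * suc n   ≡⟨ cong (_* suc n) (^-distrib-* 4 2 E) ⟨
      8 ^ E * suc n           ∎
      where open ≤-Reasoning
    module U = HostGraph h k (wordConst k (growthConst k)) 0<h
    universal : Universal d (suc n) U.host
    universal H dense = embed (orientation H d 1<d dense)
      where
      embed : (∃ λ (o : Orientation H) → ∀ a → outdeg o a ≤ k) → H ⊆G U.host
      embed (o , out≤k) = Embedding.embedded o k b h 0<h (2≤ceilℕ d 1<d) out≤k refl n≤
  construct : ∀ n → Goal n
  construct zero    = 0 , emptyGraph , z≤n , λ H _ → (λ ()) , (λ { {()} }) , λ ()
  construct (suc n) = construct⁺ n (power-scale (2 * k + 2) (suc n) (≤-trans (s≤s z≤n) (m≤n+m 2 (2 * k))) (s≤s z≤n))
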